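{- Let $n\ge 3$, consider the arc-reversal walk on the cycle graph $C_n$ with vertex set $\{0,\ldots,n-1\}$, where $i$ and $j$ are adjacent if and only if $i-j\equiv\pm1\pmod n$, and let $i$ be any vertex. The walk is $n$-periodic at vertex $i$. If $n=2m$, there is perfect state transfer from vertex $i$ to vertex $i+m \pmod n$ at time $m$. If $n=4\ell$, there is peak state transfer from $i$ to the vertices $i\pm\ell\pmod n$ at time $\ell$. There is no peak state transfer (at any time) between any of the other pairs of distinct vertices of $C_n$.
   Context: Arc-reversal walk: let $G=(V,E)$ be a finite simple graph without isolated vertices and $\mathcal{A}$ its set of arcs (ordered pairs $(u,v)$ with $uv\in E$; $u$ is the tail). Let $N\in\mathbb{R}^{\mathcal{A}\times V}$ with $N(a,v)=1/\sqrt{d(v)}$ if $v$ is the tail of $a$ and $0$ otherwise ($d(v)$ is the degree), and let $R$ be the permutation matrix on $\mathcal{A}$ swapping $(u,v)$ and $(v,u)$. The transition matrix is $U=R(2NN^T-I)$. Put $B_t=N^TU^tN$ for integers $t\ge0$, and $B=B_1=D^{ -1/2}AD^{ -1/2}$, where $A$ is the adjacency matrix and $D$ the diagonal degree matrix. Let $B=\sum_\theta\theta E_\theta$ be the spectral decomposition ($\theta$ over distinct eigenvalues, $E_\theta$ the orthogonal projection onto the $\theta$-eigenspace). For distinct vertices $u,v$ there is peak state transfer from $u$ to $v$ at time $t$ (a positive integer) if $|B_t(u,v)|=\sum_\theta|E_\theta(u,v)|$ and $E_\theta(u,v)\neq0$ for at least one $\theta$. There is perfect state transfer from $u$ to $v\neq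 u$ at time $t$ if $U^tN\mathbf{e}_u=\gamma N\mathbf{e}_v$ for some $\gamma\in\mathbb{C}$ with $|\gamma|=1$ (equivalently $|B_t(u,v)|=1$). The walk is periodic at $u$ if $U^tN\mathbf{e}_u=\gamma N\mathbf{e}_u$ for some integer $t>0$ and some $|\gamma|=1$; the smallest such $t$ is the period, and the walk is then called $t$-periodic at $u$. -}

module Defs where

open import Algebra.Bundles using (CommutativeRing)
import Algebra.Properties.CommutativeMonoid.Sum as Sum
import Algebra.Properties.Monoid.Mult as Mult
open import Algebra.Structures using (IsCommutativeRing)
open import Data.Bool.Base using (Bool; T)
open import Data.Bool.Properties using (T?)
open import Data.Fin.Base using (Fin; toℕ; fromℕ<)
open import Data.Fin.Properties using (_≟_; toℕ-fromℕ<; nonZeroIndex)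
open import Data.Fin.Subset using (∣_∣)
open import Data.Integer.Base as ℤ using (ℤ; +_; 1ℤ; -1ℤ)
open import Data.Integer.Divisibility.Signed using (_∣_; _∣?_; divides; ∣⇒∣ᵤ)
open import Data.Integer.DivMod using (n%ℕd<d; a≡a%ℕn+[a/ℕn]*n)
import Data.Integer.Properties as ℤ
open import Data.Integer.Tactic.RingSolver using (solve-∀)
open import Data.Nat.Base as ℕ using (ℕ; zero; suc)
import Data.Nat.Divisibility as ℕ
import Data.Nat.Properties as ℕ
open import Data.Product.Base using (Σ-syntax; ∃; _×_; _,_; proj₁; proj₂)
open import Data.Sum.Base as ⊎ using (_⊎_; inj₁; inj₂)
open import Data.Vec.Base using (tabulate)
open import Function.Base using (_∘_; flip)
open import Function.Definitions using (Injective)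
open import Level using (0ℓ)
open import Relation.Binary.PropositionalEquality
open import Relation.Binary.Structures using (IsDecTotalOrder)
open import Relation.Nullary.Decidable using (Dec; yes; no; ⌊_⌋; fromWitness; toWitness; _⊎-dec_; _×-dec_)
open import Relation.Nullary.Negation using (¬_)

-- The (classical) real numbers, axiomatised as a Dedekind-complete totally
-- ordered field, which determines them up to isomorphism.  As is usual
-- classically, equality and order are decidable; 0# ⁻¹ is unspecified.

record CompleteOrderedField : Set₁ where
  infix  8 _⁻¹ -_
  infixl 7 _*_
  infixl 6 _+_
  infix  4 _≤_

  field
    Carrier           : Set
    _+_ _*_           : Carrier → Carrier → Carrier
    -_ _⁻¹            : Carrier → Carrier
    0# 1#             : Carrier
    _≤_               : Carrier → Carrier → Set
    isCommutativeRing : IsCommutativeRing _≡_ _+_ _*_ -_ 0# 1#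
    0≢1               : 0# ≢ 1#
    *-inverse         : ∀ x → x ≢ 0# → x * x ⁻¹ ≡ 1#
    isDecTotalOrder   : IsDecTotalOrder _≡_ _≤_
    +-monoˡ-≤         : ∀ x y z → x ≤ y → x + z ≤ y + z
    *-nonneg          : ∀ x y → 0# ≤ x → 0# ≤ y → 0# ≤ x * y

  UpperBound : (Carrier → Set) → Carrier → Set
  UpperBound P b = ∀ x → P x → x ≤ b

  Supremum : (Carrier → Set) → Carrier → Set
  Supremum P s = UpperBound P s × (∀ b → UpperBound P b → s ≤ b)

  field
    complete : (P : Carrier → Set) → ∃ P → ∃ (UpperBound P) → ∃ (Supremum P)

  commutativeRing : CommutativeRing 0ℓ 0ℓ
  commutativeRing = record { isCommutativeRing = isCommutativeRing }

  open CommutativeRing commutativeRing public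
    using (_-_; +-monoid; +-commutativeMonoid; +-identityˡ; *-identityˡ;
           -‿inverseʳ; distribʳ; +-assoc; +-identityʳ)
  open IsDecTotalOrder isDecTotalOrder public
    using (_≤?_) renaming (_≟_ to _≟ᴿ_; total to ≤-total; trans to ≤-trans; refl to ≤-refl)

  open Sum +-commutativeMonoid public using (sum)

  fromℕ : ℕ → Carrier
  fromℕ k = k · 1#
    where open Mult +-monoid renaming (_×_ to _·_)

  abs : Carrier → Carrier
  abs x with 0# ≤? x
  ... | yes _ = x
  ... | no  _ = - x

  -- √ x is the supremum of { y ∣ y = 0 or y² ≤ x }: the nonnegative square
  -- root for x ≥ 0, and 0 for x < 0.

  UnderRoot : Carrier → Carrier → Set
  UnderRoot x y = y ≡ 0# ⊎ y * y ≤ x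

  0≤y-x : ∀ {x y} → x ≤ y → 0# ≤ y - x
  0≤y-x {x} {y} x≤y = subst (_≤ y - x) (-‿inverseʳ x) (+-monoˡ-≤ x y (- x) x≤y)

  *-monoʳ : ∀ {x y z} → 0# ≤ z → x ≤ y → x * z ≤ y * z
  *-monoʳ {x} {y} {z} 0≤z x≤y = subst₂ _≤_ (+-identityˡ (x * z)) eq
    (+-monoˡ-≤ 0# _ (x * z) (*-nonneg _ z (0≤y-x x≤y) 0≤z))
    where
    eq : (y - x) * z + x * z ≡ y * z
    eq = trans (sym (distribʳ z (y - x) x)) (cong (_* z)
      (trans (+-assoc y (- x) x)
      (trans (cong (λ w → y + w) (CommutativeRing.-‿inverseˡ commutativeRing x)) (+-identityʳ y))))

  bound : ∀ x b → 0# ≤ b → 1# ≤ b → x ≤ b → UpperBound (UnderRoot x) b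
  bound x b 0≤b 1≤b x≤b y (inj₁ refl) = 0≤b
  bound x b 0≤b 1≤b x≤b y (inj₂ y²≤x) with ≤-total y 0# | ≤-total y 1#
  ... | inj₁ y≤0 | _        = ≤-trans y≤0 0≤b
  ... | inj₂ _   | inj₁ y≤1 = ≤-trans y≤1 1≤b
  ... | inj₂ 0≤y | inj₂ 1≤y =
    ≤-trans (subst (_≤ y * y) (*-identityˡ y) (*-monoʳ 0≤y 1≤y)) (≤-trans y²≤x x≤b)

  upper : ∀ x y → ∃ λ z → x ≤ z × y ≤ z
  upper x y with ≤-total x y
  ... | inj₁ x≤y = y , x≤y , ≤-refl
  ... | inj₂ y≤x = x , ≤-refl , y≤x

  bounded : ∀ x → ∃ (UpperBound (UnderRoot x))
  bounded x with upper 0# 1#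
  ... | c , 0≤c , 1≤c with upper c x
  ...   | b , c≤b , x≤b = b , bound x b (≤-trans 0≤c c≤b) (≤-trans 1≤c c≤b) x≤b

  √ : Carrier → Carrier
  √ x = proj₁ (complete (UnderRoot x) (0# , inj₁ refl) (bounded x))

  √-supremum : ∀ x → Supremum (UnderRoot x) (√ x)
  √-supremum x = proj₂ (complete (UnderRoot x) (0# , inj₁ refl) (bounded x))

record Graph (n : ℕ) : Set where
  field
    adj        : Fin n → Fin n → Bool
    symmetric  : ∀ u v → T (adj u v) → T (adj v u)
    loopless   : ∀ u → ¬ T (adj u u)
    noIsolated : ∀ u → ∃ λ v → T (adj u v)

  degree : Fin n → ℕ
  degree u = ∣ tabulate (adj u) ∣

  Arc : Set
  Arc = Σ[ u ∈ Fin n ] Σ[ v ∈ Fin n ] T (adj u v)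

  tail head : Arc → Fin n
  tail (u , _ , _) = u
  head (_ , v , _) = v

module ArcReversalWalk (ℝ : CompleteOrderedField) {n : ℕ} (G : Graph n) where
  open CompleteOrderedField ℝ renaming (Carrier to R)
  open Graph G

  V : Set
  V = Fin n

  Vector : Set → Set
  Vector I = I → R

  Matrix : Set → Set → Set
  Matrix I J = I → J → R

  ∑ᵥ : Vector V → R
  ∑ᵥ = sum

  atArc : Vector Arc → ∀ u v → Dec (T (adj u v)) → R
  atArc f u v (yes uv) = f (u , v , uv)
  atArc f u v (no _)   = 0#

  ∑ₐ : Vector Arc → R
  ∑ₐ f = ∑ᵥ λ u → ∑ᵥ λ v → atArc f u v (T? (adj u v))

  infixr 7 _·ᵥ_ _·ₐ_ _$ᵥ_ _$ₐ_

  _·ᵥ_ : ∀ {I J} → Matrix I V → Matrix V J → Matrix I J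
  (M ·ᵥ M′) i j = ∑ᵥ λ k → M i k * M′ k j

  _·ₐ_ : ∀ {I J} → Matrix I Arc → Matrix Arc J → Matrix I J
  (M ·ₐ M′) i j = ∑ₐ λ k → M i k * M′ k j

  _$ᵥ_ : ∀ {I} → Matrix I V → Vector V → Vector I
  (M $ᵥ x) i = ∑ᵥ λ k → M i k * x k

  _$ₐ_ : ∀ {I} → Matrix I Arc → Vector Arc → Vector I
  (M $ₐ x) i = ∑ₐ λ k → M i k * x k

  _ᵀ : ∀ {I J} → Matrix I J → Matrix J I
  _ᵀ = flip

  indicator : ∀ {P : Set} → Dec P → R
  indicator (yes _) = 1#
  indicator (no  _) = 0#

  𝐞 : V → Vector V
  𝐞 u v = indicator (u ≟ v)

  -- An arc is determined by its ends, since T (adj u v) has at most one proof.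

  Iₐ : Matrix Arc Arc
  Iₐ a b = indicator ((tail a ≟ tail b) ×-dec (head a ≟ head b))

  reversal : Matrix Arc Arc
  reversal a b = indicator ((tail a ≟ head b) ×-dec (head a ≟ tail b))

  N : Matrix Arc V
  N a v = indicator (tail a ≟ v) * (√ (fromℕ (degree v))) ⁻¹

  U : Matrix Arc Arc
  U = reversal ·ₐ λ a b → fromℕ 2 * (N ·ᵥ N ᵀ) a b - Iₐ a b

  U^_ : ℕ → Matrix Arc Arc
  U^ zero  = Iₐ
  U^ suc t = U ·ₐ U^ t

  B_ : ℕ → Matrix V V
  B_ t = N ᵀ ·ₐ U^ t ·ₐ N

  B : Matrix V V
  B = B_ 1

  ⟨_,_⟩ : Vector V → Vector V → R
  ⟨ x , y ⟩ = ∑ᵥ λ v → x v * y v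

  Eigenspace : Matrix V V → R → Vector V → Set
  Eigenspace M θ x = ∀ v → (M $ᵥ x) v ≡ θ * x v

  IsEigenvalue : Matrix V V → R → Set
  IsEigenvalue M θ = ∃ λ x → Eigenspace M θ x × (∃ λ v → x v ≢ 0#)

  IsOrthogonalProjection : Matrix V V → (Vector V → Set) → Set
  IsOrthogonalProjection E W = ∀ x →
    W (E $ᵥ x) × (∀ y → W y → ⟨ (λ v → x v - (E $ᵥ x) v) , y ⟩ ≡ 0#)

  record SpectralDecomposition (M : Matrix V V) : Set where
    field
      size         : ℕ
      θ            : Fin size → R
      E            : Fin size → Matrix V V
      θ-distinct   : Injective _≡_ _≡_ θ
      θ-eigenvalue : ∀ r → IsEigenvalue M (θ r)
      θ-exhaustive : ∀ λ′ → IsEigenvalue M λ′ → ∃ λ r → θ r ≡ λ′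
      E-projection : ∀ r → IsOrthogonalProjection (E r) (Eigenspace M (θ r))
      decomposes   : ∀ u v → M u v ≡ sum λ r → θ r * E r u v

  -- A spectral decomposition is unique up to the order of the eigenvalues, so
  -- the existential quantifier merely names that of B.

  PeakStateTransfer : V → V → ℕ → Set
  PeakStateTransfer u v t = u ≢ v × 0 ℕ.< t ×
    Σ[ S ∈ SpectralDecomposition B ] let open SpectralDecomposition S in
      abs ((B_ t) u v) ≡ sum (λ r → abs (E r u v)) × (∃ λ r → E r u v ≢ 0#)

  record ℂ : Set where
    constructor _+i_
    field
      re im : R

  ofReal : R → ℂ
  ofReal x = x +i 0#

  _*ᶜ_ : ℂ → ℂ → ℂ
  (a +i b) *ᶜ (c +i d) = (a * c - b * d) +i (a * d + b * c)

  modulus : ℂ → R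
  modulus (a +i b) = √ (a * a + b * b)

  Transfer : V → V → ℕ → Set
  Transfer u v t = Σ[ γ ∈ ℂ ] modulus γ ≡ 1# ×
    (∀ a → ofReal ((U^ t $ₐ N $ᵥ 𝐞 u) a) ≡ γ *ᶜ ofReal ((N $ᵥ 𝐞 v) a))

  PerfectStateTransfer : V → V → ℕ → Set
  PerfectStateTransfer u v t = u ≢ v × Transfer u v t

  PeriodicAt : ℕ → V → Set
  PeriodicAt t u = 0 ℕ.< t × Transfer u u t ×
    (∀ s → 0 ℕ.< s → Transfer u u s → t ℕ.≤ s)

infixl 6 _⊕_

_⊕_ : ∀ {n} → Fin n → ℤ → Fin n
_⊕_ {n} i k = fromℕ< (n%ℕd<d (+ toℕ i ℤ.+ k) n {{nonZeroIndex i}})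

_≡_[mod_] : ℤ → ℤ → ℕ → Set
i ≡ j [mod n ] = + n ∣ i ℤ.- j

CycleAdjacent : ∀ {n} → Fin n → Fin n → Set
CycleAdjacent {n} i j =
  ((+ toℕ i ℤ.- + toℕ j) ≡ 1ℤ [mod n ]) ⊎ ((+ toℕ i ℤ.- + toℕ j) ≡ -1ℤ [mod n ])

cycleAdjacent? : ∀ {n} (i j : Fin n) → Dec (CycleAdjacent i j)
cycleAdjacent? {n} i j = (+ n ∣? _) ⊎-dec (+ n ∣? _)

private
  negate : ∀ {n} x y z → ℤ.- x ≡ y → n ∣ (x ℤ.- z) → n ∣ (y ℤ.- (ℤ.- z))
  negate x y z refl (divides q eq) = divides (ℤ.- q)
    (trans (lemma x z) (trans (cong ℤ.-_ eq) (ℤ.neg-distribˡ-* q _)))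
    where
    lemma : ∀ x z → ℤ.- x ℤ.- (ℤ.- z) ≡ ℤ.- (x ℤ.- z)
    lemma = solve-∀

  neg-minus : ∀ a b → ℤ.- (a ℤ.- b) ≡ b ℤ.- a
  neg-minus = solve-∀

  cycleSym : ∀ {n} (i j : Fin n) → CycleAdjacent i j → CycleAdjacent j i
  cycleSym i j (inj₁ d) = inj₂ (negate _ _ 1ℤ (neg-minus (+ toℕ i) (+ toℕ j)) d)
  cycleSym i j (inj₂ d) = inj₁ (negate _ _ -1ℤ (neg-minus (+ toℕ i) (+ toℕ j)) d)

  cycleLoopless : ∀ {n} → 3 ℕ.≤ n → (i : Fin n) → ¬ CycleAdjacent i i
  cycleLoopless {n} 3≤n i adj = ℕ.<⇒≱ (ℕ.≤-trans (ℕ.s≤s (ℕ.s≤s ℕ.z≤n)) 3≤n) (ℕ.∣⇒≤ n∣1)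
    where
    i-i = ℤ.+-inverseʳ (+ toℕ i)
    n∣1 : n ℕ.∣ 1
    n∣1 = ⊎.[_,_]
      (λ d → ∣⇒∣ᵤ (subst (λ x → + n ∣ x ℤ.- 1ℤ) i-i d))
      (λ d → ∣⇒∣ᵤ (subst (λ x → + n ∣ x ℤ.- -1ℤ) i-i d)) adj

  cycleNext : ∀ {n} (i : Fin n) → CycleAdjacent i (i ⊕ 1ℤ)
  cycleNext {n} i = inj₂ (divides q eq)
    where
    instance _ = nonZeroIndex i
    s = + toℕ i ℤ.+ 1ℤ
    q = s ℤ./ℕ n
    r = s ℤ.%ℕ n
    rearrange : ∀ i r → (i ℤ.- r) ℤ.- -1ℤ ≡ (i ℤ.+ 1ℤ) ℤ.- r
    rearrange = solve-∀
    cancel : ∀ r x → (r ℤ.+ x) ℤ.- r ≡ x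
    cancel = solve-∀
    eq : (+ toℕ i ℤ.- + toℕ (i ⊕ 1ℤ)) ℤ.- -1ℤ ≡ q ℤ.* + n
    eq = begin
      (+ toℕ i ℤ.- + toℕ (i ⊕ 1ℤ)) ℤ.- -1ℤ
        ≡⟨ cong (λ k → (+ toℕ i ℤ.- + k) ℤ.- -1ℤ) (toℕ-fromℕ< (n%ℕd<d s n)) ⟩
      (+ toℕ i ℤ.- + r) ℤ.- -1ℤ   ≡⟨ rearrange (+ toℕ i) (+ r) ⟩
      s ℤ.- + r                   ≡⟨ cong (ℤ._- + r) (a≡a%ℕn+[a/ℕn]*n s n) ⟩
      (+ r ℤ.+ q ℤ.* + n) ℤ.- + r ≡⟨ cancel (+ r) (q ℤ.* + n) ⟩
      q ℤ.* + n                   ∎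
      where open ≡-Reasoning

cycle : ∀ n → 3 ℕ.≤ n → Graph n
cycle n 3≤n = record
  { adj        = λ i j → ⌊ cycleAdjacent? i j ⌋
  ; symmetric  = λ i j → fromWitness ∘ cycleSym i j ∘ toWitness
  ; loopless   = λ i → cycleLoopless 3≤n i ∘ toWitness
  ; noIsolated = λ i → i ⊕ 1ℤ , fromWitness (cycleNext i)
  }

{-# OPTIONS --safe #-}
module Submission where

-- The walk on a cycle is rigid.  Every vertex v has two outgoing arcs, one in
-- each direction, and U moves an arc one step along its own direction
-- (U-step).  Hence U^ t shifts the forward arcs by t and the backward arcs by
-- - t, and B_ t u v = (δ (u + t) v + δ (u - t) v) / 2 (B-entry).  Periodicity
-- with period n and perfect state transfer to the antipode are read off from
-- these shifts.
--
-- An eigenvector x of B for θ satisfies x (v + 1) + x (v - 1) = 2 θ x v, so it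
-- is an eigenvector of B_ t for T θ t, with T the Chebyshev polynomials
-- (eigen-shift), and comparing entries of largest absolute value gives
-- |T θ t| ≤ 1 (eigenvalue-bound).
--
-- Obstruction.  In any spectral decomposition the projections add up to the
-- identity (Decomposed.sum-E), so B_ t i j is the sum of T θ t * E θ i j.
-- Peak state transfer is then equality in the triangle inequality, and forces
-- (T θ t) ^ 2 = 1 whenever E θ i j is nonzero.  As cos (3 φ) = cos φ when
-- cos φ = 1 or -1, it follows that B_ (3 t) i j = B_ t i j, which is nonzero.
-- So j is both i + t or i - t and i + 3 t or i - 3 t, whence n divides 4 t but
-- not t; this leaves the half turn and the two quarter turns
-- (peak-transfer-quarter-turns).
--
-- Quarter turns.  For n = 4 ℓ an actual spectral decomposition is needed, and
-- for it the number c = cos (2 π / n).  It is obtained without trigonometry as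
-- the largest zero of T ℓ (chebyshev-zero), found by completeness, with the
-- interlacing of the zeros of consecutive Chebyshev polynomials as induction
-- step.  From T c ℓ = 0 and positivity of the preceding values, z ↦ T c |z| is
-- n-periodic, strictly decreasing on half a period, and equal to 1 only at the
-- multiples of n; so the eigenvalues cos (2 π k / n) with 0 ≤ k ≤ 2 ℓ are
-- distinct and the matrices with entries proportional to
-- cos (2 π k (u - v) / n) resolve the identity (projector-sum).  At distance ℓ
-- the cosines are 0, 1 or -1, so |E k i j| = T (θ k) ℓ * E k i j for each k,
-- and summing over k gives B_ ℓ i j (quarter-transfer).

open import Algebra.Bundles using (CommutativeRing)
import Algebra.Properties.Ring as RingProperties
import Algebra.Properties.Semiring.Mult.TCOptimised as SemiringMult
import Algebra.Properties.Semiring.Sum as SemiringSum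
import Algebra.Solver.Ring as RingSolver
import Algebra.Solver.Ring.AlmostCommutativeRing as ACR
open import Data.Bool.Base as Bool using (Bool; true; false)
open import Data.Bool.Properties using (T?; T-irrelevant)
open import Data.Fin.Base using (Fin; zero; suc; toℕ)
open import Data.Fin.Properties using (_≟_; any?; suc-injective; toℕ-fromℕ<; toℕ-injective; toℕ<n; nonZeroIndex)
import Data.Fin.Subset as Subset
open import Data.Integer.Base as ℤ using (ℤ; -[1+_]; 0ℤ; 1ℤ; -1ℤ)
open import Data.Integer.Divisibility.Signed
  using (_∣_; divides; ∣⇒∣ᵤ; ∣m∣n⇒∣m+n; ∣m∣n⇒∣m-n; ∣m⇒∣-m; ∣n⇒∣m*n)
open import Data.Integer.DivMod using (n%ℕd<d; a≡a%ℕn+[a/ℕn]*n)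
import Data.Integer.Properties as ℤ
import Data.Integer.Tactic.RingSolver as ℤ-Solver
import Data.Maybe.Base as Maybe
open import Data.Nat.Base as ℕ using (ℕ; zero; suc)
import Data.Nat.Divisibility as ℕ
import Data.Nat.Properties as ℕ
import Data.Nat.Tactic.RingSolver as ℕ-Solver
open import Data.Product.Base using (∃; ∃-syntax; _×_; _,_; proj₁; proj₂)
open import Data.Sum.Base using (_⊎_; inj₁; inj₂; [_,_]′)
open import Data.Vec.Base using (tabulate)
open import Function.Base using (_∘_)
open import Relation.Binary.Definitions using (tri<; tri≈; tri>)
open import Relation.Binary.PropositionalEquality
open import Relation.Binary.Structures using (IsDecTotalOrder)
open import Relation.Nullary.Decidable using (Dec; yes; no; dec⇒maybe; fromWitness; toWitness; _×-dec_)
open import Relation.Nullary.Negation using (¬_; contradiction)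

open import Defs

-- Ordered fields and finite sums

module RealField (ℝ : CompleteOrderedField) where
  open CompleteOrderedField ℝ public renaming (Carrier to R)
  open CommutativeRing commutativeRing public
    using (*-comm; *-assoc; *-identityʳ; zeroˡ; zeroʳ; distribˡ; +-comm; -‿inverseˡ; semiring; ring)
  open IsDecTotalOrder isDecTotalOrder public using () renaming (antisym to ≤-antisym)
  open RingProperties ring using (-0#≈0#; -‿+-comm; -‿involutive; -‿distribˡ-*; -‿distribʳ-*)
  open SemiringMult semiring using (×-homo-+; ×1-homo-*; 1+×) renaming (_×_ to _·_)
  open SemiringSum semiring public
    using (sum-cong-≗; ∑-distrib-+; ∑-comm; sum-replicate-zero; *-distribˡ-sum; *-distribʳ-sum)

  -- The canonical homomorphism from the integers; with it as coefficient map,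
  -- the ring solver computes with numerals.
  fromℤ : ℤ → R
  fromℤ (ℤ.+ k)    = k · 1#
  fromℤ -[1+ k ] = - (suc k · 1#)

  private
    fromℤ-⊖ : ∀ j k → fromℤ (j ℤ.⊖ k) ≡ j · 1# - k · 1#
    fromℤ-⊖ zero    zero    = sym (-‿inverseʳ 0#)
    fromℤ-⊖ zero    (suc k) = sym (+-identityˡ _)
    fromℤ-⊖ (suc j) zero    = sym (trans (cong (suc j · 1# +_) -0#≈0#) (+-identityʳ _))
    fromℤ-⊖ (suc j) (suc k) = begin
      fromℤ (suc j ℤ.⊖ suc k)               ≡⟨ cong fromℤ (ℤ.[1+m]⊖[1+n]≡m⊖n j k) ⟩
      fromℤ (j ℤ.⊖ k)                       ≡⟨ fromℤ-⊖ j k ⟩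
      a - b                                 ≡⟨ cong (_- b) (sym (+-identityʳ a)) ⟩
      a + 0# - b                            ≡⟨ cong (λ z → a + z - b) (sym (-‿inverseʳ 1#)) ⟩
      a + (1# - 1#) - b                     ≡⟨ cong (_- b) (sym (+-assoc a 1# (- 1#))) ⟩
      (a + 1# - 1#) - b                     ≡⟨ +-assoc (a + 1#) (- 1#) (- b) ⟩
      a + 1# + (- 1# - b)
        ≡⟨ cong₂ _+_ (trans (+-comm a 1#) (sym (1+× j 1#))) (-‿+-comm 1# b) ⟩
      suc j · 1# - (1# + b)                 ≡⟨ cong (λ z → suc j · 1# - z) (sym (1+× k 1#)) ⟩
      suc j · 1# - suc k · 1#               ∎
      where
      open ≡-Reasoning
      a = j · 1#
      b = k · 1#

    fromℤ-+ : ∀ x y → fromℤ (x ℤ.+ y) ≡ fromℤ x + fromℤ y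
    fromℤ-+ (ℤ.+ j)    (ℤ.+ k)    = ×-homo-+ 1# j k
    fromℤ-+ (ℤ.+ j)    -[1+ k ] = fromℤ-⊖ j (suc k)
    fromℤ-+ -[1+ j ] (ℤ.+ k)    = trans (fromℤ-⊖ k (suc j)) (+-comm _ _)
    fromℤ-+ -[1+ j ] -[1+ k ] = trans (cong (λ z → - (z · 1#)) (cong suc (sym (ℕ.+-suc j k))))
      (trans (cong -_ (×-homo-+ 1# (suc j) (suc k))) (sym (-‿+-comm _ _)))

    fromℤ-neg : ∀ x → fromℤ (ℤ.- x) ≡ - fromℤ x
    fromℤ-neg (ℤ.+ zero)  = sym -0#≈0#
    fromℤ-neg (ℤ.+ suc k) = refl
    fromℤ-neg -[1+ k ]  = sym (-‿involutive _)

    fromℤ-pos* : ∀ j y → fromℤ (ℤ.+ j ℤ.* y) ≡ j · 1# * fromℤ y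
    fromℤ-pos* j (ℤ.+ k)    = trans (cong fromℤ (sym (ℤ.pos-* j k))) (×1-homo-* j k)
    fromℤ-pos* j -[1+ k ] = begin
      fromℤ (ℤ.+ j ℤ.* -[1+ k ])          ≡⟨ cong fromℤ (sym (ℤ.neg-distribʳ-* (ℤ.+ j) (ℤ.+ suc k))) ⟩
      fromℤ (ℤ.- (ℤ.+ j ℤ.* ℤ.+ suc k))     ≡⟨ fromℤ-neg (ℤ.+ j ℤ.* ℤ.+ suc k) ⟩
      - fromℤ (ℤ.+ j ℤ.* ℤ.+ suc k)         ≡⟨ cong -_ (fromℤ-pos* j (ℤ.+ suc k)) ⟩
      - (j · 1# * suc k · 1#)           ≡⟨ -‿distribʳ-* _ _ ⟩
      j · 1# * - (suc k · 1#)           ∎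
      where open ≡-Reasoning

    fromℤ-* : ∀ x y → fromℤ (x ℤ.* y) ≡ fromℤ x * fromℤ y
    fromℤ-* (ℤ.+ j)    y = fromℤ-pos* j y
    fromℤ-* -[1+ j ] y = begin
      fromℤ (-[1+ j ] ℤ.* y)            ≡⟨ cong fromℤ (sym (ℤ.neg-distribˡ-* (ℤ.+ suc j) y)) ⟩
      fromℤ (ℤ.- (ℤ.+ suc j ℤ.* y))       ≡⟨ fromℤ-neg (ℤ.+ suc j ℤ.* y) ⟩
      - fromℤ (ℤ.+ suc j ℤ.* y)           ≡⟨ cong -_ (fromℤ-pos* (suc j) y) ⟩
      - (suc j · 1# * fromℤ y)          ≡⟨ -‿distribˡ-* _ _ ⟩
      - (suc j · 1#) * fromℤ y          ∎
      where open ≡-Reasoning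

    morphism : ℤ.+-*-rawRing ACR.-Raw-AlmostCommutative⟶ ACR.fromCommutativeRing commutativeRing
    morphism = record
      { ⟦_⟧ = fromℤ ; +-homo = fromℤ-+ ; *-homo = fromℤ-* ; -‿homo = fromℤ-neg
      ; 0-homo = refl ; 1-homo = refl }

  open RingSolver ℤ.+-*-rawRing (ACR.fromCommutativeRing commutativeRing) morphism
    (λ x y → Maybe.map (cong fromℤ) (dec⇒maybe (x ℤ.≟ y))) public
    using (solve; _:=_; _:+_; _:*_; _:-_; :-_; con)


  infix 4 _<_

  -- The strict order as the negation of the converse order, which suffices since
  -- the order is total and decidable.
  _<_ : R → R → Set
  x < y = ¬ (y ≤ x)

  2# : R
  2# = 1# + 1#

  <⇒≤ : ∀ {x y} → x < y → x ≤ y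
  <⇒≤ {x} {y} x<y = [ (λ x≤y → x≤y) , (λ y≤x → contradiction y≤x x<y) ]′ (≤-total x y)

  <-≤-trans : ∀ {x y z} → x < y → y ≤ z → x < z
  <-≤-trans x<y y≤z z≤x = x<y (≤-trans y≤z z≤x)

  ≤-<-trans : ∀ {x y z} → x ≤ y → y < z → x < z
  ≤-<-trans x≤y y<z z≤x = y<z (≤-trans z≤x x≤y)

  <⇒≢ : ∀ {x y} → x < y → x ≢ y
  <⇒≢ x<x refl = x<x ≤-refl

  ≤∧≢⇒< : ∀ {x y} → x ≤ y → x ≢ y → x < y
  ≤∧≢⇒< x≤y x≢y y≤x = x≢y (≤-antisym x≤y y≤x)

  -- Inequalities are proved by exhibiting a nonnegative difference.
  ≤-by : ∀ {x y d} → 0# ≤ d → y ≡ x + d → x ≤ y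
  ≤-by {x} {y} {d} 0≤d refl =
    subst₂ _≤_ (+-identityˡ x) (+-comm d x) (+-monoˡ-≤ 0# d x 0≤d)

  +-nonneg : ∀ {x y} → 0# ≤ x → 0# ≤ y → 0# ≤ x + y
  +-nonneg {x} 0≤x 0≤y = ≤-trans 0≤x (≤-by 0≤y refl)

  ≤0⇒0≤- : ∀ {x} → x ≤ 0# → 0# ≤ - x
  ≤0⇒0≤- {x} x≤0 = subst (0# ≤_) (+-identityˡ (- x)) (0≤y-x x≤0)

  <-by : ∀ {x y d} → 0# < d → y ≡ x + d → x < y
  <-by {x} {y} {d} 0<d refl y≤x = 0<d (≤-by (0≤y-x y≤x)
    (solve 2 (λ x d → con 0ℤ := d :+ (x :- (x :+ d))) refl x d))

  0<y-x : ∀ {x y} → x < y → 0# < y - x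
  0<y-x {x} {y} x<y y-x≤0 = x<y (≤-by (≤0⇒0≤- y-x≤0)
    (solve 2 (λ x y → x := y :+ :- (y :- x)) refl x y))

  +-pos : ∀ {x y} → 0# < x → 0# ≤ y → 0# < x + y
  +-pos 0<x 0≤y = <-≤-trans 0<x (≤-by 0≤y refl)

  ²-nonneg : ∀ x → 0# ≤ x * x
  ²-nonneg x with ≤-total 0# x
  ... | inj₁ 0≤x = *-nonneg x x 0≤x 0≤x
  ... | inj₂ x≤0 = subst (0# ≤_) (solve 1 (λ x → (:- x) :* (:- x) := x :* x) refl x)
    (*-nonneg _ _ (≤0⇒0≤- x≤0) (≤0⇒0≤- x≤0))

  0≤1 : 0# ≤ 1#
  0≤1 = subst (0# ≤_) (*-identityʳ 1#) (²-nonneg 1#)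

  0≤2 : 0# ≤ 2#
  0≤2 = +-nonneg 0≤1 0≤1

  +-nonneg-zero : ∀ {x y} → 0# ≤ x → 0# ≤ y → x + y ≡ 0# → x ≡ 0#
  +-nonneg-zero {x} {y} 0≤x 0≤y eq = ≤-antisym (≤-by 0≤y (sym eq)) 0≤x

  2≢0 : 2# ≢ 0#
  2≢0 2≡0 = 0≢1 (sym (+-nonneg-zero 0≤1 0≤1 2≡0))

  *-zero-cancel : ∀ {x y} → x ≢ 0# → x * y ≡ 0# → y ≡ 0#
  *-zero-cancel {x} {y} x≢0 xy≡0 = begin
    y               ≡⟨ sym (*-identityˡ y) ⟩
    1# * y          ≡⟨ cong (_* y) (sym (*-inverse x x≢0)) ⟩
    x * x ⁻¹ * y    ≡⟨ solve 3 (λ x i y → x :* i :* y := i :* (x :* y)) refl x (x ⁻¹) y ⟩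
    x ⁻¹ * (x * y)  ≡⟨ cong (x ⁻¹ *_) xy≡0 ⟩
    x ⁻¹ * 0#       ≡⟨ zeroʳ _ ⟩
    0#              ∎
    where open ≡-Reasoning

  *-cancelˡ : ∀ {x y z} → x ≢ 0# → x * y ≡ x * z → y ≡ z
  *-cancelˡ {x} {y} {z} x≢0 eq = begin
    y            ≡⟨ solve 2 (λ y z → y := y :- z :+ z) refl y z ⟩
    y - z + z    ≡⟨ cong (_+ z) (*-zero-cancel x≢0 (trans
                      (solve 3 (λ x y z → x :* (y :- z) := x :* y :- x :* z) refl x y z)
                      (trans (cong (_- x * z) eq) (-‿inverseʳ _)))) ⟩
    0# + z       ≡⟨ +-identityˡ z ⟩
    z            ∎
    where open ≡-Reasoning

  *-nonzero : ∀ {x y} → x ≢ 0# → y ≢ 0# → x * y ≢ 0#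
  *-nonzero x≢0 y≢0 xy≡0 = y≢0 (*-zero-cancel x≢0 xy≡0)

  ²-zero : ∀ {x} → x * x ≡ 0# → x ≡ 0#
  ²-zero {x} x²≡0 with x ≟ᴿ 0#
  ... | yes x≡0 = x≡0
  ... | no x≢0  = *-zero-cancel x≢0 x²≡0

  *-pos : ∀ {x y} → 0# < x → 0# < y → 0# < x * y
  *-pos {x} {y} 0<x 0<y = ≤∧≢⇒< (*-nonneg x y (<⇒≤ 0<x) (<⇒≤ 0<y))
    (≢-sym (*-nonzero (≢-sym (<⇒≢ 0<x)) (≢-sym (<⇒≢ 0<y))))

  ⁻¹-pos : ∀ {x} → 0# < x → 0# < x ⁻¹
  ⁻¹-pos {x} 0<x x⁻¹≤0 = 0≢1 (≤-antisym 0≤1 (≤-by (*-nonneg x _ (<⇒≤ 0<x) (≤0⇒0≤- x⁻¹≤0))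
    (trans (solve 2 (λ x y → con 0ℤ := x :* y :+ x :* (:- y)) refl x (x ⁻¹))
      (cong (_+ x * (- (x ⁻¹))) (*-inverse x (≢-sym (<⇒≢ 0<x)))))))

  ²-cancel-≤ : ∀ {x y} → 0# ≤ y → x * x ≤ y * y → x ≤ y
  ²-cancel-≤ {x} {y} 0≤y x²≤y² with ≤-total x y
  ... | inj₁ x≤y = x≤y
  ... | inj₂ y≤x = ≤-by ≤-refl (trans (solve 2 (λ x y → y := x :+ con 0ℤ :- (x :- y)) refl x y)
          (trans (cong (λ d → x + 0# - d) d≡0) (trans (cong (λ z → x + 0# + z) -0#≈0#) (+-identityʳ _))))
    where
    d = x - y
    -- x ^ 2 = y ^ 2 + 2 y d + d ^ 2, so d ^ 2 ≤ 0.
    d≡0 : d ≡ 0#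
    d≡0 = ²-zero (≤-antisym
      (≤-by (+-nonneg (0≤y-x x²≤y²) (*-nonneg _ _ 0≤2 (*-nonneg _ _ 0≤y (0≤y-x y≤x))))
        (solve 2 (λ x y → con 0ℤ := (x :- y) :* (x :- y) :+
          ((y :* y :- x :* x) :+ con (ℤ.+ 2) :* (y :* (x :- y)))) refl x y))
      (²-nonneg d))

  ²-injective : ∀ {x y} → 0# ≤ x → 0# ≤ y → x * x ≡ y * y → x ≡ y
  ²-injective 0≤x 0≤y eq =
    ≤-antisym (²-cancel-≤ 0≤y (≤-by ≤-refl (trans (sym eq) (sym (+-identityʳ _)))))
              (²-cancel-≤ 0≤x (≤-by ≤-refl (trans eq (sym (+-identityʳ _)))))

  √-² : ∀ {x} → 0# ≤ x → √ (x * x) ≡ x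
  √-² {x} 0≤x = ≤-antisym
    (proj₂ (√-supremum _) x λ { y (inj₁ refl) → 0≤x ; y (inj₂ y²≤x²) → ²-cancel-≤ 0≤x y²≤x² })
    (proj₁ (√-supremum _) x (inj₂ ≤-refl))

  abs-nonneg : ∀ x → 0# ≤ abs x
  abs-nonneg x with 0# ≤? x
  ... | yes 0≤x = 0≤x
  ... | no  0≰x = ≤0⇒0≤- (<⇒≤ 0≰x)

  abs-² : ∀ x → abs x * abs x ≡ x * x
  abs-² x with 0# ≤? x
  ... | yes _ = refl
  ... | no  _ = solve 1 (λ x → (:- x) :* (:- x) := x :* x) refl x

  abs-unique : ∀ {x y} → 0# ≤ y → y * y ≡ x * x → abs x ≡ y
  abs-unique {x} 0≤y eq = ²-injective (abs-nonneg x) 0≤y (trans (abs-² x) (sym eq))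

  abs-zero : ∀ {x} → abs x ≡ 0# → x ≡ 0#
  abs-zero {x} eq = ²-zero (trans (sym (abs-² x)) (trans (cong (λ z → z * z) eq) (zeroʳ 0#)))

  abs-sign : ∀ x → ∃[ σ ] σ * σ ≡ 1# × abs x ≡ σ * x
  abs-sign x with 0# ≤? x
  ... | yes _ = 1# , *-identityʳ 1# , sym (*-identityˡ x)
  ... | no  _ = - 1# , solve 0 ((:- con 1ℤ) :* (:- con 1ℤ) := con 1ℤ) refl
                     , solve 1 (λ x → :- x := (:- con 1ℤ) :* x) refl x

  sum-nonneg : ∀ {m} (f : Fin m → R) → (∀ k → 0# ≤ f k) → 0# ≤ sum f
  sum-nonneg {zero}  f 0≤f = ≤-refl
  sum-nonneg {suc m} f 0≤f = +-nonneg (0≤f zero) (sum-nonneg (f ∘ suc) (0≤f ∘ suc))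

  sum-nonneg-zero : ∀ {m} (f : Fin m → R) → (∀ k → 0# ≤ f k) → sum f ≡ 0# → ∀ k → f k ≡ 0#
  sum-nonneg-zero {suc m} f 0≤f eq zero    =
    +-nonneg-zero (0≤f zero) (sum-nonneg (f ∘ suc) (0≤f ∘ suc)) eq
  sum-nonneg-zero {suc m} f 0≤f eq (suc k) = sum-nonneg-zero (f ∘ suc) (0≤f ∘ suc)
    (+-nonneg-zero (sum-nonneg (f ∘ suc) (0≤f ∘ suc)) (0≤f zero) (trans (+-comm _ _) eq)) k

  sum-neg : ∀ {m} (f : Fin m → R) → sum (λ k → - f k) ≡ - sum f
  sum-neg {zero}  f = sym -0#≈0#
  sum-neg {suc m} f = trans (cong (λ z → - f zero + z) (sum-neg (f ∘ suc))) (-‿+-comm _ _)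

  sum-minus : ∀ {m} (f g : Fin m → R) → sum (λ k → f k - g k) ≡ sum f - sum g
  sum-minus f g = trans (∑-distrib-+ f (λ k → - g k)) (cong (λ z → sum f + z) (sum-neg g))

  sum-zero : ∀ {m} (f : Fin m → R) → (∀ k → f k ≡ 0#) → sum f ≡ 0#
  sum-zero {m} f f≡0 = trans (sum-cong-≗ f≡0) (sum-replicate-zero m)

  sum-single : ∀ {m} (f : Fin m → R) p → (∀ k → k ≢ p → f k ≡ 0#) → sum f ≡ f p
  sum-single f zero    off = trans (cong (λ z → f zero + z) (sum-zero (f ∘ suc) λ k → off (suc k) λ ()))
    (+-identityʳ _)
  sum-single f (suc p) off = trans (cong₂ _+_ (off zero λ ())
    (sum-single (f ∘ suc) p λ k k≢p → off (suc k) (k≢p ∘ suc-injective))) (+-identityˡ _)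

  sum-pair : ∀ {m} (f : Fin m → R) {p q} → p ≢ q → (∀ k → k ≢ p → k ≢ q → f k ≡ 0#) →
    sum f ≡ f p + f q
  sum-pair f {p} {q} p≢q off = begin
    sum f                                 ≡⟨ sum-cong-≗ split ⟩
    sum (λ k → at k + off-at k)           ≡⟨ ∑-distrib-+ at off-at ⟩
    sum at + sum off-at
      ≡⟨ cong₂ _+_ (sum-single at p at-off) (sum-single off-at q off-at-off) ⟩
    at p + off-at q                       ≡⟨ cong₂ _+_ at-p off-at-q ⟩
    f p + f q                             ∎
    where
    open ≡-Reasoning
    at off-at : Fin _ → R
    at k with k ≟ p
    ... | yes _ = f k
    ... | no  _ = 0#
    off-at k with k ≟ p
    ... | yes _ = 0#
    ... | no  _ = f k
    split : ∀ k → f k ≡ at k + off-at k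
    split k with k ≟ p
    ... | yes _ = sym (+-identityʳ _)
    ... | no  _ = sym (+-identityˡ _)
    at-off : ∀ k → k ≢ p → at k ≡ 0#
    at-off k k≢p with k ≟ p
    ... | yes k≡p = contradiction k≡p k≢p
    ... | no  _   = refl
    off-at-off : ∀ k → k ≢ q → off-at k ≡ 0#
    off-at-off k k≢q with k ≟ p
    ... | yes _   = refl
    ... | no  k≢p = off k k≢p k≢q
    at-p : at p ≡ f p
    at-p with p ≟ p
    ... | yes _  = refl
    ... | no p≢p = contradiction refl p≢p
    off-at-q : off-at q ≡ f q
    off-at-q with q ≟ p
    ... | yes q≡p = contradiction (sym q≡p) p≢q
    ... | no  _   = refl

  argmax-² : ∀ {m} (f : Fin (suc m) → R) → ∃[ k ] ∀ j → f j * f j ≤ f k * f k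
  argmax-² {zero}  f = zero , λ { zero → ≤-refl }
  argmax-² {suc m} f with argmax-² (f ∘ suc)
  ... | k , max with ≤-total (f zero * f zero) (f (suc k) * f (suc k))
  ...   | inj₁ f₀≤fₖ = suc k , λ { zero → f₀≤fₖ ; (suc j) → max j }
  ...   | inj₂ fₖ≤f₀ = zero , λ { zero → ≤-refl ; (suc j) → ≤-trans (max j) fₖ≤f₀ }

-- Chebyshev polynomials and the number cos (2 π / n)

module Chebyshev (ℝ : CompleteOrderedField) where
  open RealField ℝ

  -- Chebyshev polynomials of the first kind: cos (k φ) = T (cos φ) k.
  T : R → ℕ → R
  T x zero          = 1#
  T x (suc zero)    = x
  T x (suc (suc k)) = 2# * x * T x (suc k) - T x k

  -- The three-term recurrence solved by z ↦ cos (z φ), with θ = cos φ.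
  Recurrent : R → (ℤ → R) → Set
  Recurrent θ f = ∀ z → f (z ℤ.+ 1ℤ) + f (z ℤ.- 1ℤ) ≡ 2# * θ * f z

  -- For f z = cos (z φ) and θ = cos φ this reads
  -- cos ((z + k) φ) + cos ((z - k) φ) = 2 cos (k φ) cos (z φ).
  product-formula : ∀ {θ f} → Recurrent θ f → ∀ k z →
    f (z ℤ.+ ℤ.+ k) + f (z ℤ.- ℤ.+ k) ≡ 2# * T θ k * f z
  product-formula {θ} {f} rec zero z = begin
    f (z ℤ.+ 0ℤ) + f (z ℤ.- 0ℤ)  ≡⟨ cong₂ (λ x y → f x + f y) (ℤ.+-identityʳ z) (ℤ.+-identityʳ z) ⟩
    f z + f z                    ≡⟨ solve 1 (λ x → x :+ x := con (ℤ.+ 2) :* con 1ℤ :* x) refl (f z) ⟩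
    2# * 1# * f z                ∎
    where open ≡-Reasoning
  product-formula rec (suc zero) z = rec z
  product-formula {θ} {f} rec (suc (suc k)) z = begin
    f (z ℤ.+ ℤ.+ suc (suc k)) + f (z ℤ.- ℤ.+ suc (suc k))
      ≡⟨ cong₂ (λ x y → f x + f y) (up z (ℤ.+ k)) (down z (ℤ.+ k)) ⟩
    f (z⁺ ℤ.+ 1ℤ) + f (z⁻ ℤ.- 1ℤ)
      ≡⟨ solve 4 (λ a b c d → a :+ b := (a :+ c) :+ (d :+ b) :- (c :+ d)) refl
           (f (z⁺ ℤ.+ 1ℤ)) (f (z⁻ ℤ.- 1ℤ)) (f (z⁺ ℤ.- 1ℤ)) (f (z⁻ ℤ.+ 1ℤ)) ⟩
    (f (z⁺ ℤ.+ 1ℤ) + f (z⁺ ℤ.- 1ℤ)) + (f (z⁻ ℤ.+ 1ℤ) + f (z⁻ ℤ.- 1ℤ)) - (f (z⁺ ℤ.- 1ℤ) + f (z⁻ ℤ.+ 1ℤ))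
      ≡⟨ cong₂ _-_ (cong₂ _+_ (rec z⁺) (rec z⁻))
           (cong₂ (λ x y → f x + f y) (up-down z (ℤ.+ k)) (down-up z (ℤ.+ k))) ⟩
    (2# * θ * f z⁺ + 2# * θ * f z⁻) - (f (z ℤ.+ ℤ.+ k) + f (z ℤ.- ℤ.+ k))
      ≡⟨ cong₂ (λ x y → x - y) (sym (distribˡ (2# * θ) (f z⁺) (f z⁻))) (product-formula {f = f} rec k z) ⟩
    2# * θ * (f z⁺ + f z⁻) - 2# * T θ k * f z
      ≡⟨ cong (λ x → 2# * θ * x - 2# * T θ k * f z) (product-formula {f = f} rec (suc k) z) ⟩
    2# * θ * (2# * T θ (suc k) * f z) - 2# * T θ k * f z
      ≡⟨ solve 4 (λ θ a b x → con (ℤ.+ 2) :* θ :* (con (ℤ.+ 2) :* a :* x) :- con (ℤ.+ 2) :* b :* x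
           := con (ℤ.+ 2) :* (con (ℤ.+ 2) :* θ :* a :- b) :* x) refl θ (T θ (suc k)) (T θ k) (f z) ⟩
    2# * T θ (suc (suc k)) * f z ∎
    where
    open ≡-Reasoning
    z⁺ = z ℤ.+ ℤ.+ suc k
    z⁻ = z ℤ.- ℤ.+ suc k
    up : ∀ z k → z ℤ.+ (ℤ.+ 2 ℤ.+ k) ≡ z ℤ.+ (1ℤ ℤ.+ k) ℤ.+ 1ℤ
    up = ℤ-Solver.solve-∀
    down : ∀ z k → z ℤ.- (ℤ.+ 2 ℤ.+ k) ≡ z ℤ.- (1ℤ ℤ.+ k) ℤ.- 1ℤ
    down = ℤ-Solver.solve-∀
    up-down : ∀ z k → z ℤ.+ (1ℤ ℤ.+ k) ℤ.- 1ℤ ≡ z ℤ.+ k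
    up-down = ℤ-Solver.solve-∀
    down-up : ∀ z k → z ℤ.- (1ℤ ℤ.+ k) ℤ.+ 1ℤ ≡ z ℤ.- k
    down-up = ℤ-Solver.solve-∀

  -- The even solution normalised by its value 1 at zero: C (cos φ) z = cos (z φ).
  C : R → ℤ → R
  C x z = T x ℤ.∣ z ∣

  C-even : ∀ x z → C x (ℤ.- z) ≡ C x z
  C-even x z = cong (T x) (ℤ.∣-i∣≡∣i∣ z)

  C-recurrent : ∀ x → Recurrent x (C x)
  C-recurrent x (ℤ.+ zero)  = solve 1 (λ x → x :+ x := con (ℤ.+ 2) :* x :* con 1ℤ) refl x
  C-recurrent x (ℤ.+ suc k) = trans
    (cong (λ m → T x m + T x k) (ℕ.+-comm (suc k) 1))
    (solve 2 (λ a b → a :- b :+ b := a) refl (2# * x * T x (suc k)) (T x k))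
  C-recurrent x -[1+ k ] = trans
    (cong₂ (λ a b → a + T x b) (trans (cong (T x) (ℤ.∣m⊖n∣≡∣n⊖m∣ 1 (suc k)))
      (cong (C x) (ℤ.[1+m]⊖[1+n]≡m⊖n k 0))) (cong (λ (m : ℕ) → suc (suc m)) (ℕ.+-identityʳ k)))
    (solve 2 (λ a b → b :+ (a :- b) := a) refl (2# * x * T x (suc k)) (T x k))

  C-product : ∀ x y z → C x (z ℤ.+ y) + C x (z ℤ.- y) ≡ 2# * C x y * C x z
  C-product x (ℤ.+ k)  z = product-formula (C-recurrent x) k z
  C-product x -[1+ k ] z = trans (+-comm _ _) (product-formula (C-recurrent x) (suc k) z)

  T-one : ∀ k → T 1# k ≡ 1#
  T-one zero          = refl
  T-one (suc zero)    = refl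
  T-one (suc (suc k)) = trans (cong₂ (λ a b → 2# * 1# * a - b) (T-one (suc k)) (T-one k))
    (solve 0 (con (ℤ.+ 2) :* con 1ℤ :* con 1ℤ :- con 1ℤ := con 1ℤ) refl)

  infix 4 _≼_

  -- a ≼ A says that A ≥ 0 and the absolute value of a is at most A.
  _≼_ : R → R → Set
  a ≼ A = 0# ≤ A × 0# ≤ A - a × 0# ≤ A + a

  ≼-+ : ∀ {a A b B} → a ≼ A → b ≼ B → a + b ≼ A + B
  ≼-+ {a} {A} {b} {B} (0≤A , ua , la) (0≤B , ub , lb) = +-nonneg 0≤A 0≤B
    , subst (0# ≤_) (solve 4 (λ a A b B → (A :- a) :+ (B :- b) := A :+ B :- (a :+ b)) refl a A b B)
        (+-nonneg ua ub)
    , subst (0# ≤_) (solve 4 (λ a A b B → (A :+ a) :+ (B :+ b) := A :+ B :+ (a :+ b)) refl a A b B)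
        (+-nonneg la lb)

  ≼-neg : ∀ {a A} → a ≼ A → - a ≼ A
  ≼-neg {a} {A} (0≤A , ua , la) = 0≤A
    , subst (0# ≤_) (solve 2 (λ a A → A :+ a := A :- :- a) refl a A) la , ua

  ≼-scale : ∀ {x a A} → 0# ≤ x → x ≤ 1# → a ≼ A → x * a ≼ A
  ≼-scale {x} {a} {A} 0≤x x≤1 (0≤A , ua , la) = 0≤A
    , subst (0# ≤_) (solve 3 (λ x a A → (con 1ℤ :- x) :* A :+ x :* (A :- a) := A :- x :* a) refl x a A)
        (+-nonneg (*-nonneg _ _ (0≤y-x x≤1) 0≤A) (*-nonneg _ _ 0≤x ua))
    , subst (0# ≤_) (solve 3 (λ x a A → (con 1ℤ :- x) :* A :+ x :* (A :+ a) := A :+ x :* a) refl x a A)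
        (+-nonneg (*-nonneg _ _ (0≤y-x x≤1) 0≤A) (*-nonneg _ _ 0≤x la))

  ≼-double : ∀ {x a A} → 0# ≤ x → x ≤ 1# → a ≼ A → 2# * x * a ≼ A + A
  ≼-double {x} {a} {A} 0≤x x≤1 a≼A = subst (_≼ A + A)
    (solve 2 (λ x a → x :* a :+ x :* a := con (ℤ.+ 2) :* x :* a) refl x a)
    (≼-+ (≼-scale 0≤x x≤1 a≼A) (≼-scale 0≤x x≤1 a≼A))

  T-bounded : ∀ k → ∃[ M ] ∀ x → 0# ≤ x → x ≤ 1# → T x k ≼ M
  T-bounded zero       = 1# , λ x 0≤x x≤1 → 0≤1 , 0≤y-x ≤-refl , 0≤2
  T-bounded (suc zero) = 1# , λ x 0≤x x≤1 → 0≤1 , 0≤y-x x≤1 , +-nonneg 0≤1 0≤x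
  T-bounded (suc (suc k)) with T-bounded (suc k) | T-bounded k
  ... | M , M-bounds | M′ , M′-bounds = M + M + M′ , λ x 0≤x x≤1 →
    ≼-+ (≼-double 0≤x x≤1 (M-bounds x 0≤x x≤1)) (≼-neg (M′-bounds x 0≤x x≤1))

  -- The difference quotient (T y k - T x k) / (y - x), as a polynomial in y and x.
  quotient : R → R → ℕ → R
  quotient y x zero          = 0#
  quotient y x (suc zero)    = 1#
  quotient y x (suc (suc k)) = 2# * y * quotient y x (suc k) + 2# * 1# * T x (suc k) - quotient y x k

  T-difference : ∀ y x k → T y k - T x k ≡ (y - x) * quotient y x k
  T-difference y x zero          = solve 2 (λ y x → con 1ℤ :- con 1ℤ := (y :- x) :* con 0ℤ) refl y x
  T-difference y x (suc zero)    = sym (*-identityʳ _)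
  T-difference y x (suc (suc k)) = begin
    (2# * y * T₁ y - T₀ y) - (2# * x * T₁ x - T₀ x)
      ≡⟨ solve 6 (λ x y a b c d → (con (ℤ.+ 2) :* y :* a :- b) :- (con (ℤ.+ 2) :* x :* c :- d)
           := con (ℤ.+ 2) :* y :* (a :- c) :+ (y :- x) :* (con (ℤ.+ 2) :* con 1ℤ :* c) :- (b :- d))
           refl x y (T₁ y) (T₀ y) (T₁ x) (T₀ x) ⟩
    2# * y * (T₁ y - T₁ x) + (y - x) * (2# * 1# * T₁ x) - (T₀ y - T₀ x)
      ≡⟨ cong₂ (λ a b → 2# * y * a + (y - x) * (2# * 1# * T₁ x) - b)
           (T-difference y x (suc k)) (T-difference y x k) ⟩
    2# * y * ((y - x) * q₁) + (y - x) * (2# * 1# * T₁ x) - (y - x) * q₀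
      ≡⟨ solve 5 (λ x y q₁ c q₀ → con (ℤ.+ 2) :* y :* ((y :- x) :* q₁) :+ (y :- x) :*
          (con (ℤ.+ 2) :* con 1ℤ :* c) :- (y :- x) :* q₀
           := (y :- x) :* (con (ℤ.+ 2) :* y :* q₁ :+ con (ℤ.+ 2) :* con 1ℤ :* c :- q₀)) refl x y q₁
               (T₁ x) q₀ ⟩
    (y - x) * quotient y x (suc (suc k)) ∎
    where
    open ≡-Reasoning
    T₀ T₁ : R → R
    T₀ x = T x k
    T₁ x = T x (suc k)
    q₀ = quotient y x k
    q₁ = quotient y x (suc k)

  quotient-bounded : ∀ k → ∃[ M ] ∀ y x → 0# ≤ y → y ≤ 1# → 0# ≤ x → x ≤ 1# → quotient y x k ≼ M
  quotient-bounded zero       = 0# , λ y x _ _ _ _ →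
    ≤-refl , 0≤y-x ≤-refl , +-nonneg ≤-refl ≤-refl
  quotient-bounded (suc zero) = 1# , λ y x _ _ _ _ → 0≤1 , 0≤y-x ≤-refl , 0≤2
  quotient-bounded (suc (suc k)) with quotient-bounded (suc k) | T-bounded (suc k) | quotient-bounded k
  ... | M , M-bounds | N , N-bounds | M′ , M′-bounds = M + M + (N + N) + M′ , λ y x 0≤y y≤1 0≤x x≤1 →
    ≼-+ (≼-+ (≼-double 0≤y y≤1 (M-bounds y x 0≤y y≤1 0≤x x≤1))
             (≼-double 0≤1 ≤-refl (N-bounds x 0≤x x≤1)))
        (≼-neg (M′-bounds y x 0≤y y≤1 0≤x x≤1))

  -- A Lipschitz condition on [0, 1], with two inequalities in place of an
  -- absolute value.
  Lipschitz : R → (R → R) → Set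
  Lipschitz L f = ∀ x y → 0# ≤ x → x ≤ y → y ≤ 1# →
    f y - f x ≤ L * (y - x) × f x - f y ≤ L * (y - x)

  T-lipschitz : ∀ k → ∃[ L ] 0# < L × Lipschitz L (λ x → T x k)
  T-lipschitz k with quotient-bounded k
  ... | M , M-bounds = M + 1# , 0<L , lipschitz
    where
    0≤M = proj₁ (M-bounds 0# 0# ≤-refl 0≤1 ≤-refl 0≤1)
    0<L : 0# < M + 1#
    0<L = <-≤-trans (≤∧≢⇒< 0≤1 0≢1) (≤-by 0≤M (+-comm M 1#))
    lipschitz : Lipschitz (M + 1#) (λ x → T x k)
    lipschitz x y 0≤x x≤y y≤1 = ≤-by (+-nonneg (*-nonneg _ _ 0≤d q≤M) 0≤d) upper-eq
                              , ≤-by (+-nonneg (*-nonneg _ _ 0≤d -M≤q) 0≤d) lower-eq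
      where
      0≤d = 0≤y-x x≤y
      bounds = M-bounds y x (≤-trans 0≤x x≤y) y≤1 0≤x (≤-trans x≤y y≤1)
      q≤M = proj₁ (proj₂ bounds)
      -M≤q = proj₂ (proj₂ bounds)
      q = quotient y x k
      upper-eq = trans (solve 3 (λ d M q → (M :+ con 1ℤ) :* d := d :* q :+ (d :* (M :- q) :+ d)) refl
          (y - x) M q)
        (cong (λ t → t + ((y - x) * (M - q) + (y - x))) (sym (T-difference y x k)))
      lower-eq = trans (solve 3 (λ d M q → (M :+ con 1ℤ) :* d := :- (d :* q) :+ (d :* (M :+ q) :+ d)) refl
          (y - x) M q)
        (cong (λ t → t + ((y - x) * (M + q) + (y - x)))
          (trans (cong -_ (sym (T-difference y x k)))
            (solve 2 (λ a b → :- (a :- b) := b :- a) refl (T y k) (T x k))))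

  -- The supremum of the points of [a, 1] where f ≤ 0.
  largest-zero : ∀ {L f} → 0# < L → Lipschitz L f → ∀ {a} → 0# ≤ a → a ≤ 1# → f a < 0# → 0# < f 1# →
    ∃[ d ] a ≤ d × d ≤ 1# × f d ≡ 0# × (∀ x → d < x → x ≤ 1# → 0# < f x)
  largest-zero {L} {f} 0<L lip {a} 0≤a a≤1 fa<0 0<f1 = d , a≤d , d≤1 , fd≡0 , positive
    where
    P : R → Set
    P x = a ≤ x × x ≤ 1# × f x ≤ 0#
    supremum = complete P (a , ≤-refl , a≤1 , <⇒≤ fa<0) (1# , λ x Px → proj₁ (proj₂ Px))
    d = proj₁ supremum
    d-upper = proj₁ (proj₂ supremum)
    d-least = proj₂ (proj₂ supremum)
    a≤d = d-upper a (≤-refl , a≤1 , <⇒≤ fa<0)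
    d≤1 = d-least 1# λ x Px → proj₁ (proj₂ Px)
    0≤d = ≤-trans 0≤a a≤d
    i = L ⁻¹
    Li≡1 = *-inverse L (≢-sym (<⇒≢ 0<L))

    positive : ∀ x → d < x → x ≤ 1# → 0# < f x
    positive x d<x x≤1 fx≤0 = d<x (d-upper x (≤-trans a≤d (<⇒≤ d<x) , x≤1 , fx≤0))

    -- If f d were positive, d - f d / L would be a smaller upper bound.
    not-pos : ¬ 0# < f d
    not-pos 0<fd = *-pos 0<fd (⁻¹-pos 0<L) (≤-by (0≤y-x (d-least d′ d′-upper))
      (solve 2 (λ d s → con 0ℤ := s :+ (d :- s :- d)) refl d (f d * i)))
      where
      d′ = d - f d * i
      d′-upper : ∀ x → P x → x ≤ d′
      d′-upper x Px@(a≤x , x≤1 , fx≤0) = ≤-by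
        (*-nonneg _ _ (<⇒≤ (⁻¹-pos 0<L))
          (+-nonneg (0≤y-x (proj₁ (lip x d (≤-trans 0≤a a≤x) (d-upper x Px) d≤1))) (≤0⇒0≤- fx≤0)))
        (sym (trans (solve 6 (λ x d i L fd fx → x :+ i :* ((L :* (d :- x) :- (fd :- fx)) :- fx)
                       := x :+ (L :* i) :* (d :- x) :- fd :* i) refl x d i L (f d) (f x))
             (trans (cong (λ t → x + t * (d - x) - f d * i) Li≡1)
               (solve 3 (λ x d s → x :+ con 1ℤ :* (d :- x) :- s := d :- s) refl x d (f d * i)))))

    -- If f d were negative, f would not be positive until d - f d / L.
    not-neg : ¬ f d < 0#
    not-neg fd<0 = [ within , beyond ]′ (≤-total x 1#)
      where
      e = - f d
      0<e : 0# < e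
      0<e e≤0 = fd<0 (subst (0# ≤_) (solve 1 (λ x → :- :- x := x) refl (f d)) (≤0⇒0≤- e≤0))
      x = d + e * i
      0<ei = *-pos 0<e (⁻¹-pos 0<L)
      d≤x : d ≤ x
      d≤x = ≤-by (<⇒≤ 0<ei) refl
      d<x : d < x
      d<x = ≤∧≢⇒< d≤x λ d≡x → <⇒≢ 0<ei (trans (sym (-‿inverseʳ d))
        (trans (cong (_- d) d≡x) (solve 2 (λ d s → d :+ s :- d := s) refl d (e * i))))
      L[x-d]≡e : L * (x - d) ≡ e
      L[x-d]≡e = trans (solve 4 (λ L d e i → L :* (d :+ e :* i :- d) := (L :* i) :* e) refl L d e i)
        (trans (cong (_* e) Li≡1) (*-identityˡ e))
      within : ¬ x ≤ 1#
      within x≤1 = positive x d<x x≤1 (≤-by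
        (0≤y-x (proj₁ (lip d x 0≤d d≤x x≤1)))
        (sym (trans (solve 3 (λ r fx fd → fx :+ (r :- (fx :- fd)) := r :+ fd) refl (L * (x - d)) (f x) (f d))
          (trans (cong (_+ f d) L[x-d]≡e) (-‿inverseˡ (f d))))))
      beyond : ¬ 1# ≤ x
      beyond 1≤x = 0<f1 (≤-by
        (+-nonneg (0≤y-x (proj₁ (lip d 1# 0≤d d≤1 ≤-refl))) (*-nonneg _ _ (<⇒≤ 0<L) (0≤y-x 1≤x)))
        (sym (trans (solve 5 (λ L x d f1 fd → f1 :+ ((L :* (con 1ℤ :- d) :- (f1 :- fd)) :+ L :* (x :- con 1ℤ))
                       := L :* (x :- d) :+ fd) refl L x d (f 1#) (f d))
          (trans (cong (_+ f d) L[x-d]≡e) (-‿inverseˡ (f d))))))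

    fd≡0 : f d ≡ 0#
    fd≡0 with f d ≟ᴿ 0#
    ... | yes eq  = eq
    ... | no fd≢0 = [ (λ fd≤0 → contradiction (≤∧≢⇒< fd≤0 fd≢0) not-neg)
                    , (λ 0≤fd → contradiction (≤∧≢⇒< 0≤fd (≢-sym fd≢0)) not-pos) ]′ (≤-total (f d) 0#)

  -- The largest zero c = cos (π / (2 ℓ)) of T ℓ.  Beyond it T ℓ is positive, and
  -- from c on so are all preceding polynomials.
  record LargestZero (ℓ : ℕ) : Set where
    field
      c      : R
      0≤c    : 0# ≤ c
      c<1    : c < 1#
      T-zero : T c ℓ ≡ 0#
      T-pos  : ∀ x → c ≤ x → x ≤ 1# → ∀ j → j ℕ.< ℓ → 0# < T x j
      T-pos′ : ∀ x → c < x → x ≤ 1# → 0# < T x ℓ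

  0<1 : 0# < 1#
  0<1 = ≤∧≢⇒< 0≤1 0≢1

  -- The largest zeros of consecutive polynomials interlace: at the largest zero
  -- of T ℓ the next polynomial is negative, while it is 1 at 1.
  chebyshev-zero : ∀ k → LargestZero (suc k)
  chebyshev-zero zero = record
    { c = 0# ; 0≤c = ≤-refl ; c<1 = 0<1 ; T-zero = refl
    ; T-pos = λ { x _ _ zero _ → 0<1 ; x _ _ (suc j) (ℕ.s≤s ()) }
    ; T-pos′ = λ x 0<x _ → 0<x }
  chebyshev-zero (suc k) = record
    { c = d ; 0≤c = ≤-trans 0≤c c≤d
    ; c<1 = ≤∧≢⇒< d≤1 λ d≡1 → 0≢1 (sym (trans (sym (T-one (suc (suc k))))
        (trans (cong (λ x → T x (suc (suc k))) (sym d≡1)) Td≡0)))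
    ; T-zero = Td≡0 ; T-pos = pos ; T-pos′ = d-pos }
    where
    open LargestZero (chebyshev-zero k)
    -- The next polynomial takes the value 2 c 0 - T c k at c.
    Tc<0 : T c (suc (suc k)) < 0#
    Tc<0 0≤Tc = T-pos c ≤-refl (<⇒≤ c<1) k (ℕ.n<1+n k) (≤-by 0≤Tc
      (sym (trans (cong (λ t → T c k + (2# * c * t - T c k)) T-zero)
        (solve 2 (λ c t → t :+ (con (ℤ.+ 2) :* c :* con 0ℤ :- t) := con 0ℤ) refl c (T c k)))))
    lip = T-lipschitz (suc (suc k))
    zero-of-T = largest-zero {f = λ x → T x (suc (suc k))} (proj₁ (proj₂ lip)) (proj₂ (proj₂ lip)) 0≤c
        (<⇒≤ c<1)
      Tc<0 (subst (0# <_) (sym (T-one (suc (suc k)))) 0<1)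
    d = proj₁ zero-of-T
    c≤d = proj₁ (proj₂ zero-of-T)
    d≤1 = proj₁ (proj₂ (proj₂ zero-of-T))
    Td≡0 = proj₁ (proj₂ (proj₂ (proj₂ zero-of-T)))
    d-pos = proj₂ (proj₂ (proj₂ (proj₂ zero-of-T)))
    c<d : c < d
    c<d = ≤∧≢⇒< c≤d λ c≡d → <⇒≢ Tc<0 (trans (cong (λ x → T x (suc (suc k))) c≡d) Td≡0)
    pos : ∀ x → d ≤ x → x ≤ 1# → ∀ j → j ℕ.< suc (suc k) → 0# < T x j
    pos x d≤x x≤1 j (ℕ.s≤s j≤1+k) with ℕ.m≤n⇒m<n∨m≡n j≤1+k
    ... | inj₁ j<1+k = T-pos x (≤-trans c≤d d≤x) x≤1 j j<1+k
    ... | inj₂ refl  = T-pos′ x (<-≤-trans c<d d≤x) x≤1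

  -- With n = 4 ℓ, the largest zero of T ℓ is cos (2 π / n).
  module PrimitiveCosine {ℓ-1 : ℕ} (largest : LargestZero (suc ℓ-1)) where
    open LargestZero largest

    ℓ = suc ℓ-1

    -- cos z stands for the cosine of 2 π z / n.
    cos : ℤ → R
    cos = C c

    cos-antiperiodic : ∀ z → cos (z ℤ.+ ℤ.+ ℓ) ≡ - cos (z ℤ.- ℤ.+ ℓ)
    cos-antiperiodic z = begin
      cos (z ℤ.+ ℤ.+ ℓ)              ≡⟨ solve 2 (λ a b → a := (a :+ b) :- b) refl _ (cos (z ℤ.- ℤ.+ ℓ)) ⟩
      (cos (z ℤ.+ ℤ.+ ℓ) + b) - b    ≡⟨ cong (_- b) (C-product c (ℤ.+ ℓ) z) ⟩
      2# * T c ℓ * cos z - b         ≡⟨ cong (λ t → 2# * t * cos z - b) T-zero ⟩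
      2# * 0# * cos z - b
        ≡⟨ solve 2 (λ a b → con (ℤ.+ 2) :* con 0ℤ :* a :- b := :- b) refl (cos z) b ⟩
      - b                            ∎
      where
      open ≡-Reasoning
      b = cos (z ℤ.- ℤ.+ ℓ)

    cos-period : ∀ z → cos (z ℤ.+ ℤ.+ 4 ℤ.* ℤ.+ ℓ) ≡ cos z
    cos-period z = begin
      cos (z ℤ.+ ℤ.+ 4 ℤ.* L)                 ≡⟨ cong cos (regroup₁ z L) ⟩
      cos (z ℤ.+ L ℤ.+ (L ℤ.+ L) ℤ.+ L)       ≡⟨ cos-antiperiodic (z ℤ.+ L ℤ.+ (L ℤ.+ L)) ⟩
      - cos (z ℤ.+ L ℤ.+ (L ℤ.+ L) ℤ.- L)     ≡⟨ cong (λ y → - cos y) (regroup₂ z L) ⟩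
      - cos (z ℤ.+ L ℤ.+ L)                   ≡⟨ cong -_ (cos-antiperiodic (z ℤ.+ L)) ⟩
      - - cos (z ℤ.+ L ℤ.- L)                 ≡⟨ solve 1 (λ a → :- :- a := a) refl _ ⟩
      cos (z ℤ.+ L ℤ.- L)                     ≡⟨ cong cos (regroup₃ z L) ⟩
      cos z                                   ∎
      where
      open ≡-Reasoning
      L = ℤ.+ ℓ
      regroup₁ : ∀ z L → z ℤ.+ ℤ.+ 4 ℤ.* L ≡ z ℤ.+ L ℤ.+ (L ℤ.+ L) ℤ.+ L
      regroup₁ = ℤ-Solver.solve-∀
      regroup₂ : ∀ z L → z ℤ.+ L ℤ.+ (L ℤ.+ L) ℤ.- L ≡ z ℤ.+ L ℤ.+ L
      regroup₂ = ℤ-Solver.solve-∀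
      regroup₃ : ∀ z L → z ℤ.+ L ℤ.- L ≡ z
      regroup₃ = ℤ-Solver.solve-∀

    private
      period-ℕ : ∀ q z → cos (z ℤ.+ ℤ.+ q ℤ.* (ℤ.+ 4 ℤ.* ℤ.+ ℓ)) ≡ cos z
      period-ℕ zero    z = cong cos (ℤ.+-identityʳ z)
      period-ℕ (suc q) z = trans (cong cos (regroup z (ℤ.+ q) (ℤ.+ 4 ℤ.* ℤ.+ ℓ)))
        (trans (cos-period (z ℤ.+ ℤ.+ q ℤ.* (ℤ.+ 4 ℤ.* ℤ.+ ℓ))) (period-ℕ q z))
        where
        regroup : ∀ z q n → z ℤ.+ (1ℤ ℤ.+ q) ℤ.* n ≡ z ℤ.+ q ℤ.* n ℤ.+ n
        regroup = ℤ-Solver.solve-∀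

    cos-periodic : ∀ q z → cos (z ℤ.+ q ℤ.* (ℤ.+ 4 ℤ.* ℤ.+ ℓ)) ≡ cos z
    cos-periodic (ℤ.+ q)  z = period-ℕ q z
    cos-periodic -[1+ q ] z = trans (sym (period-ℕ (suc q) (z ℤ.+ -[1+ q ] ℤ.* (ℤ.+ 4 ℤ.* ℤ.+ ℓ))))
        (cong cos (cancel z (ℤ.+ suc q) (ℤ.+ 4 ℤ.* ℤ.+ ℓ)))
      where
      cancel : ∀ z q n → z ℤ.+ (ℤ.- q) ℤ.* n ℤ.+ q ℤ.* n ≡ z
      cancel = ℤ-Solver.solve-∀

    cos-cong : ∀ {y z} → ℤ.+ (4 ℕ.* ℓ) ∣ y ℤ.- z → cos y ≡ cos z
    cos-cong {y} {z} (divides q eq) = trans (cong cos (begin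
      y                                       ≡⟨ split y z ⟩
      z ℤ.+ (y ℤ.- z)                         ≡⟨ cong (λ t → z ℤ.+ t) eq ⟩
      z ℤ.+ q ℤ.* ℤ.+ (4 ℕ.* ℓ)               ≡⟨ cong (λ t → z ℤ.+ q ℤ.* t) (ℤ.pos-* 4 ℓ) ⟩
      z ℤ.+ q ℤ.* (ℤ.+ 4 ℤ.* ℤ.+ ℓ)           ∎)) (cos-periodic q z)
      where
      open ≡-Reasoning
      split : ∀ y z → y ≡ z ℤ.+ (y ℤ.- z)
      split = ℤ-Solver.solve-∀

    -- Up to the first zero the differences T c j - T c (j + 1) grow with j: each
    -- step adds 2 (1 - c) T c (j + 1).
    decreasing-below : ∀ j → j ℕ.< ℓ → T c (suc j) < T c j
    decreasing-below zero    _     = c<1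
    decreasing-below (suc j) 1+j<ℓ = <-by
      (+-pos (0<y-x (decreasing-below j (ℕ.<-trans (ℕ.n<1+n j) 1+j<ℓ)))
        (*-nonneg _ _ 0≤2 (*-nonneg _ _ (0≤y-x (<⇒≤ c<1)) (<⇒≤ (T-pos c ≤-refl (<⇒≤ c<1) (suc j) 1+j<ℓ)))))
      (solve 3 (λ c s t → s := (con (ℤ.+ 2) :* c :* s :- t) :+
          ((t :- s) :+ con (ℤ.+ 2) :* ((con 1ℤ :- c) :* s)))
        refl c (T c (suc j)) (T c j))

    -- The reflection cos (π - φ) = - cos φ.
    T-reflect : ∀ i j → i ℕ.+ j ≡ ℓ → T c (ℓ ℕ.+ j) ≡ - T c i
    T-reflect i j i+j≡ℓ = begin
      T c (ℓ ℕ.+ j)               ≡⟨ cong (T c) (ℕ.+-comm ℓ j) ⟩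
      cos (ℤ.+ j ℤ.+ ℤ.+ ℓ)       ≡⟨ cos-antiperiodic (ℤ.+ j) ⟩
      - cos (ℤ.+ j ℤ.- ℤ.+ ℓ)     ≡⟨ cong (λ m → - cos (ℤ.+ j ℤ.- ℤ.+ m)) (sym i+j≡ℓ) ⟩
      - cos (ℤ.+ j ℤ.- (ℤ.+ i ℤ.+ ℤ.+ j)) ≡⟨ cong (λ z → - cos z) (cancel (ℤ.+ i) (ℤ.+ j)) ⟩
      - cos (ℤ.- (ℤ.+ i))         ≡⟨ cong -_ (C-even c (ℤ.+ i)) ⟩
      - T c i                     ∎
      where
      open ≡-Reasoning
      cancel : ∀ i j → j ℤ.- (i ℤ.+ j) ≡ ℤ.- i
      cancel = ℤ-Solver.solve-∀

    decreasing : ∀ j → j ℕ.< ℓ ℕ.+ ℓ → T c (suc j) < T c j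
    decreasing j j<2ℓ with j ℕ.<? ℓ
    ... | yes j<ℓ = decreasing-below j j<ℓ
    ... | no  j≮ℓ = subst (λ m → T c (suc m) < T c m) (ℕ.m+[n∸m]≡n ℓ≤j)
      (subst₂ _<_ (sym (trans (cong (T c) (sym (ℕ.+-suc ℓ i)))
          (T-reflect k (suc i) (trans (ℕ.+-suc k i) (trans (cong suc (ℕ.+-comm k i)) 1+i+k≡ℓ)))))
                  (sym (T-reflect (suc k) i (trans (cong suc (ℕ.+-comm k i)) 1+i+k≡ℓ)))
        (<-by (0<y-x (decreasing-below k (subst (k ℕ.<_) 1+i+k≡ℓ (ℕ.s≤s (ℕ.m≤n+m k i)))))
          (solve 2 (λ a b → :- a := :- b :+ (b :- a)) refl (T c (suc k)) (T c k))))
      where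
      ℓ≤j = ℕ.≮⇒≥ j≮ℓ
      i = j ℕ.∸ ℓ
      i<ℓ : i ℕ.< ℓ
      i<ℓ = ℕ.+-cancelˡ-< ℓ i ℓ (subst (ℕ._< ℓ ℕ.+ ℓ) (sym (ℕ.m+[n∸m]≡n ℓ≤j)) j<2ℓ)
      k = ℓ ℕ.∸ suc i
      1+i+k≡ℓ : suc i ℕ.+ k ≡ ℓ
      1+i+k≡ℓ = ℕ.m+[n∸m]≡n i<ℓ

    strictly-decreasing : ∀ {i j} → i ℕ.< j → j ℕ.≤ ℓ ℕ.+ ℓ → T c j < T c i
    strictly-decreasing {i} {suc j} (ℕ.s≤s i≤j) j<2ℓ with ℕ.m≤n⇒m<n∨m≡n i≤j
    ... | inj₂ refl = decreasing i j<2ℓ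
    ... | inj₁ i<j  = ≤-<-trans (<⇒≤ (decreasing j j<2ℓ)) (strictly-decreasing i<j (ℕ.<⇒≤ j<2ℓ))

    T-injective : ∀ {i j} → i ℕ.≤ ℓ ℕ.+ ℓ → j ℕ.≤ ℓ ℕ.+ ℓ → T c i ≡ T c j → i ≡ j
    T-injective {i} {j} i≤2ℓ j≤2ℓ eq with ℕ.<-cmp i j
    ... | tri< i<j _ _ = contradiction (sym eq) (<⇒≢ (strictly-decreasing i<j j≤2ℓ))
    ... | tri≈ _ i≡j _ = i≡j
    ... | tri> _ _ j<i = contradiction eq (<⇒≢ (strictly-decreasing j<i i≤2ℓ))

    cos≡1⇒period : ∀ z → cos z ≡ 1# → ℤ.+ (4 ℕ.* ℓ) ∣ z
    cos≡1⇒period z cos-z≡1 =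
        divides q (trans z≡r+qn (trans (cong (λ m → ℤ.+ m ℤ.+ q ℤ.* ℤ.+ n) r≡0) (ℤ.+-identityˡ _)))
      where
      n = 4 ℕ.* ℓ
      q = z ℤ./ℕ n
      r = z ℤ.%ℕ n
      z≡r+qn = a≡a%ℕn+[a/ℕn]*n z n
      r<n : r ℕ.< n
      r<n = n%ℕd<d z n
      cos-r≡1 : T c r ≡ 1#
      cos-r≡1 = trans (sym (cos-cong {z} {ℤ.+ r} (divides q
        (trans (cong (ℤ._- ℤ.+ r) z≡r+qn) (cancel (ℤ.+ r) (q ℤ.* ℤ.+ n)))))) cos-z≡1
        where
        cancel : ∀ r x → r ℤ.+ x ℤ.- r ≡ x
        cancel = ℤ-Solver.solve-∀
      4ℓ≡2ℓ+2ℓ : n ≡ (ℓ ℕ.+ ℓ) ℕ.+ (ℓ ℕ.+ ℓ)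
      4ℓ≡2ℓ+2ℓ = lemma ℓ
        where
        lemma : ∀ ℓ → 4 ℕ.* ℓ ≡ (ℓ ℕ.+ ℓ) ℕ.+ (ℓ ℕ.+ ℓ)
        lemma = ℕ-Solver.solve-∀
      r≡0 : r ≡ 0
      r≡0 with r ℕ.≤? ℓ ℕ.+ ℓ
      ... | yes r≤2ℓ = T-injective r≤2ℓ ℕ.z≤n cos-r≡1
      -- Otherwise n - r lies in the lower half of the period.
      ... | no  r≰2ℓ = contradiction (trans (cong (r ℕ.+_) (sym s≡0)) (ℕ.m+[n∸m]≡n (ℕ.<⇒≤ r<n)))
                         λ r+0≡n → ℕ.<⇒≢ r<n (trans (sym (ℕ.+-identityʳ r)) r+0≡n)
        where
        s = n ℕ.∸ r
        s≤2ℓ : s ℕ.≤ ℓ ℕ.+ ℓ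
        s≤2ℓ = ℕ.m≤n+o⇒m∸n≤o n r (subst (ℕ._≤ r ℕ.+ (ℓ ℕ.+ ℓ)) (sym 4ℓ≡2ℓ+2ℓ)
            (ℕ.+-monoˡ-≤ (ℓ ℕ.+ ℓ) (ℕ.<⇒≤ (ℕ.≰⇒> r≰2ℓ))))
        cos-s≡1 : T c s ≡ 1#
        cos-s≡1 = trans (sym (C-even c (ℤ.+ s))) (trans (cos-cong {ℤ.- (ℤ.+ s)} {ℤ.+ r} (divides -1ℤ
          (trans (neg-sum (ℤ.+ s) (ℤ.+ r)) (trans (cong (λ m → ℤ.- (ℤ.+ m)) (ℕ.m+[n∸m]≡n (ℕ.<⇒≤ r<n)))
            (sym (ℤ.-1*i≡-i (ℤ.+ n))))))) cos-r≡1)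
          where
          neg-sum : ∀ s r → ℤ.- s ℤ.- r ≡ ℤ.- (r ℤ.+ s)
          neg-sum = ℤ-Solver.solve-∀
        s≡0 : s ≡ 0
        s≡0 = T-injective s≤2ℓ ℕ.z≤n cos-s≡1

-- Rotations of the cycle

module Rotation {n : ℕ} where

  ∣-small⇒≡0 : ∀ {z} → ℤ.+ n ∣ z → ℤ.∣ z ∣ ℕ.< n → z ≡ 0ℤ
  ∣-small⇒≡0 {z} n∣z ∣z∣<n with ℤ.∣ z ∣ in eq | ∣⇒∣ᵤ n∣z
  ... | zero  | _   = ℤ.∣i∣≡0⇒i≡0 eq
  ... | suc _ | n∣s = contradiction (ℕ.∣⇒≤ n∣s) (ℕ.<⇒≱ ∣z∣<n)

  congruent⇒≡ : ∀ {i j : Fin n} → ℤ.+ n ∣ ℤ.+ toℕ i ℤ.- ℤ.+ toℕ j → i ≡ j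
  congruent⇒≡ {i} {j} n∣i-j = toℕ-injective (ℤ.+-injective (ℤ.i-j≡0⇒i≡j _ _ (∣-small⇒≡0 n∣i-j bound′)))
    where
    bound′ : ℤ.∣ ℤ.+ toℕ i ℤ.- ℤ.+ toℕ j ∣ ℕ.< n
    bound′ = ℕ.≤-<-trans
      (subst (ℕ._≤ toℕ i ℕ.⊔ toℕ j) (cong ℤ.∣_∣ (sym (ℤ.m-n≡m⊖n (toℕ i) (toℕ j))))
          (ℤ.∣m⊝n∣≤m⊔n (toℕ i) (toℕ j)))
      (ℕ.⊔-lub (toℕ<n i) (toℕ<n j))

  -- i ⊕ k represents i + k modulo n.
  toℕ-⊕ : ∀ (i : Fin n) k → ℤ.+ n ∣ ℤ.+ toℕ (i ⊕ k) ℤ.- (ℤ.+ toℕ i ℤ.+ k)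
  toℕ-⊕ i k = divides (ℤ.- q) (begin
    ℤ.+ toℕ (i ⊕ k) ℤ.- s                   ≡⟨ cong (λ m → ℤ.+ m ℤ.- s) (toℕ-fromℕ< (n%ℕd<d s n)) ⟩
    ℤ.+ r ℤ.- s                             ≡⟨ cong (λ t → ℤ.+ r ℤ.- t) (a≡a%ℕn+[a/ℕn]*n s n) ⟩
    ℤ.+ r ℤ.- (ℤ.+ r ℤ.+ q ℤ.* ℤ.+ n)       ≡⟨ cancel (ℤ.+ r) q (ℤ.+ n) ⟩
    (ℤ.- q) ℤ.* ℤ.+ n                       ∎)
    where
    open ≡-Reasoning
    instance _ = nonZeroIndex i
    s = ℤ.+ toℕ i ℤ.+ k
    q = s ℤ./ℕ n
    r = s ℤ.%ℕ n
    cancel : ∀ r q n → r ℤ.- (r ℤ.+ q ℤ.* n) ≡ (ℤ.- q) ℤ.* n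
    cancel = ℤ-Solver.solve-∀

  ⊕-cong : ∀ (i : Fin n) j k → ℤ.+ n ∣ j ℤ.- k → i ⊕ j ≡ i ⊕ k
  ⊕-cong i j k n∣j-k = congruent⇒≡
      (subst (ℤ.+ n ∣_) (regroup (ℤ.+ toℕ i) j k (ℤ.+ toℕ (i ⊕ j)) (ℤ.+ toℕ (i ⊕ k)))
    (∣m∣n⇒∣m+n (∣m∣n⇒∣m-n (toℕ-⊕ i j) (toℕ-⊕ i k)) n∣j-k))
    where
    regroup : ∀ i j k x y → (x ℤ.- (i ℤ.+ j)) ℤ.- (y ℤ.- (i ℤ.+ k)) ℤ.+ (j ℤ.- k) ≡ x ℤ.- y
    regroup = ℤ-Solver.solve-∀

  ⊕-injective : ∀ (i : Fin n) j k → i ⊕ j ≡ i ⊕ k → ℤ.+ n ∣ j ℤ.- k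
  ⊕-injective i j k eq = subst (ℤ.+ n ∣_)
    (trans (cong (λ v → ℤ.+ toℕ v ℤ.- (ℤ.+ toℕ i ℤ.+ k) ℤ.- (ℤ.+ toℕ (i ⊕ j) ℤ.- (ℤ.+ toℕ i ℤ.+ j))) (sym eq))
      (regroup (ℤ.+ toℕ i) j k (ℤ.+ toℕ (i ⊕ j))))
    (∣m∣n⇒∣m-n (toℕ-⊕ i k) (toℕ-⊕ i j))
    where
    regroup : ∀ i j k x → x ℤ.- (i ℤ.+ k) ℤ.- (x ℤ.- (i ℤ.+ j)) ≡ j ℤ.- k
    regroup = ℤ-Solver.solve-∀

  ⊕-⊕ : ∀ (i : Fin n) j k → (i ⊕ j) ⊕ k ≡ i ⊕ (j ℤ.+ k)
  ⊕-⊕ i j k = congruent⇒≡ (subst (ℤ.+ n ∣_)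
    (regroup (ℤ.+ toℕ i) j k (ℤ.+ toℕ (i ⊕ j)) (ℤ.+ toℕ ((i ⊕ j) ⊕ k)) (ℤ.+ toℕ (i ⊕ (j ℤ.+ k))))
    (∣m∣n⇒∣m-n (∣m∣n⇒∣m+n (toℕ-⊕ (i ⊕ j) k) (toℕ-⊕ i j)) (toℕ-⊕ i (j ℤ.+ k))))
    where
    regroup : ∀ i j k x y z → (y ℤ.- (x ℤ.+ k)) ℤ.+ (x ℤ.- (i ℤ.+ j)) ℤ.- (z ℤ.- (i ℤ.+ (j ℤ.+ k))) ≡ y ℤ.- z
    regroup = ℤ-Solver.solve-∀

  ⊕-identity : ∀ (i : Fin n) → i ⊕ 0ℤ ≡ i
  ⊕-identity i = congruent⇒≡ (subst (λ z → ℤ.+ n ∣ ℤ.+ toℕ (i ⊕ 0ℤ) ℤ.- z) (ℤ.+-identityʳ (ℤ.+ toℕ i))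
      (toℕ-⊕ i 0ℤ))

  ⊕-cancel : ∀ (i : Fin n) k → (i ⊕ k) ⊕ (ℤ.- k) ≡ i
  ⊕-cancel i k = trans (⊕-⊕ i k (ℤ.- k)) (trans (cong (i ⊕_) (ℤ.+-inverseʳ k)) (⊕-identity i))

  ⊕-cancel′ : ∀ (i : Fin n) k → (i ⊕ (ℤ.- k)) ⊕ k ≡ i
  ⊕-cancel′ i k = trans (⊕-⊕ i (ℤ.- k) k) (trans (cong (i ⊕_) (ℤ.+-inverseˡ k)) (⊕-identity i))

  ⊕-fixed : ∀ (i : Fin n) k → i ⊕ k ≡ i → ℤ.+ n ∣ k
  ⊕-fixed i k eq = subst (ℤ.+ n ∣_) (ℤ.+-identityʳ k) (⊕-injective i k 0ℤ (trans eq (sym (⊕-identity i))))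

  ⊕-fix : ∀ (i : Fin n) k → ℤ.+ n ∣ k → i ⊕ k ≡ i
  ⊕-fix i k n∣k = trans (⊕-cong i k 0ℤ (subst (ℤ.+ n ∣_) (sym (ℤ.+-identityʳ k)) n∣k)) (⊕-identity i)

  ⊕-moves : ∀ (i : Fin n) k → 0 ℕ.< k → k ℕ.< n → i ≢ i ⊕ ℤ.+ k
  ⊕-moves i (suc k) _ 1+k<n eq =
    contradiction (∣-small⇒≡0 (⊕-fixed i (ℤ.+ suc k) (sym eq)) 1+k<n) λ ()

  adjacent : ∀ {i j : Fin n} → CycleAdjacent i j → j ≡ i ⊕ 1ℤ ⊎ j ≡ i ⊕ -1ℤ
  adjacent {i} {j} = [ (λ d → inj₂ (shift -1ℤ (subst (ℤ.+ n ∣_) (eq₁ (ℤ.+ toℕ i) (ℤ.+ toℕ j)) d)))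
                     , (λ d → inj₁ (shift 1ℤ (subst (ℤ.+ n ∣_) (eq₂ (ℤ.+ toℕ i) (ℤ.+ toℕ j)) d))) ]′
    where
    eq₁ : ∀ i j → i ℤ.- j ℤ.- 1ℤ ≡ (i ℤ.+ -1ℤ) ℤ.- j
    eq₁ = ℤ-Solver.solve-∀
    eq₂ : ∀ i j → i ℤ.- j ℤ.- -1ℤ ≡ (i ℤ.+ 1ℤ) ℤ.- j
    eq₂ = ℤ-Solver.solve-∀
    regroup : ∀ s j x → ℤ.- ((x ℤ.- s) ℤ.+ (s ℤ.- j)) ≡ j ℤ.- x
    regroup = ℤ-Solver.solve-∀
    shift : ∀ k → ℤ.+ n ∣ (ℤ.+ toℕ i ℤ.+ k) ℤ.- ℤ.+ toℕ j → j ≡ i ⊕ k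
    shift k d = congruent⇒≡ (subst (ℤ.+ n ∣_) (regroup (ℤ.+ toℕ i ℤ.+ k) (ℤ.+ toℕ j) (ℤ.+ toℕ (i ⊕ k)))
      (∣m⇒∣-m (∣m∣n⇒∣m+n (toℕ-⊕ i k) d)))

  next-adjacent : ∀ (i : Fin n) → CycleAdjacent i (i ⊕ 1ℤ)
  next-adjacent i = inj₂ (subst (ℤ.+ n ∣_) (regroup (ℤ.+ toℕ i) (ℤ.+ toℕ (i ⊕ 1ℤ))) (∣m⇒∣-m (toℕ-⊕ i 1ℤ)))
    where
    regroup : ∀ i x → ℤ.- (x ℤ.- (i ℤ.+ 1ℤ)) ≡ i ℤ.- x ℤ.- -1ℤ
    regroup = ℤ-Solver.solve-∀

  previous-adjacent : ∀ (i : Fin n) → CycleAdjacent i (i ⊕ -1ℤ)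
  previous-adjacent i = inj₁ (subst (ℤ.+ n ∣_) (regroup (ℤ.+ toℕ i) (ℤ.+ toℕ (i ⊕ -1ℤ)))
      (∣m⇒∣-m (toℕ-⊕ i -1ℤ)))
    where
    regroup : ∀ i x → ℤ.- (x ℤ.- (i ℤ.+ -1ℤ)) ≡ i ℤ.- x ℤ.- 1ℤ
    regroup = ℤ-Solver.solve-∀

  -- If n divides 4 t but not t, then t is n / 2, n / 4 or - n / 4 modulo n.
  quarter-turns : ∀ {t} → ℤ.+ n ∣ ℤ.+ 4 ℤ.* t → ¬ ℤ.+ n ∣ t →
    (∃[ m ] n ≡ 2 ℕ.* m × ℤ.+ n ∣ t ℤ.- ℤ.+ m) ⊎
    (∃[ ℓ ] n ≡ 4 ℕ.* ℓ × ((ℤ.+ n ∣ (t ℤ.- ℤ.+ ℓ)) ⊎ (ℤ.+ n ∣ (t ℤ.- ℤ.- (ℤ.+ ℓ)))))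
  quarter-turns {t} (divides q 4t≡qn) n∤t = cases (q ℤ.%ℕ 4) refl (n%ℕd<d q 4)
    where
    -- The cases are the residues of q modulo 4.
    a = q ℤ./ℕ 4
    N = ℤ.+ n
    4t≡ : ℤ.+ 4 ℤ.* t ≡ (ℤ.+ (q ℤ.%ℕ 4) ℤ.+ a ℤ.* ℤ.+ 4) ℤ.* N
    4t≡ = trans 4t≡qn (cong (ℤ._* N) (a≡a%ℕn+[a/ℕn]*n q 4))

    -- If n is a positive multiple of z, then z is a natural number.
    natural : ∀ k z → N ≡ ℤ.+ suc k ℤ.* z → ∃[ m ] z ≡ ℤ.+ m × n ≡ suc k ℕ.* m
    natural k (ℤ.+ m)  eq = m , refl , ℤ.+-injective (trans eq (sym (ℤ.pos-* (suc k) m)))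

    cases : ∀ r → q ℤ.%ℕ 4 ≡ r → r ℕ.< 4 → _
    cases 0 r≡ _ = contradiction (divides a (ℤ.*-cancelˡ-≡ (ℤ.+ 4) _ _ (trans 4t≡
      (trans (cong (λ r → (ℤ.+ r ℤ.+ a ℤ.* ℤ.+ 4) ℤ.* N) r≡) (regroup a N))))) n∤t
      where
      regroup : ∀ a n → (0ℤ ℤ.+ a ℤ.* ℤ.+ 4) ℤ.* n ≡ ℤ.+ 4 ℤ.* (a ℤ.* n)
      regroup = ℤ-Solver.solve-∀
    cases 1 r≡ _ with natural 3 (t ℤ.- a ℤ.* N) N≡
      where
      regroup : ∀ a n → n ≡ (1ℤ ℤ.+ a ℤ.* ℤ.+ 4) ℤ.* n ℤ.- ℤ.+ 4 ℤ.* (a ℤ.* n)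
      regroup = ℤ-Solver.solve-∀
      regroup′ : ∀ t x → ℤ.+ 4 ℤ.* t ℤ.- ℤ.+ 4 ℤ.* x ≡ ℤ.+ 4 ℤ.* (t ℤ.- x)
      regroup′ = ℤ-Solver.solve-∀
      N≡ : N ≡ ℤ.+ 4 ℤ.* (t ℤ.- a ℤ.* N)
      N≡ = trans (regroup a N) (trans (cong (ℤ._- ℤ.+ 4 ℤ.* (a ℤ.* N)) (sym (trans 4t≡
        (cong (λ r → (ℤ.+ r ℤ.+ a ℤ.* ℤ.+ 4) ℤ.* N) r≡)))) (regroup′ t (a ℤ.* N)))
    ... | ℓ , z≡ℓ , n≡4ℓ = inj₂ (ℓ , n≡4ℓ , inj₁ (divides a
      (trans (cong (λ z → t ℤ.- z) (sym z≡ℓ)) (cancel t (a ℤ.* N)))))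
      where
      cancel : ∀ t x → t ℤ.- (t ℤ.- x) ≡ x
      cancel = ℤ-Solver.solve-∀
    cases 2 r≡ _ with natural 1 (t ℤ.- a ℤ.* N) N≡
      where
      regroup : ∀ a n → ℤ.+ 2 ℤ.* n ≡ (ℤ.+ 2 ℤ.+ a ℤ.* ℤ.+ 4) ℤ.* n ℤ.- ℤ.+ 4 ℤ.* (a ℤ.* n)
      regroup = ℤ-Solver.solve-∀
      regroup′ : ∀ t x → ℤ.+ 4 ℤ.* t ℤ.- ℤ.+ 4 ℤ.* x ≡ ℤ.+ 2 ℤ.* (ℤ.+ 2 ℤ.* (t ℤ.- x))
      regroup′ = ℤ-Solver.solve-∀
      N≡ : N ≡ ℤ.+ 2 ℤ.* (t ℤ.- a ℤ.* N)
      N≡ = ℤ.*-cancelˡ-≡ (ℤ.+ 2) _ _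
          (trans (regroup a N) (trans (cong (ℤ._- ℤ.+ 4 ℤ.* (a ℤ.* N)) (sym (trans 4t≡
        (cong (λ r → (ℤ.+ r ℤ.+ a ℤ.* ℤ.+ 4) ℤ.* N) r≡)))) (regroup′ t (a ℤ.* N))))
    ... | m , z≡m , n≡2m = inj₁ (m , n≡2m , divides a
      (trans (cong (λ z → t ℤ.- z) (sym z≡m)) (cancel t (a ℤ.* N))))
      where
      cancel : ∀ t x → t ℤ.- (t ℤ.- x) ≡ x
      cancel = ℤ-Solver.solve-∀
    cases 3 r≡ _ with natural 3 (a ℤ.* N ℤ.+ N ℤ.- t) N≡
      where
      regroup : ∀ a n → n ≡ ℤ.+ 4 ℤ.* (a ℤ.* n ℤ.+ n) ℤ.- (ℤ.+ 3 ℤ.+ a ℤ.* ℤ.+ 4) ℤ.* n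
      regroup = ℤ-Solver.solve-∀
      regroup′ : ∀ t x → ℤ.+ 4 ℤ.* x ℤ.- ℤ.+ 4 ℤ.* t ≡ ℤ.+ 4 ℤ.* (x ℤ.- t)
      regroup′ = ℤ-Solver.solve-∀
      N≡ : N ≡ ℤ.+ 4 ℤ.* (a ℤ.* N ℤ.+ N ℤ.- t)
      N≡ = trans (regroup a N) (trans (cong (λ z → ℤ.+ 4 ℤ.* (a ℤ.* N ℤ.+ N) ℤ.- z) (sym (trans 4t≡
        (cong (λ r → (ℤ.+ r ℤ.+ a ℤ.* ℤ.+ 4) ℤ.* N) r≡)))) (regroup′ t (a ℤ.* N ℤ.+ N)))
    ... | ℓ , z≡ℓ , n≡4ℓ = inj₂ (ℓ , n≡4ℓ , inj₂ (divides (a ℤ.+ 1ℤ)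
      (trans (cong (λ z → t ℤ.- ℤ.- z) (sym z≡ℓ)) (cancel t a N))))
      where
      cancel : ∀ t a n → t ℤ.- ℤ.- (a ℤ.* n ℤ.+ n ℤ.- t) ≡ (a ℤ.+ 1ℤ) ℤ.* n
      cancel = ℤ-Solver.solve-∀
    cases (suc (suc (suc (suc _)))) _ (ℕ.s≤s (ℕ.s≤s (ℕ.s≤s (ℕ.s≤s ()))))

-- The walk as a permutation of the arcs

-- The two orientations of the cycle.
data Direction : Set where
  forward backward : Direction

opposite : Direction → Direction
opposite forward  = backward
opposite backward = forward

-- The displacement of t steps in a given direction.
shift : Direction → ℕ → ℤ
shift forward  t = ℤ.+ t
shift backward t = ℤ.- (ℤ.+ t)

shift-suc : ∀ d t → shift d 1 ℤ.+ shift d t ≡ shift d (suc t)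
shift-suc forward  t       = refl
shift-suc backward zero    = refl
shift-suc backward (suc t) = refl

shift-opposite : ∀ d t → shift (opposite d) t ≡ ℤ.- shift d t
shift-opposite forward  t = refl
shift-opposite backward t = sym (ℤ.neg-involutive (ℤ.+ t))

module CycleWalk (ℝ : CompleteOrderedField) (n : ℕ) (3≤n : 3 ℕ.≤ n) where
  open RealField ℝ
  open ArcReversalWalk ℝ (cycle n 3≤n) public renaming (B to 𝐁)
  open Graph (cycle n 3≤n) public
  open Rotation {n}

  indicator-yes : ∀ {P : Set} (d : Dec P) → P → indicator d ≡ 1#
  indicator-yes (yes _) p = refl
  indicator-yes (no ¬p) p = contradiction p ¬p

  indicator-no : ∀ {P : Set} (d : Dec P) → ¬ P → indicator d ≡ 0#
  indicator-no (yes p) ¬p = contradiction p ¬p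
  indicator-no (no _)  ¬p = refl

  indicator-cong : ∀ {P Q : Set} (d : Dec P) (e : Dec Q) → (P → Q) → (Q → P) → indicator d ≡ indicator e
  indicator-cong (yes p) e to from = sym (indicator-yes e (to p))
  indicator-cong (no ¬p) e to from = sym (indicator-no e (¬p ∘ from))

  indicator-nonneg : ∀ {P : Set} (d : Dec P) → 0# ≤ indicator d
  indicator-nonneg (yes _) = 0≤1
  indicator-nonneg (no _)  = ≤-refl

  -- The Kronecker delta.
  δ : V → V → R
  δ = 𝐞

  δ-refl : ∀ u → δ u u ≡ 1#
  δ-refl u = indicator-yes (u ≟ u) refl

  δ-off : ∀ {u v} → u ≢ v → δ u v ≡ 0#
  δ-off {u} {v} = indicator-no (u ≟ v)

  δ-sym : ∀ u v → δ u v ≡ δ v u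
  δ-sym u v = indicator-cong (u ≟ v) (v ≟ u) sym sym

  δ-⊕ : ∀ (u : V) k (v : V) → δ (u ⊕ k) v ≡ δ u (v ⊕ (ℤ.- k))
  δ-⊕ u k v = indicator-cong (u ⊕ k ≟ v) (u ≟ v ⊕ (ℤ.- k))
    (λ eq → trans (sym (⊕-cancel u k)) (cong (_⊕ (ℤ.- k)) eq))
    (λ eq → trans (cong (_⊕ k) eq) (⊕-cancel′ v k))

  sum-δ : ∀ u (f : V → R) → sum (λ k → δ u k * f k) ≡ f u
  sum-δ u f = trans (sum-single _ u λ k k≢u → trans (cong (_* f k) (δ-off (≢-sym k≢u))) (zeroˡ (f k)))
    (trans (cong (_* f u) (δ-refl u)) (*-identityˡ (f u)))

  small-shift : ∀ {u : V} {j k} → j ℤ.- k ≢ 0ℤ → ℤ.∣ j ℤ.- k ∣ ℕ.< n → u ⊕ j ≢ u ⊕ k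
  small-shift {u} {j} {k} j-k≢0 small eq = j-k≢0 (∣-small⇒≡0 (⊕-injective u j k eq) small)

  adjacent-shift : ∀ d (u : V) → CycleAdjacent u (u ⊕ shift d 1)
  adjacent-shift forward  = next-adjacent
  adjacent-shift backward = previous-adjacent

  neighbours-differ : ∀ d (u : V) → u ⊕ shift d 1 ≢ u ⊕ shift (opposite d) 1
  neighbours-differ forward  u = small-shift {u} {1ℤ} { -1ℤ} (λ ()) 3≤n
  neighbours-differ backward u = small-shift {u} { -1ℤ} {1ℤ} (λ ()) 3≤n

  shift-adj : ∀ d (u : V) → Bool.T (adj u (u ⊕ shift d 1))
  shift-adj d u = fromWitness {a? = cycleAdjacent? u (u ⊕ shift d 1)} (adjacent-shift d u)

  adj-shift : ∀ u v → Bool.T (adj u v) → v ≡ u ⊕ shift forward 1 ⊎ v ≡ u ⊕ shift backward 1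
  adj-shift u v uv = adjacent {i = u} {v} (toWitness {a? = cycleAdjacent? u v} uv)

  -- The arc leaving u in a given direction.
  arc : Direction → V → Arc
  arc d u = u , u ⊕ shift d 1 , shift-adj d u

  arc-≡ : ∀ {u v w} (uv : Bool.T (adj u v)) (uw : Bool.T (adj u w)) → v ≡ w →
      _≡_ {A = Arc} (u , v , uv) (u , w , uw)
  arc-≡ {u} {v} uv uw refl = cong (λ e → u , v , e) (T-irrelevant uv uw)

  arc-exhaustive : ∀ a → ∃[ d ] ∃[ u ] a ≡ arc d u
  arc-exhaustive (u , v , uv) = [ (λ v≡ → forward  , u , arc-≡ uv (shift-adj forward u) v≡)
                                , (λ v≡ → backward , u , arc-≡ uv (shift-adj backward u) v≡) ]′
                                    (adj-shift u v uv)

  atArc-yes : ∀ f u v d (uv : Bool.T (adj u v)) → atArc f u v d ≡ f (u , v , uv)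
  atArc-yes f u v (yes uv′) uv = cong f (arc-≡ uv′ uv refl)
  atArc-yes f u v (no ¬uv)  uv = contradiction uv ¬uv

  atArc-no : ∀ f u v d → ¬ Bool.T (adj u v) → atArc f u v d ≡ 0#
  atArc-no f u v (yes uv) ¬uv = contradiction uv ¬uv
  atArc-no f u v (no _)   ¬uv = refl

  sum-neighbours : ∀ f d u → sum (λ v → atArc f u v (T? (adj u v))) ≡ f (arc d u) + f (arc (opposite d) u)
  sum-neighbours f d u = trans
    (sum-pair _ (neighbours-differ d u) λ v v≢ v≢′ → atArc-no f u v (T? (adj u v)) (off d v v≢ v≢′))
    (cong₂ _+_ (at d) (at (opposite d)))
    where
    at : ∀ d → atArc f u (u ⊕ shift d 1) (T? (adj u (u ⊕ shift d 1))) ≡ f (arc d u)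
    at d = atArc-yes f u (u ⊕ shift d 1) (T? (adj u (u ⊕ shift d 1))) (shift-adj d u)
    off : ∀ d v → v ≢ u ⊕ shift d 1 → v ≢ u ⊕ shift (opposite d) 1 → ¬ Bool.T (adj u v)
    off forward  v v≢ v≢′ uv = [ v≢ , v≢′ ]′ (adj-shift u v uv)
    off backward v v≢ v≢′ uv = [ v≢′ , v≢ ]′ (adj-shift u v uv)

  sum-arcs : ∀ f d → ∑ₐ f ≡ sum λ u → f (arc d u) + f (arc (opposite d) u)
  sum-arcs f d = sum-cong-≗ (sum-neighbours f d)

  ∑ₐ-cong : ∀ {f g} → (∀ a → f a ≡ g a) → ∑ₐ f ≡ ∑ₐ g
  ∑ₐ-cong {f} {g} f≡g = sum-cong-≗ λ u → sum-cong-≗ λ v → at u v (T? (adj u v))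
    where
    at : ∀ u v d → atArc f u v d ≡ atArc g u v d
    at u v (yes uv) = f≡g (u , v , uv)
    at u v (no _)   = refl

  fromℕ-count : ∀ {m} (p : Fin m → Bool) → fromℕ Subset.∣ tabulate p ∣ ≡ sum λ k → indicator (T? (p k))
  fromℕ-count {zero}  p = refl
  fromℕ-count {suc m} p with p zero
  ... | true  = cong (λ z → 1# + z) (fromℕ-count (p ∘ suc))
  ... | false = trans (fromℕ-count (p ∘ suc)) (sym (+-identityˡ _))

  degree≡2 : ∀ u → fromℕ (degree u) ≡ 2#
  degree≡2 u = trans (fromℕ-count (adj u))
    (trans (sum-cong-≗ λ v → atArc-1 v (T? (adj u v))) (sum-neighbours (λ _ → 1#) forward u))
    where
    atArc-1 : ∀ v d → indicator d ≡ atArc (λ _ → 1#) u v d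
    atArc-1 v (yes _) = refl
    atArc-1 v (no _)  = refl

  -- 2 c is a square root of 2 when c is a zero of T 2 = 2 x ^ 2 - 1.
  √2² : √ 2# * √ 2# ≡ 2#
  √2² = trans (cong (λ z → z * z) √2≡2c) 2c²≡2
    where
    open Chebyshev.LargestZero (Chebyshev.chebyshev-zero ℝ 1)
    2c²≡2 : 2# * c * (2# * c) ≡ 2#
    2c²≡2 = trans (solve 1 (λ c → con (ℤ.+ 2) :* c :* (con (ℤ.+ 2) :* c)
                     := con (ℤ.+ 2) :* (con (ℤ.+ 2) :* c :* c :- con 1ℤ) :+ con (ℤ.+ 2)) refl c)
      (trans (cong (λ z → 2# * z + 2#) T-zero) (solve 0 (con (ℤ.+ 2) :* con 0ℤ :+ con (ℤ.+ 2) := con (ℤ.+ 2))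
          refl))
    √2≡2c : √ 2# ≡ 2# * c
    √2≡2c = trans (cong √ (sym 2c²≡2)) (√-² (*-nonneg 2# c 0≤2 0≤c))

  -- The common nonzero entry s of N, and its square h = 1 / 2.
  s h : R
  s = (√ 2#) ⁻¹
  h = s * s

  s-inverse : √ 2# * s ≡ 1#
  s-inverse = *-inverse (√ 2#) λ √2≡0 → 2≢0 (trans (sym √2²) (trans (cong (_* √ 2#) √2≡0) (zeroˡ (√ 2#))))

  s≢0 : s ≢ 0#
  s≢0 s≡0 = 0≢1 (trans (sym (zeroʳ (√ 2#))) (trans (cong (√ 2# *_) (sym s≡0)) s-inverse))

  2h≡1 : 2# * h ≡ 1#
  2h≡1 = trans (cong (_* h) (sym √2²)) (trans
    (solve 2 (λ r s → r :* r :* (s :* s) := (r :* s) :* (r :* s)) refl (√ 2#) s)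
    (trans (cong₂ _*_ s-inverse s-inverse) (*-identityʳ 1#)))

  N-entry : ∀ a v → N a v ≡ δ (tail a) v * s
  N-entry a v = cong (λ x → δ (tail a) v * (√ x) ⁻¹) (degree≡2 v)

  NNᵀ-entry : ∀ a b → fromℕ 2 * (N ·ᵥ N ᵀ) a b ≡ δ (tail a) (tail b)
  NNᵀ-entry a b = begin
    fromℕ 2 * sum (λ v → N a v * N b v)
      ≡⟨ cong (fromℕ 2 *_) (sum-cong-≗ λ v → trans (cong₂ _*_ (N-entry a v) (N-entry b v))
           (*-assoc (δ (tail a) v) s (δ (tail b) v * s))) ⟩
    fromℕ 2 * sum (λ v → δ (tail a) v * (s * (δ (tail b) v * s)))
      ≡⟨ cong (fromℕ 2 *_) (sum-δ (tail a) _) ⟩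
    fromℕ 2 * (s * (δ (tail b) (tail a) * s))
      ≡⟨ solve 2 (λ s e → (con 1ℤ :+ (con 1ℤ :+ con 0ℤ)) :* (s :* (e :* s)) := (con (ℤ.+ 2) :* (s :* s)) :* e)
           refl s (δ (tail b) (tail a)) ⟩
    2# * h * δ (tail b) (tail a)
      ≡⟨ cong (_* δ (tail b) (tail a)) 2h≡1 ⟩
    1# * δ (tail b) (tail a)
      ≡⟨ *-identityˡ _ ⟩
    δ (tail b) (tail a)
      ≡⟨ δ-sym (tail b) (tail a) ⟩
    δ (tail a) (tail b) ∎
    where open ≡-Reasoning

  Iₐ-same : ∀ d u v → Iₐ (arc d u) (arc d v) ≡ δ u v
  Iₐ-same d u v = indicator-cong ((u ≟ v) ×-dec (u ⊕ shift d 1 ≟ v ⊕ shift d 1)) (u ≟ v)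
    proj₁ (λ u≡v → u≡v , cong (_⊕ shift d 1) u≡v)

  Iₐ-opposite : ∀ d u v → Iₐ (arc d u) (arc (opposite d) v) ≡ 0#
  Iₐ-opposite d u v = indicator-no ((u ≟ v) ×-dec (u ⊕ shift d 1 ≟ v ⊕ shift (opposite d) 1))
    λ { (refl , eq) → neighbours-differ d u eq }

  sum-Iₐ : ∀ d w f → ∑ₐ (λ a → Iₐ (arc d w) a * f a) ≡ f (arc d w)
  sum-Iₐ d w f = trans (sum-arcs (λ a → Iₐ (arc d w) a * f a) d) (trans (sum-cong-≗ λ u → trans
    (cong₂ _+_ (cong (_* f (arc d u)) (Iₐ-same d w u))
      (trans (cong (_* f (arc (opposite d) u)) (Iₐ-opposite d w u)) (zeroˡ _)))
    (+-identityʳ _)) (sum-δ w (f ∘ arc d)))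

  reversal-same : ∀ d w u → reversal (arc d w) (arc d u) ≡ 0#
  reversal-same d w u = indicator-no ((w ≟ u ⊕ shift d 1) ×-dec (w ⊕ shift d 1 ≟ u))
    λ (w≡ , ≡u) → impossible d (trans (cong (_⊕ shift d 1) (sym w≡)) ≡u)
    where
    -- Otherwise u + 2 = u.
    impossible : ∀ d → (u ⊕ shift d 1) ⊕ shift d 1 ≢ u
    impossible forward  eq = small-shift {u} {ℤ.+ 2} {0ℤ} (λ ()) 3≤n
      (trans (sym (⊕-⊕ u 1ℤ 1ℤ)) (trans eq (sym (⊕-identity u))))
    impossible backward eq = small-shift {u} { -[1+ 1 ]} {0ℤ} (λ ()) 3≤n
      (trans (sym (⊕-⊕ u -1ℤ -1ℤ)) (trans eq (sym (⊕-identity u))))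

  reversal-opposite : ∀ d w u → reversal (arc d w) (arc (opposite d) u) ≡ δ (w ⊕ shift d 1) u
  reversal-opposite d w u = indicator-cong ((w ≟ u ⊕ shift (opposite d) 1) ×-dec (w ⊕ shift d 1 ≟ u))
      (w ⊕ shift d 1 ≟ u)
    proj₂ (λ eq → trans (sym (⊕-cancel w (shift d 1))) (cong₂ _⊕_ eq (sym (shift-opposite d 1))) , eq)

  -- Row a of U is the row of 2 N Nᵀ - I belonging to the reversed arc.
  U-entry : ∀ d w b → U (arc d w) b ≡ δ (w ⊕ shift d 1) (tail b) - Iₐ (arc (opposite d) (w ⊕ shift d 1)) b
  U-entry d w b = begin
    ∑ₐ (λ a → reversal (arc d w) a * M a)
      ≡⟨ sum-arcs (λ a → reversal (arc d w) a * M a) d ⟩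
    sum (λ u → reversal (arc d w) (arc d u) * M (arc d u) + reversal (arc d w) (arc d′ u) * M (arc d′ u))
      ≡⟨ sum-cong-≗ (λ u → trans (cong₂ (λ x y → x * M (arc d u) + y * M (arc d′ u)) (reversal-same d w u)
          (reversal-opposite d w u))
           (solve 2 (λ x y → con 0ℤ :* x :+ y := y) refl (M (arc d u)) (δ (w ⊕ shift d 1) u * M (arc d′ u)))) ⟩
    sum (λ u → δ (w ⊕ shift d 1) u * M (arc d′ u))
      ≡⟨ sum-δ (w ⊕ shift d 1) (λ u → M (arc d′ u)) ⟩
    M (arc d′ (w ⊕ shift d 1))
      ≡⟨ cong (_- Iₐ (arc d′ (w ⊕ shift d 1)) b) (NNᵀ-entry (arc d′ (w ⊕ shift d 1)) b) ⟩
    δ (w ⊕ shift d 1) (tail b) - Iₐ (arc d′ (w ⊕ shift d 1)) b ∎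
    where
    open ≡-Reasoning
    d′ = opposite d
    M : Arc → R
    M a = fromℕ 2 * (N ·ᵥ N ᵀ) a b - Iₐ a b

  opposite-involutive : ∀ d → opposite (opposite d) ≡ d
  opposite-involutive forward  = refl
  opposite-involutive backward = refl

  -- U is a permutation matrix: it moves every arc one step along its own direction.
  U-step : ∀ {J : Set} (X : Matrix Arc J) d w j → (U ·ₐ X) (arc d w) j ≡ X (arc d (w ⊕ shift d 1)) j
  U-step X d w j = begin
    ∑ₐ (λ a → U (arc d w) a * X a j)
      ≡⟨ sum-arcs (λ a → U (arc d w) a * X a j) d ⟩
    sum (λ u → U (arc d w) (arc d u) * X (arc d u) j + U (arc d w) (arc d′ u) * X (arc d′ u) j)
      ≡⟨ sum-cong-≗ (λ u → trans (cong₂ (λ x y → x * X (arc d u) j + y * X (arc d′ u) j) (same u) (other u))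
           (solve 2 (λ x y → y :+ con 0ℤ :* x := y) refl (X (arc d′ u) j) (δ w′ u * X (arc d u) j))) ⟩
    sum (λ u → δ w′ u * X (arc d u) j)
      ≡⟨ sum-δ w′ (λ u → X (arc d u) j) ⟩
    X (arc d w′) j ∎
    where
    open ≡-Reasoning
    d′ = opposite d
    w′ = w ⊕ shift d 1
    same : ∀ u → U (arc d w) (arc d u) ≡ δ w′ u
    same u = trans (U-entry d w (arc d u)) (trans
      (cong (λ x → δ w′ u - x) (trans (cong (λ e → Iₐ (arc d′ w′) (arc e u)) (sym (opposite-involutive d)))
          (Iₐ-opposite d′ w′ u)))
      (solve 1 (λ x → x :- con 0ℤ := x) refl (δ w′ u)))
    other : ∀ u → U (arc d w) (arc d′ u) ≡ 0#
    other u = trans (U-entry d w (arc d′ u)) (trans (cong (λ x → δ w′ u - x) (Iₐ-same d′ w′ u))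
        (-‿inverseʳ (δ w′ u)))

  U^-entry : ∀ t d w b → (U^ t) (arc d w) b ≡ Iₐ (arc d (w ⊕ shift d t)) b
  U^-entry zero    d w b =
      cong (λ u → Iₐ (arc d u) b) (sym (trans (cong (w ⊕_) (shift-zero d)) (⊕-identity w)))
    where
    shift-zero : ∀ d → shift d 0 ≡ 0ℤ
    shift-zero forward  = refl
    shift-zero backward = refl
  U^-entry (suc t) d w b = begin
    (U ·ₐ U^ t) (arc d w) b                      ≡⟨ U-step (U^ t) d w b ⟩
    (U^ t) (arc d (w ⊕ shift d 1)) b             ≡⟨ U^-entry t d (w ⊕ shift d 1) b ⟩
    Iₐ (arc d ((w ⊕ shift d 1) ⊕ shift d t)) b
      ≡⟨ cong (λ u → Iₐ (arc d u) b) (trans (⊕-⊕ w (shift d 1) (shift d t)) (cong (w ⊕_) (shift-suc d t))) ⟩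
    Iₐ (arc d (w ⊕ shift d (suc t))) b           ∎
    where open ≡-Reasoning

  U^-action : ∀ t d w f → ∑ₐ (λ a → (U^ t) (arc d w) a * f a) ≡ f (arc d (w ⊕ shift d t))
  U^-action t d w f = trans (∑ₐ-cong λ a → cong (_* f a) (U^-entry t d w a)) (sum-Iₐ d (w ⊕ shift d t) f)

  B-entry : ∀ t u v → (B_ t) u v ≡ h * (δ (u ⊕ ℤ.+ t) v + δ (u ⊕ ℤ.- (ℤ.+ t)) v)
  B-entry t u v = begin
    ∑ₐ (λ a → N a u * (U^ t ·ₐ N) a v)
      ≡⟨ sum-arcs (λ a → N a u * (U^ t ·ₐ N) a v) forward ⟩
    sum (λ w → N (arc forward w) u * (U^ t ·ₐ N) (arc forward w) v + N (arc backward w) u * (U^ t ·ₐ N)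
        (arc backward w) v)
      ≡⟨ sum-cong-≗ (λ w → trans (cong₂ _+_ (entry forward w) (entry backward w))
          (sym (distribˡ (δ w u) _ _))) ⟩
    sum (λ w → δ w u * (s * (δ (w ⊕ ℤ.+ t) v * s) + s * (δ (w ⊕ ℤ.- (ℤ.+ t)) v * s)))
      ≡⟨ sum-cong-≗ (λ w → cong (_* (s * (δ (w ⊕ ℤ.+ t) v * s) + s * (δ (w ⊕ ℤ.- (ℤ.+ t)) v * s)))
          (δ-sym w u)) ⟩
    sum (λ w → δ u w * (s * (δ (w ⊕ ℤ.+ t) v * s) + s * (δ (w ⊕ ℤ.- (ℤ.+ t)) v * s)))
      ≡⟨ sum-δ u (λ w → s * (δ (w ⊕ ℤ.+ t) v * s) + s * (δ (w ⊕ ℤ.- (ℤ.+ t)) v * s)) ⟩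
    s * (δ (u ⊕ ℤ.+ t) v * s) + s * (δ (u ⊕ ℤ.- (ℤ.+ t)) v * s)
      ≡⟨ solve 3 (λ s x y → s :* (x :* s) :+ s :* (y :* s) := s :* s :* (x :+ y)) refl s (δ (u ⊕ ℤ.+ t) v)
          (δ (u ⊕ ℤ.- (ℤ.+ t)) v) ⟩
    h * (δ (u ⊕ ℤ.+ t) v + δ (u ⊕ ℤ.- (ℤ.+ t)) v) ∎
    where
    open ≡-Reasoning
    entry : ∀ d w → N (arc d w) u * (U^ t ·ₐ N) (arc d w) v ≡ δ w u * (s * (δ (w ⊕ shift d t) v * s))
    entry d w = trans (cong₂ _*_ (N-entry (arc d w) u)
        (trans (U^-action t d w (λ a → N a v)) (N-entry (arc d (w ⊕ shift d t)) v)))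
      (*-assoc (δ w u) s (δ (w ⊕ shift d t) v * s))

  N-state : ∀ u a → (N $ᵥ 𝐞 u) a ≡ N a u
  N-state u a = trans (sum-cong-≗ λ v → *-comm (N a v) (δ u v)) (sum-δ u (N a))

  state : ∀ u t d w → (U^ t $ₐ N $ᵥ 𝐞 u) (arc d w) ≡ δ (w ⊕ shift d t) u * s
  state u t d w = trans (U^-action t d w (N $ᵥ 𝐞 u))
    (trans (N-state u (arc d (w ⊕ shift d t))) (N-entry (arc d (w ⊕ shift d t)) u))

  -- Transfer with phase γ = 1.
  transfer : ∀ u v t → (∀ d w → δ (w ⊕ shift d t) u ≡ δ w v) → Transfer u v t
  transfer u v t eq = 1# +i 0# , modulus-1 , λ a → at a (arc-exhaustive a)
    where
    modulus-1 : √ (1# * 1# + 0# * 0#) ≡ 1#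
    modulus-1 = trans (cong √ (solve 0 (con 1ℤ :* con 1ℤ :+ con 0ℤ :* con 0ℤ := con 1ℤ :* con 1ℤ) refl))
        (√-² 0≤1)
    at : ∀ a → (∃[ d ] ∃[ w ] a ≡ arc d w) →
      ofReal ((U^ t $ₐ N $ᵥ 𝐞 u) a) ≡ (1# +i 0#) *ᶜ ofReal ((N $ᵥ 𝐞 v) a)
    at .(arc d w) (d , w , refl) = cong₂ _+i_
      (trans (trans (state u t d w) (trans (cong (_* s) (eq d w))
          (sym (trans (N-state v (arc d w)) (N-entry (arc d w) v)))))
        (solve 1 (λ x → x := con 1ℤ :* x :- con 0ℤ :* con 0ℤ) refl ((N $ᵥ 𝐞 v) (arc d w))))
      (solve 1 (λ x → con 0ℤ := con 1ℤ :* con 0ℤ :+ con 0ℤ :* x) refl ((N $ᵥ 𝐞 v) (arc d w)))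

  -- If u + t were not u, the forward arc leaving u would have amplitude 0 after
  -- t steps; this forces γ = 0, whereas γ has modulus 1.
  return : ∀ u t → Transfer u u t → ℤ.+ n ∣ ℤ.+ t
  return u t (γ , |γ|≡1 , eq) with u ⊕ ℤ.+ t ≟ u
  ... | yes u+t≡u = ⊕-fixed u (ℤ.+ t) u+t≡u
  ... | no  u+t≢u = contradiction |γ|≡1 (|γ|≢1 γ (γ-zero γ (eq (arc forward u))))
    where
    at-u : (N $ᵥ 𝐞 u) (arc forward u) ≡ s
    at-u = trans (N-state u (arc forward u)) (trans (N-entry (arc forward u) u)
        (trans (cong (_* s) (δ-refl u)) (*-identityˡ s)))
    after : (U^ t $ₐ N $ᵥ 𝐞 u) (arc forward u) ≡ 0#
    after = trans (state u t forward u) (trans (cong (_* s) (δ-off u+t≢u)) (zeroˡ s))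
    γ-zero : ∀ γ → ofReal ((U^ t $ₐ N $ᵥ 𝐞 u) (arc forward u)) ≡ γ *ᶜ ofReal ((N $ᵥ 𝐞 u) (arc forward u)) →
        γ ≡ 0# +i 0#
    γ-zero (a +i b) eq = cong₂ _+i_
      (cancel (trans (solve 3 (λ a b s → s :* a := a :* s :- b :* con 0ℤ) refl a b s)
          (trans (cong (λ x → a * x - b * 0#) (sym at-u)) (trans (sym (cong ℂ.re eq)) after))))
      (cancel (trans (solve 3 (λ a b s → s :* b := a :* con 0ℤ :+ b :* s) refl a b s)
          (trans (cong (λ x → a * 0# + b * x) (sym at-u)) (sym (cong ℂ.im eq)))))
      where
      cancel : ∀ {x} → s * x ≡ 0# → x ≡ 0#
      cancel = *-zero-cancel s≢0
    |γ|≢1 : ∀ γ → γ ≡ 0# +i 0# → modulus γ ≢ 1#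
    |γ|≢1 .(0# +i 0#) refl √0≡1 = 0≢1 (trans (sym (√-² ≤-refl))
      (trans (cong √ (solve 0 (con 0ℤ :* con 0ℤ := con 0ℤ :* con 0ℤ :+ con 0ℤ :* con 0ℤ) refl)) √0≡1))

  periodic : ∀ i → PeriodicAt n i
  periodic i = ℕ.≤-trans (ℕ.s≤s ℕ.z≤n) 3≤n
    , transfer i i n (λ d w → cong (λ v → δ v i) (⊕-fix w (shift d n) (n∣shift d)))
    , λ { (suc t) _ tr → ℕ.∣⇒≤ (∣⇒∣ᵤ (return i (suc t) tr)) }
    where
    n∣shift : ∀ d → ℤ.+ n ∣ shift d n
    n∣shift forward  = divides 1ℤ (sym (ℤ.*-identityˡ (ℤ.+ n)))
    n∣shift backward = divides -1ℤ (sym (ℤ.-1*i≡-i (ℤ.+ n)))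

  antipodal-transfer : ∀ i m → n ≡ 2 ℕ.* m → PerfectStateTransfer i (i ⊕ ℤ.+ m) m
  antipodal-transfer i zero    n≡0 = contradiction (subst (3 ℕ.≤_) n≡0 3≤n) λ ()
  antipodal-transfer i m@(suc _) n≡2m = ⊕-moves i m (ℕ.s≤s ℕ.z≤n) m<n
    , transfer i (i ⊕ ℤ.+ m) m λ d w → trans (δ-⊕ w (shift d m) i)
        (cong (δ w) (⊕-cong i (ℤ.- shift d m) (ℤ.+ m) (half d)))
    where
    m<n : m ℕ.< n
    m<n = subst (m ℕ.<_) (trans (cong (m ℕ.+_) (sym (ℕ.+-identityʳ m))) (sym n≡2m)) (ℕ.m<m+n m (ℕ.s≤s ℕ.z≤n))
    half : ∀ d → ℤ.+ n ∣ ℤ.- shift d m ℤ.- ℤ.+ m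
    half forward  = divides -1ℤ
        (trans (double (ℤ.+ m)) (cong (-1ℤ ℤ.*_) (trans (sym (ℤ.pos-* 2 m)) (cong ℤ.+_ (sym n≡2m)))))
      where
      double : ∀ m → ℤ.- m ℤ.- m ≡ -1ℤ ℤ.* (ℤ.+ 2 ℤ.* m)
      double = ℤ-Solver.solve-∀
    half backward = divides 0ℤ (ℤ.+-inverseʳ (ℤ.+ m))

-- Eigenvectors of B and resolutions of the identity

module CycleSpectrum (ℝ : CompleteOrderedField) (n : ℕ) (3≤n : 3 ℕ.≤ n) where
  open RealField ℝ
  open Chebyshev ℝ
  open CycleWalk ℝ n 3≤n
  open Rotation {n}

  B-nonzero : ∀ t u v → (B_ t) u v ≢ 0# → v ≡ u ⊕ ℤ.+ t ⊎ v ≡ u ⊕ ℤ.- (ℤ.+ t)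
  B-nonzero t u v B≢0 = decide (u ⊕ ℤ.+ t ≟ v) (u ⊕ ℤ.- (ℤ.+ t) ≟ v)
    where
    decide : Dec (u ⊕ ℤ.+ t ≡ v) → Dec (u ⊕ ℤ.- (ℤ.+ t) ≡ v) → v ≡ u ⊕ ℤ.+ t ⊎ v ≡ u ⊕ ℤ.- (ℤ.+ t)
    decide (yes eq) _        = inj₁ (sym eq)
    decide (no _)   (yes eq) = inj₂ (sym eq)
    decide (no ≢₁)  (no ≢₂)  = contradiction (trans (B-entry t u v)
      (trans (cong₂ (λ x y → h * (x + y)) (δ-off ≢₁) (δ-off ≢₂))
        (solve 1 (λ h → h :* (con 0ℤ :+ con 0ℤ) := con 0ℤ) refl h))) B≢0

  B-nonneg : ∀ t u v → 0# ≤ (B_ t) u v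
  B-nonneg t u v = subst (0# ≤_) (sym (B-entry t u v)) (*-nonneg _ _ (²-nonneg s)
    (+-nonneg (indicator-nonneg (u ⊕ ℤ.+ t ≟ v)) (indicator-nonneg (u ⊕ ℤ.- (ℤ.+ t) ≟ v))))

  B-symmetric : ∀ u v → 𝐁 u v ≡ 𝐁 v u
  B-symmetric u v = begin
    𝐁 u v                                  ≡⟨ B-entry 1 u v ⟩
    h * (δ (u ⊕ 1ℤ) v + δ (u ⊕ -1ℤ) v)     ≡⟨ cong₂ (λ x y → h * (x + y)) (swap 1ℤ) (swap -1ℤ) ⟩
    h * (δ (v ⊕ -1ℤ) u + δ (v ⊕ 1ℤ) u)     ≡⟨ cong (h *_) (+-comm _ _) ⟩
    h * (δ (v ⊕ 1ℤ) u + δ (v ⊕ -1ℤ) u)     ≡⟨ sym (B-entry 1 v u) ⟩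
    𝐁 v u                                  ∎
    where
    open ≡-Reasoning
    swap : ∀ k → δ (u ⊕ k) v ≡ δ (v ⊕ (ℤ.- k)) u
    swap k = trans (δ-⊕ u k v) (δ-sym u (v ⊕ (ℤ.- k)))

  B-action : ∀ x v → (𝐁 $ᵥ x) v ≡ h * (x (v ⊕ 1ℤ) + x (v ⊕ -1ℤ))
  B-action x v = begin
    sum (λ k → 𝐁 v k * x k)
      ≡⟨ sum-cong-≗ (λ k → trans (cong (_* x k) (B-entry 1 v k))
           (solve 4 (λ h a b x → h :* (a :+ b) :* x := a :* (h :* x) :+ b :* (h :* x)) refl
             h (δ (v ⊕ 1ℤ) k) (δ (v ⊕ -1ℤ) k) (x k))) ⟩
    sum (λ k → δ (v ⊕ 1ℤ) k * (h * x k) + δ (v ⊕ -1ℤ) k * (h * x k))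
      ≡⟨ ∑-distrib-+ (λ k → δ (v ⊕ 1ℤ) k * (h * x k)) (λ k → δ (v ⊕ -1ℤ) k * (h * x k)) ⟩
    sum (λ k → δ (v ⊕ 1ℤ) k * (h * x k)) + sum (λ k → δ (v ⊕ -1ℤ) k * (h * x k))
      ≡⟨ cong₂ _+_ (sum-δ (v ⊕ 1ℤ) (λ k → h * x k)) (sum-δ (v ⊕ -1ℤ) (λ k → h * x k)) ⟩
    h * x (v ⊕ 1ℤ) + h * x (v ⊕ -1ℤ)
      ≡⟨ sym (distribˡ h (x (v ⊕ 1ℤ)) (x (v ⊕ -1ℤ))) ⟩
    h * (x (v ⊕ 1ℤ) + x (v ⊕ -1ℤ)) ∎
    where open ≡-Reasoning

  eigen-from-recurrence : ∀ θ x → (∀ v → x (v ⊕ 1ℤ) + x (v ⊕ -1ℤ) ≡ 2# * θ * x v) → Eigenspace 𝐁 θ x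
  eigen-from-recurrence θ x rec v = trans (B-action x v) (trans (cong (h *_) (rec v))
    (trans (solve 3 (λ h θ x → h :* (con (ℤ.+ 2) :* θ :* x) := con (ℤ.+ 2) :* h :* (θ :* x)) refl h θ (x v))
      (trans (cong (_* (θ * x v)) 2h≡1) (*-identityˡ (θ * x v)))))

  eigen-recurrence : ∀ {θ x} → Eigenspace 𝐁 θ x → ∀ v → x (v ⊕ 1ℤ) + x (v ⊕ -1ℤ) ≡ 2# * θ * x v
  eigen-recurrence {θ} {x} Bx≡θx v = begin
    y                    ≡⟨ sym (*-identityˡ y) ⟩
    1# * y               ≡⟨ cong (_* y) (sym 2h≡1) ⟩
    2# * h * y           ≡⟨ *-assoc 2# h y ⟩
    2# * (h * y)         ≡⟨ cong (2# *_) (trans (sym (B-action x v)) (Bx≡θx v)) ⟩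
    2# * (θ * x v)       ≡⟨ sym (*-assoc 2# θ (x v)) ⟩
    2# * θ * x v         ∎
    where
    open ≡-Reasoning
    y = x (v ⊕ 1ℤ) + x (v ⊕ -1ℤ)

  -- An eigenvector of B is an eigenvector of B_ t, for the eigenvalue T θ t.
  eigen-shift : ∀ {θ x} → Eigenspace 𝐁 θ x → ∀ t v → x (v ⊕ ℤ.+ t) + x (v ⊕ ℤ.- (ℤ.+ t)) ≡ 2# * T θ t * x v
  eigen-shift {θ} {x} Bx≡θx t v = begin
    x (v ⊕ ℤ.+ t) + x (v ⊕ ℤ.- (ℤ.+ t))
      ≡⟨ cong₂ (λ j k → x (v ⊕ j) + x (v ⊕ k)) (sym (ℤ.+-identityˡ (ℤ.+ t)))
          (sym (ℤ.+-identityˡ (ℤ.- (ℤ.+ t)))) ⟩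
    f (0ℤ ℤ.+ ℤ.+ t) + f (0ℤ ℤ.- ℤ.+ t)
      ≡⟨ product-formula recurrent t 0ℤ ⟩
    2# * T θ t * x (v ⊕ 0ℤ)
      ≡⟨ cong (λ u → 2# * T θ t * x u) (⊕-identity v) ⟩
    2# * T θ t * x v ∎
    where
    open ≡-Reasoning
    f : ℤ → R
    f z = x (v ⊕ z)
    recurrent : Recurrent θ f
    recurrent z = trans (cong₂ (λ a b → x a + x b) (sym (⊕-⊕ v z 1ℤ)) (sym (⊕-⊕ v z -1ℤ)))
      (eigen-recurrence {θ} {x} Bx≡θx (v ⊕ z))

  -- The eigenvalues of B_ t lie in [-1, 1]: B_ t averages two entries, so at an
  -- entry of largest absolute value it cannot increase that value.
  eigenvalue-bound : ∀ {θ x} → Eigenspace 𝐁 θ x → ∀ w → x w ≢ 0# → ∀ t → T θ t * T θ t ≤ 1#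
  eigenvalue-bound {θ} {x} Bx≡θx w xw≢0 t = at-max (argmax x w)
    where
    argmax : ∀ {m} (f : Fin m → R) → Fin m → ∃[ k ] ∀ j → f j * f j ≤ f k * f k
    argmax {suc m} f _ = argmax-² f
    τ = T θ t
    at-max : (∃[ v ] ∀ u → x u * x u ≤ x v * x v) → τ * τ ≤ 1#
    at-max (v , max) with τ * τ ≤? 1#
    ... | yes τ²≤1 = τ²≤1
    ... | no  τ²≰1 = contradiction (≤-by 0≤gap excess) (*-pos 0<4 (*-pos (0<y-x τ²≰1) 0<m))
      where
      m = x v * x v
      a = x (v ⊕ ℤ.+ t)
      b = x (v ⊕ ℤ.- (ℤ.+ t))
      four = fromℤ (ℤ.+ 4)
      0<4 : 0# < four
      0<4 = +-pos (+-pos (+-pos 0<1 0≤1) 0≤1) 0≤1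
      0<m : 0# < m
      0<m m≤0 = xw≢0 (²-zero (≤-antisym (≤-trans (max w) m≤0) (²-nonneg (x w))))
      -- 4 τ ^ 2 m = (a + b) ^ 2 = 2 a ^ 2 + 2 b ^ 2 - (a - b) ^ 2, which is at most 4 m.
      gap = 2# * ((m - a * a) + (m - b * b)) + (a - b) * (a - b)
      0≤gap : 0# ≤ gap
      0≤gap = +-nonneg (*-nonneg _ _ 0≤2
        (+-nonneg (0≤y-x (max (v ⊕ ℤ.+ t))) (0≤y-x (max (v ⊕ ℤ.- (ℤ.+ t)))))) (²-nonneg (a - b))
      excess : 0# ≡ four * ((τ * τ - 1#) * m) + gap
      excess = begin
        0#
          ≡⟨ solve 2 (λ x τ → con 0ℤ := con (ℤ.+ 4) :* ((τ :* τ :- con 1ℤ) :* (x :* x))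
               :+ (con (ℤ.+ 4) :* (x :* x) :- (con (ℤ.+ 2) :* τ :* x) :* (con (ℤ.+ 2) :* τ :* x))) refl
                   (x v) τ ⟩
        four * ((τ * τ - 1#) * m) + (four * m - 2# * τ * x v * (2# * τ * x v))
          ≡⟨ cong (λ y → four * ((τ * τ - 1#) * m) + (four * m - y * y)) (sym (eigen-shift {θ} {x} Bx≡θx t v)) ⟩
        four * ((τ * τ - 1#) * m) + (four * m - (a + b) * (a + b))
          ≡⟨ cong (λ y → four * ((τ * τ - 1#) * m) + y)
              (solve 3 (λ m a b → con (ℤ.+ 4) :* m :- (a :+ b) :* (a :+ b)
               := con (ℤ.+ 2) :* ((m :- a :* a) :+ (m :- b :* b)) :+ (a :- b) :* (a :- b)) refl m a b) ⟩
        four * ((τ * τ - 1#) * m) + gap ∎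
        where open ≡-Reasoning

  adjoint : ∀ (M : Matrix V V) → (∀ u v → M u v ≡ M v u) → ∀ x y → ⟨ M $ᵥ x , y ⟩ ≡ ⟨ x , M $ᵥ y ⟩
  adjoint M symmetric x y = begin
    sum (λ v → sum (λ k → M v k * x k) * y v)
      ≡⟨ sum-cong-≗ (λ v → *-distribʳ-sum (y v) (λ k → M v k * x k)) ⟩
    sum (λ v → sum (λ k → M v k * x k * y v))
      ≡⟨ ∑-comm (λ v k → M v k * x k * y v) ⟩
    sum (λ k → sum (λ v → M v k * x k * y v))
      ≡⟨ sum-cong-≗ (λ k → sum-cong-≗ (λ v → trans (cong (λ m → m * x k * y v) (symmetric v k))
           (solve 3 (λ m x y → m :* x :* y := x :* (m :* y)) refl (M k v) (x k) (y v)))) ⟩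
    sum (λ k → sum (λ v → x k * (M k v * y v)))
      ≡⟨ sum-cong-≗ (λ k → sym (*-distribˡ-sum (x k) (λ v → M k v * y v))) ⟩
    sum (λ k → x k * sum (λ v → M k v * y v)) ∎
    where open ≡-Reasoning

  ⟨⟩-minus : ∀ x x′ y → ⟨ (λ v → x v - x′ v) , y ⟩ ≡ ⟨ x , y ⟩ - ⟨ x′ , y ⟩
  ⟨⟩-minus x x′ y = trans
    (sum-cong-≗ λ v → solve 3 (λ a b c → (a :- b) :* c := a :* c :- b :* c) refl (x v) (x′ v) (y v))
    (sum-minus (λ v → x v * y v) (λ v → x′ v * y v))

  ⟨⟩-cong : ∀ {x x′} → (∀ v → x v ≡ x′ v) → ∀ y → ⟨ x , y ⟩ ≡ ⟨ x′ , y ⟩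
  ⟨⟩-cong x≡x′ y = sum-cong-≗ λ v → cong (_* y v) (x≡x′ v)

  ⟨⟩-definite : ∀ {x} → ⟨ x , x ⟩ ≡ 0# → ∀ v → x v ≡ 0#
  ⟨⟩-definite {x} eq v = ²-zero (sum-nonneg-zero (λ v → x v * x v) (λ v → ²-nonneg (x v)) eq v)

  eigenspace-cong : ∀ {M θ x y} → (∀ v → x v ≡ y v) → Eigenspace M θ x → Eigenspace M θ y
  eigenspace-cong {M} {θ} x≡y eigen v = trans (sum-cong-≗ λ k → cong (M v k *_) (sym (x≡y k)))
    (trans (eigen v) (cong (θ *_) (x≡y v)))

  orthogonal : ∀ {θ φ x y} → θ ≢ φ → Eigenspace 𝐁 θ x → Eigenspace 𝐁 φ y → ⟨ x , y ⟩ ≡ 0#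
  orthogonal {θ} {φ} {x} {y} θ≢φ Bx≡θx By≡φy = *-zero-cancel θ-φ≢0 (begin
    (θ - φ) * ⟨ x , y ⟩
      ≡⟨ solve 3 (λ θ φ p → (θ :- φ) :* p := θ :* p :- φ :* p) refl θ φ ⟨ x , y ⟩ ⟩
    θ * ⟨ x , y ⟩ - φ * ⟨ x , y ⟩                           ≡⟨ cong₂ _-_ left right ⟩
    ⟨ 𝐁 $ᵥ x , y ⟩ - ⟨ x , 𝐁 $ᵥ y ⟩
      ≡⟨ cong (_- ⟨ x , 𝐁 $ᵥ y ⟩) (adjoint 𝐁 B-symmetric x y) ⟩
    ⟨ x , 𝐁 $ᵥ y ⟩ - ⟨ x , 𝐁 $ᵥ y ⟩                         ≡⟨ -‿inverseʳ ⟨ x , 𝐁 $ᵥ y ⟩ ⟩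
    0#                                                      ∎)
    where
    open ≡-Reasoning
    θ-φ≢0 : θ - φ ≢ 0#
    θ-φ≢0 eq = θ≢φ (trans (solve 2 (λ θ φ → θ := (θ :- φ) :+ φ) refl θ φ)
        (trans (cong (_+ φ) eq) (+-identityˡ φ)))
    left : θ * ⟨ x , y ⟩ ≡ ⟨ 𝐁 $ᵥ x , y ⟩
    left = trans (*-distribˡ-sum θ (λ v → x v * y v))
      (sum-cong-≗ λ v → trans (sym (*-assoc θ (x v) (y v))) (cong (_* y v) (sym (Bx≡θx v))))
    right : φ * ⟨ x , y ⟩ ≡ ⟨ x , 𝐁 $ᵥ y ⟩
    right = trans (*-distribˡ-sum φ (λ v → x v * y v))
      (sum-cong-≗ λ v → trans (solve 3 (λ p a b → p :* (a :* b) := a :* (p :* b)) refl φ (x v) (y v))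
        (cong (x v *_) (sym (By≡φy v))))

  -- A family of matrices with columns in eigenspaces of B that adds up to the
  -- identity matrix.  Neither the θ r need be distinct nor the E r projections.
  record Resolution : Set where
    field
      size   : ℕ
      θ      : Fin size → R
      E      : Fin size → Matrix V V
      column : ∀ r v → Eigenspace 𝐁 (θ r) (λ u → E r u v)
      sum-E  : ∀ u v → sum (λ r → E r u v) ≡ δ u v

    B-resolved : ∀ t u v → (B_ t) u v ≡ sum λ r → T (θ r) t * E r u v
    B-resolved t u v = begin
      (B_ t) u v
        ≡⟨ B-entry t u v ⟩
      h * (δ u⁺ v + δ u⁻ v)
        ≡⟨ cong (h *_) (trans (cong₂ _+_ (sym (sum-E u⁺ v)) (sym (sum-E u⁻ v)))
             (sym (∑-distrib-+ (λ r → E r u⁺ v) (λ r → E r u⁻ v)))) ⟩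
      h * sum (λ r → E r u⁺ v + E r u⁻ v)
        ≡⟨ cong (h *_) (sum-cong-≗ λ r → eigen-shift (column r v) t u) ⟩
      h * sum (λ r → 2# * T (θ r) t * E r u v)
        ≡⟨ *-distribˡ-sum h (λ r → 2# * T (θ r) t * E r u v) ⟩
      sum (λ r → h * (2# * T (θ r) t * E r u v))
        ≡⟨ sum-cong-≗ (λ r → trans
             (solve 3 (λ h τ e → h :* (con (ℤ.+ 2) :* τ :* e) := con (ℤ.+ 2) :* h :* (τ :* e)) refl h
                 (T (θ r) t) (E r u v))
             (trans (cong (_* (T (θ r) t * E r u v)) 2h≡1) (*-identityˡ (T (θ r) t * E r u v)))) ⟩
      sum (λ r → T (θ r) t * E r u v) ∎
      where
      open ≡-Reasoning
      u⁺ = u ⊕ ℤ.+ t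
      u⁻ = u ⊕ ℤ.- (ℤ.+ t)

  module Decomposed (S : SpectralDecomposition 𝐁) where
    open SpectralDecomposition S

    E-column : ∀ r v u → (E r $ᵥ 𝐞 v) u ≡ E r u v
    E-column r v u = trans (sum-cong-≗ λ k → *-comm (E r u k) (δ v k)) (sum-δ v (E r u))

    column : ∀ r v → Eigenspace 𝐁 (θ r) (λ u → E r u v)
    column r v = eigenspace-cong {𝐁} {θ r} (E-column r v) (proj₁ (E-projection r (𝐞 v)))

    module Defect (v : V) where
      -- Column v of the identity matrix minus column v of ∑ E.
      defect : Vector V
      defect u = 𝐞 v u - sum (λ r → E r u v)

      -- B and ∑ θ E have the same columns, so B annihilates the defect.
      B-defect : ∀ u → (𝐁 $ᵥ defect) u ≡ 0#
      B-defect u = begin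
        sum (λ k → 𝐁 u k * (δ v k - sum (λ r → E r k v)))
          ≡⟨ sum-cong-≗ (λ k → trans (solve 3 (λ b d e → b :* (d :- e) := d :* b :- b :* e) refl (𝐁 u k)
              (δ v k) (sum (λ r → E r k v)))
               (cong (λ z → δ v k * 𝐁 u k - z) (*-distribˡ-sum (𝐁 u k) (λ r → E r k v)))) ⟩
        sum (λ k → δ v k * 𝐁 u k - sum (λ r → 𝐁 u k * E r k v))
          ≡⟨ sum-minus (λ k → δ v k * 𝐁 u k) (λ k → sum (λ r → 𝐁 u k * E r k v)) ⟩
        sum (λ k → δ v k * 𝐁 u k) - sum (λ k → sum (λ r → 𝐁 u k * E r k v))
          ≡⟨ cong₂ _-_ (sum-δ v (𝐁 u)) (∑-comm (λ k r → 𝐁 u k * E r k v)) ⟩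
        𝐁 u v - sum (λ r → (𝐁 $ᵥ (λ w → E r w v)) u)
          ≡⟨ cong₂ _-_ (decomposes u v) (sum-cong-≗ λ r → column r v u) ⟩
        sum (λ r → θ r * E r u v) - sum (λ r → θ r * E r u v)
          ≡⟨ -‿inverseʳ _ ⟩
        0# ∎
        where open ≡-Reasoning

      eigen-defect : Eigenspace 𝐁 0# defect
      eigen-defect u = trans (B-defect u) (sym (zeroˡ (defect u)))

      -- If 0 is the eigenvalue θ r, the defect lies in its eigenspace.  It differs
      -- from 𝐞 v - E r 𝐞 v, which is orthogonal to that eigenspace, by vectors in
      -- the other eigenspaces; so it is orthogonal to itself.
      module Kernel (r : Fin size) (θr≡0 : θ r ≡ 0#) where
        others : ∀ q → q ≢ r → ⟨ (λ u → E q u v) , defect ⟩ ≡ 0#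
        others q q≢r = orthogonal (λ θq≡0 → q≢r (θ-distinct (trans θq≡0 (sym θr≡0)))) (column q v)
            eigen-defect

        norm-zero : ⟨ defect , defect ⟩ ≡ 0#
        norm-zero = begin
          ⟨ defect , defect ⟩
            ≡⟨ ⟨⟩-minus (𝐞 v) (λ u → sum (λ q → E q u v)) defect ⟩
          ⟨ 𝐞 v , defect ⟩ - sum (λ u → sum (λ q → E q u v) * defect u)
            ≡⟨ cong (λ z → ⟨ 𝐞 v , defect ⟩ - z)
                (trans (sum-cong-≗ λ u → *-distribʳ-sum (defect u) (λ q → E q u v))
                 (∑-comm (λ u q → E q u v * defect u))) ⟩
          ⟨ 𝐞 v , defect ⟩ - sum (λ q → ⟨ (λ u → E q u v) , defect ⟩)
            ≡⟨ cong (λ z → ⟨ 𝐞 v , defect ⟩ - z) (sum-single (λ q → ⟨ (λ u → E q u v) , defect ⟩) r others) ⟩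
          ⟨ 𝐞 v , defect ⟩ - ⟨ (λ u → E r u v) , defect ⟩
            ≡⟨ sym (⟨⟩-minus (𝐞 v) (λ u → E r u v) defect) ⟩
          ⟨ (λ u → 𝐞 v u - E r u v) , defect ⟩
            ≡⟨ ⟨⟩-cong (λ u → cong (λ z → 𝐞 v u - z) (sym (E-column r v u))) defect ⟩
          ⟨ (λ u → 𝐞 v u - (E r $ᵥ 𝐞 v) u) , defect ⟩
            ≡⟨ proj₂ (E-projection r (𝐞 v)) defect (subst (λ z → Eigenspace 𝐁 z defect) (sym θr≡0)
                eigen-defect) ⟩
          0# ∎
          where open ≡-Reasoning

      -- A nonzero defect would make 0 an eigenvalue.
      defect-zero : ∀ u → defect u ≡ 0#
      defect-zero u with defect u ≟ᴿ 0#
      ... | yes eq = eq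
      ... | no  ≢0 = ⟨⟩-definite (Kernel.norm-zero (proj₁ zero-eigenvalue) (proj₂ zero-eigenvalue)) u
        where zero-eigenvalue = θ-exhaustive 0# (defect , eigen-defect , u , ≢0)

    sum-E : ∀ u v → sum (λ r → E r u v) ≡ δ u v
    sum-E u v = trans (solve 2 (λ a b → a := b :- (b :- a)) refl (sum (λ r → E r u v)) (δ v u))
      (trans (cong (λ z → δ v u - z) (Defect.defect-zero v u))
        (trans (solve 1 (λ a → a :- con 0ℤ := a) refl (δ v u)) (δ-sym v u)))

    resolution : Resolution
    resolution = record { size = size ; θ = θ ; E = E ; column = column ; sum-E = sum-E }

-- Peak state transfer only by half and quarter turns

module PeakTransferObstruction (ℝ : CompleteOrderedField) (n : ℕ) (3≤n : 3 ℕ.≤ n) where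
  open RealField ℝ
  open Chebyshev ℝ
  open CycleWalk ℝ n 3≤n
  open CycleSpectrum ℝ n 3≤n
  open Rotation {n}

  -- If the weighted sum ∑ τ p with weights in [-1, 1] has absolute value ∑ |p|,
  -- then τ is 1 or -1 wherever p does not vanish.
  triangle-equality : ∀ {m} (τ p : Fin m → R) → (∀ r → p r ≢ 0# → τ r * τ r ≤ 1#) →
    abs (sum λ r → τ r * p r) ≡ sum (λ r → abs (p r)) → ∀ r → p r ≢ 0# → τ r * τ r ≡ 1#
  triangle-equality τ p τ²≤1 eq r pr≢0 = *-cancelˡ (*-nonzero pr≢0 pr≢0) (begin
    p r * p r * (τ r * τ r)
      ≡⟨ solve 2 (λ p τ → p :* p :* (τ :* τ) := con 1ℤ :* ((τ :* p) :* (τ :* p))) refl (p r) (τ r) ⟩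
    1# * ((τ r * p r) * (τ r * p r))  ≡⟨ cong (_* ((τ r * p r) * (τ r * p r))) (sym σ²≡1) ⟩
    σ * σ * ((τ r * p r) * (τ r * p r))
      ≡⟨ solve 2 (λ σ q → σ :* σ :* (q :* q) := (σ :* q) :* (σ :* q)) refl σ (τ r * p r) ⟩
    σ * (τ r * p r) * (σ * (τ r * p r)) ≡⟨ cong (λ z → z * z) (sym abs≡) ⟩
    abs (p r) * abs (p r)             ≡⟨ abs-² (p r) ⟩
    p r * p r                         ≡⟨ sym (*-identityʳ (p r * p r)) ⟩
    p r * p r * 1#                    ∎)
    where
    open ≡-Reasoning
    total = sum λ r → τ r * p r
    sign = abs-sign total
    σ = proj₁ sign
    σ²≡1 = proj₁ (proj₂ sign)
    -- With σ the sign of the total, each |p| - σ τ p is nonnegative, and they add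
    -- up to 0.
    slack : Fin _ → R
    slack r = abs (p r) - σ * (τ r * p r)
    slack-nonneg : ∀ r → 0# ≤ slack r
    slack-nonneg r = 0≤y-x (²-cancel-≤ (abs-nonneg (p r)) (subst₂ _≤_
      (trans (sym (*-identityˡ _)) (trans (cong (_* ((τ r * p r) * (τ r * p r))) (sym σ²≡1))
        (solve 2 (λ σ q → σ :* σ :* (q :* q) := (σ :* q) :* (σ :* q)) refl σ (τ r * p r))))
      (sym (abs-² (p r)))
      τp²≤p²))
      where
      τp²≤p² : (τ r * p r) * (τ r * p r) ≤ p r * p r
      τp²≤p² with p r ≟ᴿ 0#
      ... | yes p≡0 = subst (λ z → (τ r * z) * (τ r * z) ≤ z * z) (sym p≡0)
        (≤-by ≤-refl (solve 1 (λ τ → con 0ℤ :* con 0ℤ := (τ :* con 0ℤ) :* (τ :* con 0ℤ) :+ con 0ℤ) refl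
            (τ r)))
      ... | no  p≢0 = ≤-by (*-nonneg _ _ (0≤y-x (τ²≤1 r p≢0)) (²-nonneg (p r)))
        (solve 2 (λ τ p → p :* p := (τ :* p) :* (τ :* p) :+ (con 1ℤ :- τ :* τ) :* (p :* p)) refl (τ r) (p r))
    slack-sum : sum slack ≡ 0#
    slack-sum = trans (sum-minus (λ r → abs (p r)) (λ r → σ * (τ r * p r)))
      (trans (cong₂ _-_ (trans (sym eq) (proj₂ (proj₂ sign))) (sym (*-distribˡ-sum σ (λ r → τ r * p r))))
        (-‿inverseʳ (σ * total)))
    abs≡ : abs (p r) ≡ σ * (τ r * p r)
    abs≡ = trans (solve 2 (λ a b → a := (a :- b) :+ b) refl (abs (p r)) (σ * (τ r * p r)))
      (trans (cong (_+ σ * (τ r * p r)) (sum-nonneg-zero slack slack-nonneg slack-sum r)) (+-identityˡ _))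

  -- cos (3 φ) = cos φ when cos φ is 1 or -1.
  T-triple : ∀ θ t → T θ t * T θ t ≡ 1# → T θ (3 ℕ.* t) ≡ T θ t
  T-triple θ t τ²≡1 = begin
    T θ (3 ℕ.* t)                     ≡⟨ cong (C θ) (trans (ℤ.pos-* 3 t) (triple (ℤ.+ t))) ⟩
    C θ (2t ℤ.+ ℤ.+ t)                ≡⟨ move (C-product θ (ℤ.+ t) 2t) ⟩
    2# * τ * C θ 2t - C θ (2t ℤ.- ℤ.+ t) ≡⟨ cong₂ (λ x y → 2# * τ * x - y)
                                            (trans (move (C-product θ (ℤ.+ t) (ℤ.+ t)))
                                                (cong₂ _-_ (*-assoc 2# τ τ)
                                                (cong (C θ) (ℤ.+-inverseʳ (ℤ.+ t)))))
                                            (cong (C θ) (cancel (ℤ.+ t))) ⟩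
    2# * τ * (2# * (τ * τ) - 1#) - τ  ≡⟨ cong (λ z → 2# * τ * (2# * z - 1#) - τ) τ²≡1 ⟩
    2# * τ * (2# * 1# - 1#) - τ
      ≡⟨ solve 1 (λ τ → con (ℤ.+ 2) :* τ :* (con (ℤ.+ 2) :* con 1ℤ :- con 1ℤ) :- τ := τ) refl τ ⟩
    τ                                 ∎
    where
    open ≡-Reasoning
    τ = T θ t
    2t = ℤ.+ t ℤ.+ ℤ.+ t
    triple : ∀ t → ℤ.+ 3 ℤ.* t ≡ t ℤ.+ t ℤ.+ t
    triple = ℤ-Solver.solve-∀
    cancel : ∀ t → t ℤ.+ t ℤ.- t ≡ t
    cancel = ℤ-Solver.solve-∀
    move : ∀ {a b c} → a + b ≡ c → a ≡ c - b
    move {a} {b} eq = trans (solve 2 (λ a b → a := (a :+ b) :- b) refl a b) (cong (_- b) eq)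

  -- Peak state transfer from i to j at time t, relative to a resolution R.
  module Peak (i j : V) (t : ℕ) (i≢j : i ≢ j) (R : Resolution)
    (peak : abs ((B_ t) i j) ≡ sum (λ r → abs (Resolution.E R r i j)))
    (nonzero : ∃ λ r → Resolution.E R r i j ≢ 0#) where
    open Resolution R

    B≢0 : (B_ t) i j ≢ 0#
    B≢0 B≡0 = proj₂ nonzero (abs-zero (sum-nonneg-zero (λ r → abs (E r i j)) (λ r → abs-nonneg (E r i j))
      (trans (sym peak) (abs-unique ≤-refl (sym (cong (λ z → z * z) B≡0)))) (proj₁ nonzero)))

    extremal : ∀ r → E r i j ≢ 0# → T (θ r) t * T (θ r) t ≡ 1#
    extremal = triangle-equality (λ r → T (θ r) t) (λ r → E r i j)
      (λ r Eij≢0 → eigenvalue-bound (column r j) i Eij≢0 t)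
      (trans (cong abs (sym (B-resolved t i j))) peak)

    B-triple : (B_ (3 ℕ.* t)) i j ≡ (B_ t) i j
    B-triple = trans (B-resolved (3 ℕ.* t) i j) (trans (sum-cong-≗ term) (sym (B-resolved t i j)))
      where
      term : ∀ r → T (θ r) (3 ℕ.* t) * E r i j ≡ T (θ r) t * E r i j
      term r with E r i j ≟ᴿ 0#
      ... | yes E≡0 = trans (cong (T (θ r) (3 ℕ.* t) *_) E≡0)
          (trans (zeroʳ _) (sym (trans (cong (T (θ r) t *_) E≡0) (zeroʳ _))))
      ... | no  E≢0 = cong (_* E r i j) (T-triple (θ r) t (extremal r E≢0))

    reached : j ≡ i ⊕ ℤ.+ t ⊎ j ≡ i ⊕ ℤ.- (ℤ.+ t)
    reached = B-nonzero t i j B≢0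

    n∣4t : ℤ.+ n ∣ ℤ.+ 4 ℤ.* ℤ.+ t
    n∣4t = cases reached (B-nonzero (3 ℕ.* t) i j λ B≡0 → B≢0 (trans (sym B-triple) B≡0))
      where
      3t = ℤ.+ (3 ℕ.* t)
      difference : ∀ {a b} k → j ≡ i ⊕ a → j ≡ i ⊕ b → k ℤ.* (a ℤ.- b) ≡ ℤ.+ 4 ℤ.* ℤ.+ t →
          ℤ.+ n ∣ ℤ.+ 4 ℤ.* ℤ.+ t
      difference {a} {b} k ja jb eq = subst (ℤ.+ n ∣_) eq (∣n⇒∣m*n k (⊕-injective i a b (trans (sym ja) jb)))
      eq₁ : ∀ t → -[1+ 1 ] ℤ.* (t ℤ.- ℤ.+ 3 ℤ.* t) ≡ ℤ.+ 4 ℤ.* t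
      eq₁ = ℤ-Solver.solve-∀
      eq₂ : ∀ t → 1ℤ ℤ.* (t ℤ.- ℤ.- (ℤ.+ 3 ℤ.* t)) ≡ ℤ.+ 4 ℤ.* t
      eq₂ = ℤ-Solver.solve-∀
      eq₃ : ∀ t → -1ℤ ℤ.* (ℤ.- t ℤ.- ℤ.+ 3 ℤ.* t) ≡ ℤ.+ 4 ℤ.* t
      eq₃ = ℤ-Solver.solve-∀
      eq₄ : ∀ t → ℤ.+ 2 ℤ.* (ℤ.- t ℤ.- ℤ.- (ℤ.+ 3 ℤ.* t)) ≡ ℤ.+ 4 ℤ.* t
      eq₄ = ℤ-Solver.solve-∀
      3t≡ = ℤ.pos-* 3 t
      cases : j ≡ i ⊕ ℤ.+ t ⊎ j ≡ i ⊕ ℤ.- (ℤ.+ t) → j ≡ i ⊕ 3t ⊎ j ≡ i ⊕ ℤ.- 3t → ℤ.+ n ∣ ℤ.+ 4 ℤ.* ℤ.+ t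
      cases (inj₁ p) (inj₁ q) = difference {ℤ.+ t} {3t} -[1+ 1 ] p q
        (trans (cong (λ z → -[1+ 1 ] ℤ.* (ℤ.+ t ℤ.- z)) 3t≡) (eq₁ (ℤ.+ t)))
      cases (inj₁ p) (inj₂ q) = difference {ℤ.+ t} {ℤ.- 3t} 1ℤ p q
        (trans (cong (λ z → 1ℤ ℤ.* (ℤ.+ t ℤ.- ℤ.- z)) 3t≡) (eq₂ (ℤ.+ t)))
      cases (inj₂ p) (inj₁ q) = difference {ℤ.- (ℤ.+ t)} {3t} -1ℤ p q
        (trans (cong (λ z → -1ℤ ℤ.* (ℤ.- (ℤ.+ t) ℤ.- z)) 3t≡) (eq₃ (ℤ.+ t)))
      cases (inj₂ p) (inj₂ q) = difference {ℤ.- (ℤ.+ t)} {ℤ.- 3t} (ℤ.+ 2) p q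
        (trans (cong (λ z → ℤ.+ 2 ℤ.* (ℤ.- (ℤ.+ t) ℤ.- ℤ.- z)) 3t≡) (eq₄ (ℤ.+ t)))

    n∤t : ¬ ℤ.+ n ∣ ℤ.+ t
    n∤t n∣t = [ (λ j≡ → i≢j (sym (trans j≡ (⊕-fix i (ℤ.+ t) n∣t))))
              , (λ j≡ → i≢j (sym (trans j≡ (⊕-fix i (ℤ.- (ℤ.+ t)) (∣m⇒∣-m n∣t))))) ]′ reached

    only-quarter-turns : (∃[ m ] n ≡ 2 ℕ.* m × j ≡ i ⊕ ℤ.+ m) ⊎
      (∃[ ℓ ] n ≡ 4 ℕ.* ℓ × (j ≡ i ⊕ ℤ.+ ℓ ⊎ j ≡ i ⊕ ℤ.- (ℤ.+ ℓ)))
    only-quarter-turns = [ inj₁ ∘ half , inj₂ ∘ quarter ]′ (quarter-turns {ℤ.+ t} n∣4t n∤t)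
      where
      negate : ∀ {a b} → ℤ.+ n ∣ (a ℤ.- b) → ℤ.+ n ∣ (ℤ.- a ℤ.- ℤ.- b)
      negate {a} {b} d = subst (ℤ.+ n ∣_) (eq a b) (∣m⇒∣-m d)
        where
        eq : ∀ a b → ℤ.- (a ℤ.- b) ≡ ℤ.- a ℤ.- ℤ.- b
        eq = ℤ-Solver.solve-∀
      negate′ : ∀ {a b} → ℤ.+ n ∣ (a ℤ.- ℤ.- b) → ℤ.+ n ∣ (ℤ.- a ℤ.- b)
      negate′ {a} {b} d = subst (ℤ.+ n ∣_) (eq a b) (∣m⇒∣-m d)
        where
        eq : ∀ a b → ℤ.- (a ℤ.- ℤ.- b) ≡ ℤ.- a ℤ.- b
        eq = ℤ-Solver.solve-∀
      move : ∀ a b → j ≡ i ⊕ a → ℤ.+ n ∣ (a ℤ.- b) → j ≡ i ⊕ b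
      move a b j≡ d = trans j≡ (⊕-cong i a b d)
      half : (∃[ m ] n ≡ 2 ℕ.* m × ℤ.+ n ∣ ℤ.+ t ℤ.- ℤ.+ m) → ∃[ m ] n ≡ 2 ℕ.* m × j ≡ i ⊕ ℤ.+ m
      half (m , n≡2m , d) = m , n≡2m , [ (λ j≡ → move (ℤ.+ t) (ℤ.+ m) j≡ d) ,
          (λ j≡ → move (ℤ.- (ℤ.+ t)) (ℤ.+ m) j≡ d′) ]′ reached
        where
        n≡m+m : ℤ.+ n ≡ ℤ.+ m ℤ.+ ℤ.+ m
        n≡m+m = cong ℤ.+_ (trans n≡2m (cong (m ℕ.+_) (ℕ.+-identityʳ m)))
        eq : ∀ t m → ℤ.- (t ℤ.- m ℤ.+ (m ℤ.+ m)) ≡ ℤ.- t ℤ.- m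
        eq = ℤ-Solver.solve-∀
        d′ : ℤ.+ n ∣ (ℤ.- (ℤ.+ t) ℤ.- ℤ.+ m)
        d′ = subst (ℤ.+ n ∣_) (eq (ℤ.+ t) (ℤ.+ m))
            (∣m⇒∣-m (∣m∣n⇒∣m+n d (divides 1ℤ (trans (sym n≡m+m) (sym (ℤ.*-identityˡ (ℤ.+ n)))))))
      quarter : (∃[ ℓ ] n ≡ 4 ℕ.* ℓ × ((ℤ.+ n ∣ (ℤ.+ t ℤ.- ℤ.+ ℓ)) ⊎ (ℤ.+ n ∣ (ℤ.+ t ℤ.- ℤ.- (ℤ.+ ℓ))))) →
        ∃[ ℓ ] n ≡ 4 ℕ.* ℓ × (j ≡ i ⊕ ℤ.+ ℓ ⊎ j ≡ i ⊕ ℤ.- (ℤ.+ ℓ))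
      quarter (ℓ , n≡4ℓ , inj₁ d) = ℓ , n≡4ℓ , [ (λ j≡ → inj₁ (move (ℤ.+ t) (ℤ.+ ℓ) j≡ d))
        , (λ j≡ → inj₂ (move (ℤ.- (ℤ.+ t)) (ℤ.- (ℤ.+ ℓ)) j≡ (negate {ℤ.+ t} {ℤ.+ ℓ} d))) ]′ reached
      quarter (ℓ , n≡4ℓ , inj₂ d) = ℓ , n≡4ℓ , [ (λ j≡ → inj₂ (move (ℤ.+ t) (ℤ.- (ℤ.+ ℓ)) j≡ d))
        , (λ j≡ → inj₁ (move (ℤ.- (ℤ.+ t)) (ℤ.+ ℓ) j≡ (negate′ {ℤ.+ t} {ℤ.+ ℓ} d))) ]′ reached

  peak-transfer-quarter-turns : ∀ i j t → PeakStateTransfer i j t →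
    (∃[ m ] n ≡ 2 ℕ.* m × j ≡ i ⊕ ℤ.+ m) ⊎
    (∃[ ℓ ] n ≡ 4 ℕ.* ℓ × (j ≡ i ⊕ ℤ.+ ℓ ⊎ j ≡ i ⊕ ℤ.- (ℤ.+ ℓ)))
  peak-transfer-quarter-turns i j t (i≢j , _ , S , peak , nonzero) =
    Peak.only-quarter-turns i j t i≢j (Decomposed.resolution S) peak nonzero

-- The spectral decomposition for n = 4 ℓ

module ResolutionDecomposition (ℝ : CompleteOrderedField) (n : ℕ) (3≤n : 3 ℕ.≤ n) where
  open RealField ℝ
  open CycleWalk ℝ n 3≤n
  open CycleSpectrum ℝ n 3≤n

  -- A resolution with distinct θ and symmetric, nonzero E is a spectral
  -- decomposition.
  module Decompose (resolution : Resolution)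
    (θ-distinct : ∀ {q r} → Resolution.θ resolution q ≡ Resolution.θ resolution r → q ≡ r)
    (E-symmetric : ∀ r u v → Resolution.E resolution r u v ≡ Resolution.E resolution r v u)
    (E-nonzero : ∀ r → ∃ λ u → ∃ λ v → Resolution.E resolution r u v ≢ 0#) where
    open Resolution resolution

    -- Row u of E r is its column u, an eigenvector for θ r.
    E-kills : ∀ {φ y} → Eigenspace 𝐁 φ y → ∀ r → θ r ≢ φ → ∀ u → (E r $ᵥ y) u ≡ 0#
    E-kills {φ} {y} By≡φy r θ≢φ u = trans (sum-cong-≗ λ v → cong (_* y v) (E-symmetric r u v))
      (orthogonal θ≢φ (column r u) By≡φy)

    E-total : ∀ y u → sum (λ r → (E r $ᵥ y) u) ≡ y u
    E-total y u = begin
      sum (λ r → sum (λ v → E r u v * y v))   ≡⟨ ∑-comm (λ r v → E r u v * y v) ⟩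
      sum (λ v → sum (λ r → E r u v * y v))
        ≡⟨ sum-cong-≗ (λ v → trans (sym (*-distribʳ-sum (y v) (λ r → E r u v))) (cong (_* y v) (sum-E u v))) ⟩
      sum (λ v → δ u v * y v)                 ≡⟨ sum-δ u y ⟩
      y u                                     ∎
      where open ≡-Reasoning

    E-fixes : ∀ r {y} → Eigenspace 𝐁 (θ r) y → ∀ u → (E r $ᵥ y) u ≡ y u
    E-fixes r {y} By≡θy u = trans
      (sym (sum-single (λ q → (E q $ᵥ y) u) r λ q q≢r → E-kills By≡θy q (λ θq≡θr → q≢r (θ-distinct θq≡θr)) u))
      (E-total y u)

    E-eigen : ∀ r x → Eigenspace 𝐁 (θ r) (E r $ᵥ x)
    E-eigen r x u = begin
      sum (λ k → 𝐁 u k * sum (λ v → E r k v * x v))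
        ≡⟨ sum-cong-≗ (λ k → *-distribˡ-sum (𝐁 u k) (λ v → E r k v * x v)) ⟩
      sum (λ k → sum (λ v → 𝐁 u k * (E r k v * x v)))
        ≡⟨ ∑-comm (λ k v → 𝐁 u k * (E r k v * x v)) ⟩
      sum (λ v → sum (λ k → 𝐁 u k * (E r k v * x v)))
        ≡⟨ sum-cong-≗ (λ v → trans (sum-cong-≗ λ k → sym (*-assoc (𝐁 u k) (E r k v) (x v)))
             (trans (sym (*-distribʳ-sum (x v) (λ k → 𝐁 u k * E r k v)))
             (trans (cong (_* x v) (column r v u)) (*-assoc (θ r) (E r u v) (x v))))) ⟩
      sum (λ v → θ r * (E r u v * x v))
        ≡⟨ sym (*-distribˡ-sum (θ r) (λ v → E r u v * x v)) ⟩
      θ r * sum (λ v → E r u v * x v) ∎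
      where open ≡-Reasoning

    projection : ∀ r → IsOrthogonalProjection (E r) (Eigenspace 𝐁 (θ r))
    projection r x = E-eigen r x , λ y By≡θy → begin
      ⟨ (λ v → x v - (E r $ᵥ x) v) , y ⟩    ≡⟨ ⟨⟩-minus x (E r $ᵥ x) y ⟩
      ⟨ x , y ⟩ - ⟨ E r $ᵥ x , y ⟩
        ≡⟨ cong (λ z → ⟨ x , y ⟩ - z) (adjoint (E r) (E-symmetric r) x y) ⟩
      ⟨ x , y ⟩ - ⟨ x , E r $ᵥ y ⟩
        ≡⟨ cong (λ z → ⟨ x , y ⟩ - z) (sum-cong-≗ λ v → cong (x v *_) (E-fixes r By≡θy v)) ⟩
      ⟨ x , y ⟩ - ⟨ x , y ⟩                 ≡⟨ -‿inverseʳ ⟨ x , y ⟩ ⟩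
      0#                                    ∎
      where open ≡-Reasoning

    -- An eigenvector for any other value would be killed by every E r.
    exhaustive : ∀ φ → IsEigenvalue 𝐁 φ → ∃ λ r → θ r ≡ φ
    exhaustive φ (y , By≡φy , u , yu≢0) = search θ (λ none → yu≢0 (trans (sym (E-total y u))
        (sum-zero (λ r → (E r $ᵥ y) u) λ r → E-kills By≡φy r (none r) u)))
      where
      search : ∀ {m} (f : Fin m → R) → ¬ (∀ r → f r ≢ φ) → ∃ λ r → f r ≡ φ
      search f ¬none with any? (λ r → f r ≟ᴿ φ)
      ... | yes found = found
      ... | no  ¬some = contradiction (λ r eq → ¬some (r , eq)) ¬none

    decomposition : SpectralDecomposition 𝐁
    decomposition = record
      { size = size
      ; θ = θ
      ; E = E
      ; θ-distinct = θ-distinct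
      ; θ-eigenvalue = λ r → (λ u → E r u (proj₁ (proj₂ (E-nonzero r)))) ,
          column r (proj₁ (proj₂ (E-nonzero r)))
          , proj₁ (E-nonzero r) , proj₂ (proj₂ (E-nonzero r))
      ; θ-exhaustive = exhaustive
      ; E-projection = projection
      ; decomposes = B-resolved 1
      }

-- Trapezoidal sums of solutions of the three-term recurrence.
module TrapezoidalRule (ℝ : CompleteOrderedField) where
  open RealField ℝ
  open Chebyshev ℝ

  -- Weights 2, …, 2, 1.
  endWeight : ∀ {m} → Fin (suc m) → R
  endWeight {zero}  zero    = 1#
  endWeight {suc m} zero    = 2#
  endWeight {suc m} (suc k) = endWeight k

  -- Weights 1, 2, …, 2, 1.
  weight : ∀ {m} → Fin (suc m) → R
  weight         zero    = 1#
  weight {suc m} (suc k) = endWeight k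

  endWeight-pos : ∀ {m} (k : Fin (suc m)) → 0# < endWeight k
  endWeight-pos {zero}  zero    = 0<1
  endWeight-pos {suc m} zero    = +-pos 0<1 0≤1
  endWeight-pos {suc m} (suc k) = endWeight-pos k

  weight-pos : ∀ {m} (k : Fin (suc m)) → 0# < weight k
  weight-pos {zero}  zero    = 0<1
  weight-pos {suc m} zero    = 0<1
  weight-pos {suc m} (suc k) = endWeight-pos k

  -- With G z = f (z + 1) - f (z - 1), the recurrence gives
  -- 2 (κ - 1) (f z + f (z + 1)) = G (z + 1) - G z, and the weighted sum is the sum
  -- of f over both ends of m + 1 consecutive unit intervals.
  telescope : ∀ {κ f} → Recurrent κ f → ∀ m z →
    2# * (κ - 1#) * (f z + sum (λ (k : Fin (suc m)) → endWeight k * f (z ℤ.+ ℤ.+ suc (toℕ k)))) ≡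
    (f (z ℤ.+ ℤ.+ suc (suc m)) - f (z ℤ.+ ℤ.+ m)) - (f (z ℤ.+ 1ℤ) - f (z ℤ.- 1ℤ))
  telescope {κ} {f} rec zero z = begin
    2# * (κ - 1#) * (f z + (1# * f (z ℤ.+ 1ℤ) + 0#))
      ≡⟨ solve 3 (λ κ a b → con (ℤ.+ 2) :* (κ :- con 1ℤ) :* (a :+ (con 1ℤ :* b :+ con 0ℤ))
           := (con (ℤ.+ 2) :* κ :* b :- a) :- a :+ con (ℤ.+ 2) :* κ :* a :- con (ℤ.+ 2) :* b) refl κ (f z)
               (f (z ℤ.+ 1ℤ)) ⟩
    (2# * κ * f (z ℤ.+ 1ℤ) - f z) - f z + 2# * κ * f z - 2# * f (z ℤ.+ 1ℤ)
      ≡⟨ cong₂ (λ x y → (x - f z) - f z + y - 2# * f (z ℤ.+ 1ℤ)) (sym (rec (z ℤ.+ 1ℤ))) (sym (rec z)) ⟩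
    (f (z ℤ.+ 1ℤ ℤ.+ 1ℤ) + f (z ℤ.+ 1ℤ ℤ.- 1ℤ) - f z) - f z + (f (z ℤ.+ 1ℤ) + f (z ℤ.- 1ℤ)) - 2# * f
        (z ℤ.+ 1ℤ)
      ≡⟨ cong₂ (λ x y → (f x + f y - f z) - f z + (f (z ℤ.+ 1ℤ) + f (z ℤ.- 1ℤ)) - 2# * f (z ℤ.+ 1ℤ))
          (ℤ.+-assoc z 1ℤ 1ℤ) (cancel z) ⟩
    (f (z ℤ.+ ℤ.+ 2) + f z - f z) - f z + (f (z ℤ.+ 1ℤ) + f (z ℤ.- 1ℤ)) - 2# * f (z ℤ.+ 1ℤ)
      ≡⟨ solve 4 (λ a b c d → (a :+ b :- b) :- b :+ (c :+ d) :- con (ℤ.+ 2) :* c := (a :- b) :- (c :- d)) refl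
           (f (z ℤ.+ ℤ.+ 2)) (f z) (f (z ℤ.+ 1ℤ)) (f (z ℤ.- 1ℤ)) ⟩
    (f (z ℤ.+ ℤ.+ 2) - f z) - (f (z ℤ.+ 1ℤ) - f (z ℤ.- 1ℤ))
      ≡⟨ cong (λ y → (f (z ℤ.+ ℤ.+ 2) - f y) - (f (z ℤ.+ 1ℤ) - f (z ℤ.- 1ℤ))) (sym (ℤ.+-identityʳ z)) ⟩
    (f (z ℤ.+ ℤ.+ 2) - f (z ℤ.+ 0ℤ)) - (f (z ℤ.+ 1ℤ) - f (z ℤ.- 1ℤ)) ∎
    where
    open ≡-Reasoning
    cancel : ∀ z → z ℤ.+ 1ℤ ℤ.- 1ℤ ≡ z
    cancel = ℤ-Solver.solve-∀
  telescope {κ} {f} rec (suc m) z = begin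
    2# * (κ - 1#) * (f z +
        (2# * f z′ + sum (λ (k : Fin (suc m)) → endWeight k * f (z ℤ.+ ℤ.+ suc (suc (toℕ k))))))
      ≡⟨ cong (λ y → 2# * (κ - 1#) * (f z + (2# * f z′ + y)))
           (sum-cong-≗ λ (k : Fin (suc m)) → cong (λ y → endWeight k * f y)
               (sym (ℤ.+-assoc z 1ℤ (ℤ.+ suc (toℕ k))))) ⟩
    2# * (κ - 1#) * (f z + (2# * f z′ + rest))
      ≡⟨ solve 4 (λ κ a b r → con (ℤ.+ 2) :* (κ :- con 1ℤ) :* (a :+ (con (ℤ.+ 2) :* b :+ r))
           := con (ℤ.+ 2) :* (κ :- con 1ℤ) :* (a :+ (con 1ℤ :* b :+ con 0ℤ)) :+ con (ℤ.+ 2) :* (κ :- con 1ℤ)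
               :* (b :+ r)) refl κ (f z) (f z′) rest ⟩
    2# * (κ - 1#) * (f z + (1# * f z′ + 0#)) + 2# * (κ - 1#) * (f z′ + rest)
      ≡⟨ cong₂ _+_ (telescope {f = f} rec zero z) (telescope {f = f} rec m z′) ⟩
    ((f (z ℤ.+ ℤ.+ 2) - f (z ℤ.+ 0ℤ)) - G) + ((f (z′ ℤ.+ ℤ.+ suc (suc m)) - f (z′ ℤ.+ ℤ.+ m)) -
        (f (z′ ℤ.+ 1ℤ) - f (z′ ℤ.- 1ℤ)))
      ≡⟨ cong₂ (λ x y → ((f (z ℤ.+ ℤ.+ 2) - f (z ℤ.+ 0ℤ)) - G) + (x - y))
           (cong₂ (λ x y → f x - f y) (ℤ.+-assoc z 1ℤ (ℤ.+ suc (suc m))) (ℤ.+-assoc z 1ℤ (ℤ.+ m)))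
           (cong₂ (λ x y → f x - f y) (ℤ.+-assoc z 1ℤ 1ℤ) (ℤ.+-assoc z 1ℤ -1ℤ)) ⟩
    ((f (z ℤ.+ ℤ.+ 2) - f (z ℤ.+ 0ℤ)) - G) + ((f (z ℤ.+ ℤ.+ suc (suc (suc m))) - f (z ℤ.+ ℤ.+ suc m)) -
        (f (z ℤ.+ ℤ.+ 2) - f (z ℤ.+ 0ℤ)))
      ≡⟨ solve 3 (λ a g b → (a :- g) :+ (b :- a) := b :- g) refl (f (z ℤ.+ ℤ.+ 2) - f (z ℤ.+ 0ℤ)) G
           (f (z ℤ.+ ℤ.+ suc (suc (suc m))) - f (z ℤ.+ ℤ.+ suc m)) ⟩
    (f (z ℤ.+ ℤ.+ suc (suc (suc m))) - f (z ℤ.+ ℤ.+ suc m)) - G ∎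
    where
    open ≡-Reasoning
    z′ = z ℤ.+ 1ℤ
    G = f (z ℤ.+ 1ℤ) - f (z ℤ.- 1ℤ)
    rest = sum (λ (k : Fin (suc m)) → endWeight k * f (z′ ℤ.+ ℤ.+ suc (toℕ k)))

-- The spectral decomposition of B on the cycle with n = 4 ℓ vertices.
module QuarterTransfer (ℝ : CompleteOrderedField) (n : ℕ) (3≤n : 3 ℕ.≤ n) (ℓ-1 : ℕ) (n≡4ℓ : n ≡ 4 ℕ.* suc ℓ-1)
    where
  open RealField ℝ
  open Chebyshev ℝ
  open CycleWalk ℝ n 3≤n
  open CycleSpectrum ℝ n 3≤n
  open ResolutionDecomposition ℝ n 3≤n
  open TrapezoidalRule ℝ
  open Rotation {n}
  open LargestZero (chebyshev-zero ℓ-1) using (c)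
  open PrimitiveCosine (chebyshev-zero ℓ-1)

  -- The indices k of the distinct eigenvalues cos (2 π k / n), for 0 ≤ k ≤ n / 2.
  Index : Set
  Index = Fin (suc (ℓ ℕ.+ ℓ))

  cos-mod : ∀ y z → ℤ.+ n ∣ y ℤ.- z → cos y ≡ cos z
  cos-mod y z = cos-cong {y} {z} ∘ subst (λ m → ℤ.+ m ∣ y ℤ.- z) n≡4ℓ

  totalWeight : R
  totalWeight = sum (weight {ℓ ℕ.+ ℓ})

  totalWeight-pos : 0# < totalWeight
  totalWeight-pos = +-pos 0<1 (sum-nonneg (λ k → weight (suc k)) λ k → <⇒≤ (weight-pos {ℓ ℕ.+ ℓ} (suc k)))

  -- The weights normalised to total 1.
  ω : Index → R
  ω k = weight k * totalWeight ⁻¹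

  ω-pos : ∀ k → 0# < ω k
  ω-pos k = *-pos (weight-pos k) (⁻¹-pos totalWeight-pos)

  eigenvalue : Index → R
  eigenvalue k = T c (toℕ k)

  -- A representative of u - v modulo n.
  offset : V → V → ℤ
  offset u v = ℤ.+ toℕ u ℤ.- ℤ.+ toℕ v

  -- The projection onto the eigenspace of cos (2 π k / n), with (u , v) entry
  -- proportional to cos (2 π k (u - v) / n).
  projector : Index → Matrix V V
  projector k u v = ω k * cos (ℤ.+ toℕ k ℤ.* offset u v)

  cos-offset-⊕ : ∀ (k : Index) u a v → cos (ℤ.+ toℕ k ℤ.* offset (u ⊕ a) v) ≡ cos
      (ℤ.+ toℕ k ℤ.* offset u v ℤ.+ ℤ.+ toℕ k ℤ.* a)
  cos-offset-⊕ k u a v = cos-mod (K ℤ.* offset (u ⊕ a) v) (K ℤ.* offset u v ℤ.+ K ℤ.* a)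
    (subst (ℤ.+ n ∣_) (regroup K (ℤ.+ toℕ (u ⊕ a)) (ℤ.+ toℕ u) a (ℤ.+ toℕ v)) (∣n⇒∣m*n K (toℕ-⊕ u a)))
    where
    K = ℤ.+ toℕ k
    regroup : ∀ k x u a v → k ℤ.* (x ℤ.- (u ℤ.+ a)) ≡ k ℤ.* (x ℤ.- v) ℤ.- (k ℤ.* (u ℤ.- v) ℤ.+ k ℤ.* a)
    regroup = ℤ-Solver.solve-∀

  projector-column : ∀ k v → Eigenspace 𝐁 (eigenvalue k) (λ u → projector k u v)
  projector-column k v = eigen-from-recurrence (eigenvalue k) (λ u → projector k u v) λ u → begin
    ω k * cos (K ℤ.* offset (u ⊕ 1ℤ) v) + ω k * cos (K ℤ.* offset (u ⊕ -1ℤ) v)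
      ≡⟨ cong₂ (λ x y → ω k * x + ω k * y)
           (trans (cos-offset-⊕ k u 1ℤ v) (cong (λ z → cos (K ℤ.* offset u v ℤ.+ z)) (ℤ.*-identityʳ K)))
           (trans (cos-offset-⊕ k u -1ℤ v) (cong (λ z → cos (K ℤ.* offset u v ℤ.+ z))
               (trans (ℤ.*-comm K -1ℤ) (ℤ.-1*i≡-i K)))) ⟩
    ω k * cos (K ℤ.* offset u v ℤ.+ K) + ω k * cos (K ℤ.* offset u v ℤ.- K)
      ≡⟨ trans (sym (distribˡ (ω k) _ _)) (cong (ω k *_) (C-product c K (K ℤ.* offset u v))) ⟩
    ω k * (2# * eigenvalue k * cos (K ℤ.* offset u v))
      ≡⟨ solve 3 (λ w θ x → w :* (con (ℤ.+ 2) :* θ :* x) := con (ℤ.+ 2) :* θ :* (w :* x)) refl (ω k)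
          (eigenvalue k) _ ⟩
    2# * eigenvalue k * projector k u v ∎
    where
    open ≡-Reasoning
    K = ℤ.+ toℕ k

  projector-symmetric : ∀ k u v → projector k u v ≡ projector k v u
  projector-symmetric k u v =
      cong (ω k *_) (trans (cong cos (flip-offset (ℤ.+ toℕ k) (ℤ.+ toℕ u) (ℤ.+ toℕ v)))
      (C-even c (ℤ.+ toℕ k ℤ.* offset v u)))
    where
    flip-offset : ∀ k u v → k ℤ.* (u ℤ.- v) ≡ ℤ.- (k ℤ.* (v ℤ.- u))
    flip-offset = ℤ-Solver.solve-∀

  -- The weighted sum over half a period is the plain sum over a whole period, by
  -- the evenness of the cosine; it vanishes since cos d is not 1.
  cosine-sum : ∀ d → ¬ ℤ.+ n ∣ d → sum (λ (k : Index) → weight k * cos (ℤ.+ toℕ k ℤ.* d)) ≡ 0#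
  cosine-sum d n∤d = *-zero-cancel (*-nonzero 2≢0 κ-1≢0) (begin
    2# * (κ - 1#) * (1# * f 0ℤ + rest)
      ≡⟨ cong₂ (λ x y → 2# * (κ - 1#) * (x + y)) (*-identityˡ (f 0ℤ))
           (sum-cong-≗ λ (k : Fin (ℓ ℕ.+ ℓ)) → cong (λ z → endWeight k * f z)
               (sym (ℤ.+-identityˡ (ℤ.+ suc (toℕ k))))) ⟩
    2# * (κ - 1#) * (f 0ℤ + sum (λ (k : Fin (ℓ ℕ.+ ℓ)) → endWeight k * f (0ℤ ℤ.+ ℤ.+ suc (toℕ k))))
      ≡⟨ telescope {f = f} recurrent (ℓ-1 ℕ.+ ℓ) 0ℤ ⟩
    (f (ℤ.+ suc (ℓ ℕ.+ ℓ)) - f (ℤ.+ (ℓ-1 ℕ.+ ℓ))) - (f 1ℤ - f -1ℤ)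
      ≡⟨ cong₂ (λ x y → (x - f (ℤ.+ (ℓ-1 ℕ.+ ℓ))) - (y - f -1ℤ)) reflect even ⟩
    (f (ℤ.+ (ℓ-1 ℕ.+ ℓ)) - f (ℤ.+ (ℓ-1 ℕ.+ ℓ))) - (f -1ℤ - f -1ℤ)
      ≡⟨ solve 2 (λ a b → (a :- a) :- (b :- b) := con 0ℤ) refl (f (ℤ.+ (ℓ-1 ℕ.+ ℓ))) (f -1ℤ) ⟩
    0# ∎)
    where
    open ≡-Reasoning
    κ = cos d
    f : ℤ → R
    f z = cos (z ℤ.* d)
    rest = sum (λ (k : Fin (ℓ ℕ.+ ℓ)) → endWeight k * f (ℤ.+ suc (toℕ k)))
    κ-1≢0 : κ - 1# ≢ 0#
    κ-1≢0 eq = n∤d (subst (λ m → ℤ.+ m ∣ d) (sym n≡4ℓ) (cos≡1⇒period d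
      (trans (solve 1 (λ κ → κ := (κ :- con 1ℤ) :+ con 1ℤ) refl κ)
          (trans (cong (_+ 1#) eq) (+-identityˡ 1#)))))
    recurrent : Recurrent κ f
    recurrent z = trans (cong₂ (λ a b → cos a + cos b) (up z d) (down z d)) (C-product c d (z ℤ.* d))
      where
      up : ∀ z d → (z ℤ.+ 1ℤ) ℤ.* d ≡ z ℤ.* d ℤ.+ d
      up = ℤ-Solver.solve-∀
      down : ∀ z d → (z ℤ.- 1ℤ) ℤ.* d ≡ z ℤ.* d ℤ.- d
      down = ℤ-Solver.solve-∀
    even : f 1ℤ ≡ f -1ℤ
    even = trans (sym (C-even c (1ℤ ℤ.* d))) (cong cos (lemma d))
      where
      lemma : ∀ d → ℤ.- (1ℤ ℤ.* d) ≡ -1ℤ ℤ.* d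
      lemma = ℤ-Solver.solve-∀
    -- (2 ℓ + 1) + (2 ℓ - 1) = n.
    reflect : f (ℤ.+ suc (ℓ ℕ.+ ℓ)) ≡ f (ℤ.+ (ℓ-1 ℕ.+ ℓ))
    reflect = trans (cos-mod (ℤ.+ suc (ℓ ℕ.+ ℓ) ℤ.* d) (ℤ.- (ℤ.+ (ℓ-1 ℕ.+ ℓ) ℤ.* d))
        (divides d (trans (lemma (ℤ.+ ℓ-1) d) (cong (d ℤ.*_) (sym (trans (cong ℤ.+_ n≡4ℓ) (ℤ.pos-* 4 ℓ)))))))
      (C-even c (ℤ.+ (ℓ-1 ℕ.+ ℓ) ℤ.* d))
      where
      lemma : ∀ l d → (1ℤ ℤ.+ ((1ℤ ℤ.+ l) ℤ.+ (1ℤ ℤ.+ l))) ℤ.* d ℤ.- ℤ.- ((l ℤ.+ (1ℤ ℤ.+ l)) ℤ.* d) ≡ d ℤ.*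
          (ℤ.+ 4 ℤ.* (1ℤ ℤ.+ l))
      lemma = ℤ-Solver.solve-∀

  projector-sum : ∀ u v → sum (λ k → projector k u v) ≡ δ u v
  projector-sum u v = trans (sum-cong-≗ regroup) (trans (sym (*-distribˡ-sum (totalWeight ⁻¹) summand))
      (total (u ≟ v)))
    where
    summand : Index → R
    summand k = weight k * cos (ℤ.+ toℕ k ℤ.* offset u v)
    regroup : ∀ k → projector k u v ≡ totalWeight ⁻¹ * summand k
    regroup k = solve 3 (λ w i x → w :* i :* x := i :* (w :* x)) refl (weight k) (totalWeight ⁻¹) _
    total : Dec (u ≡ v) → totalWeight ⁻¹ * sum summand ≡ δ u v
    total (yes refl) = trans {j = totalWeight ⁻¹ * totalWeight}
        (cong (totalWeight ⁻¹ *_) (sum-cong-≗ λ (k : Index) → trans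
        (cong (λ z → weight k * cos z) (trans (cong (ℤ.+ toℕ k ℤ.*_) (ℤ.+-inverseʳ (ℤ.+ toℕ u)))
            (ℤ.*-zeroʳ (ℤ.+ toℕ k))))
        (*-identityʳ (weight {ℓ ℕ.+ ℓ} k))))
      (trans (*-comm (totalWeight ⁻¹) totalWeight)
          (trans (*-inverse totalWeight (≢-sym (<⇒≢ totalWeight-pos))) (sym (δ-refl u))))
    total (no u≢v) = trans (cong (totalWeight ⁻¹ *_) (cosine-sum (offset u v) (u≢v ∘ congruent⇒≡)))
      (trans (zeroʳ _) (sym (δ-off u≢v)))

  resolution : Resolution
  resolution = record { size = suc (ℓ ℕ.+ ℓ) ; θ = eigenvalue ; E = projector ; column =
      projector-column ; sum-E = projector-sum }

  eigenvalue-injective : ∀ {j k} → eigenvalue j ≡ eigenvalue k → j ≡ k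
  eigenvalue-injective {j} {k} eq = toℕ-injective (T-injective (ℕ.≤-pred (toℕ<n j)) (ℕ.≤-pred (toℕ<n k)) eq)

  projector-diagonal : ∀ k u → projector k u u ≡ ω k
  projector-diagonal k u =
      trans (cong (λ z → ω k * cos z) (trans (cong (ℤ.+ toℕ k ℤ.*_) (ℤ.+-inverseʳ (ℤ.+ toℕ u)))
      (ℤ.*-zeroʳ (ℤ.+ toℕ k))))
    (*-identityʳ (ω k))

  module From (i : V) where
    open Decompose resolution eigenvalue-injective projector-symmetric
      (λ k → i , i , λ eq → <⇒≢ (ω-pos k) (sym (trans (sym (projector-diagonal k i)) eq)))

    -- The cosines at multiples of a quarter turn are 0, 1 or -1, for the square of
    -- 2 x ^ 2 - 1 is 1.
    cos-quarter : ∀ (k : Index) → let x = cos (ℤ.+ toℕ k ℤ.* ℤ.+ ℓ) in (x * x) * (x * x) ≡ x * x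
    cos-quarter k = *-cancelˡ (*-nonzero 2≢0 2≢0) (begin
      2# * 2# * ((x * x) * (x * x))
        ≡⟨ solve 1 (λ x → con (ℤ.+ 2) :* con (ℤ.+ 2) :* ((x :* x) :* (x :* x))
             := (con (ℤ.+ 2) :* x :* x :- con 1ℤ) :* (con (ℤ.+ 2) :* x :* x :- con 1ℤ) :- con 1ℤ :+ con
                 (ℤ.+ 2) :* con (ℤ.+ 2) :* (x :* x)) refl x ⟩
      (2# * x * x - 1#) * (2# * x * x - 1#) - 1# + 2# * 2# * (x * x)
        ≡⟨ cong (λ z → z * z - 1# + 2# * 2# * (x * x)) (sym (double a)) ⟩
      y * y - 1# + 2# * 2# * (x * x)
        ≡⟨ cong (λ z → z - 1# + 2# * 2# * (x * x)) y²≡1 ⟩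
      1# - 1# + 2# * 2# * (x * x)
        ≡⟨ solve 1 (λ x → con 1ℤ :- con 1ℤ :+ con (ℤ.+ 2) :* con (ℤ.+ 2) :* (x :* x) := con (ℤ.+ 2) :* con
            (ℤ.+ 2) :* (x :* x)) refl x ⟩
      2# * 2# * (x * x) ∎)
      where
      open ≡-Reasoning
      a = ℤ.+ toℕ k ℤ.* ℤ.+ ℓ
      x = cos a
      y = cos (a ℤ.+ a)
      double : ∀ a → cos (a ℤ.+ a) ≡ 2# * cos a * cos a - 1#
      double a = trans (solve 2 (λ p q → p := (p :+ q) :- q) refl (cos (a ℤ.+ a)) (cos (a ℤ.- a)))
        (cong₂ _-_ (C-product c a a) (cong cos (ℤ.+-inverseʳ a)))
      cos-4a≡1 : cos (a ℤ.+ a ℤ.+ (a ℤ.+ a)) ≡ 1#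
      cos-4a≡1 = cos-mod (a ℤ.+ a ℤ.+ (a ℤ.+ a)) 0ℤ (divides (ℤ.+ toℕ k)
        (trans (lemma (ℤ.+ toℕ k) (ℤ.+ ℓ))
            (cong (ℤ.+ toℕ k ℤ.*_) (sym (trans (cong ℤ.+_ n≡4ℓ) (ℤ.pos-* 4 ℓ))))))
        where
        lemma : ∀ k l → k ℤ.* l ℤ.+ k ℤ.* l ℤ.+ (k ℤ.* l ℤ.+ k ℤ.* l) ℤ.- 0ℤ ≡ k ℤ.* (ℤ.+ 4 ℤ.* l)
        lemma = ℤ-Solver.solve-∀
      y²≡1 : y * y ≡ 1#
      y²≡1 = *-cancelˡ 2≢0 (begin
        2# * (y * y)
          ≡⟨ solve 1 (λ y → con (ℤ.+ 2) :* (y :* y) := (con (ℤ.+ 2) :* y :* y :- con 1ℤ) :+ con 1ℤ) refl y ⟩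
        2# * y * y - 1# + 1#     ≡⟨ cong (_+ 1#) (trans (sym (double (a ℤ.+ a))) cos-4a≡1) ⟩
        1# + 1#                  ≡⟨ sym (*-identityʳ 2#) ⟩
        2# * 1#                  ∎)

    -- T (cos φ) ℓ = cos (ℓ φ) for φ = 2 π k / n.
    T-eigenvalue : ∀ k → T (eigenvalue k) ℓ ≡ cos (ℤ.+ toℕ k ℤ.* ℤ.+ ℓ)
    T-eigenvalue k = *-cancelˡ 2≢0 (begin
      2# * T (eigenvalue k) ℓ                     ≡⟨ sym (*-identityʳ _) ⟩
      2# * T (eigenvalue k) ℓ * 1#
        ≡⟨ cong (λ z → 2# * T (eigenvalue k) ℓ * cos z) (sym (ℤ.*-zeroʳ K)) ⟩
      2# * T (eigenvalue k) ℓ * f 0ℤ              ≡⟨ sym (product-formula {f = f} recurrent ℓ 0ℤ) ⟩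
      f (ℤ.+ ℓ) + f (ℤ.- (ℤ.+ ℓ))
        ≡⟨ cong (f (ℤ.+ ℓ) +_) (trans (cong cos (sym (ℤ.neg-distribʳ-* K (ℤ.+ ℓ)))) (C-even c (K ℤ.* ℤ.+ ℓ))) ⟩
      f (ℤ.+ ℓ) + f (ℤ.+ ℓ)
        ≡⟨ solve 1 (λ x → x :+ x := con (ℤ.+ 2) :* x) refl (f (ℤ.+ ℓ)) ⟩
      2# * f (ℤ.+ ℓ)                              ∎)
      where
      open ≡-Reasoning
      K = ℤ.+ toℕ k
      f : ℤ → R
      f z = cos (K ℤ.* z)
      recurrent : Recurrent (eigenvalue k) f
      recurrent z = trans (cong₂ (λ a b → cos a + cos b) (up K z) (down K z)) (C-product c K (K ℤ.* z))
        where
        up : ∀ k z → k ℤ.* (z ℤ.+ 1ℤ) ≡ k ℤ.* z ℤ.+ k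
        up = ℤ-Solver.solve-∀
        down : ∀ k z → k ℤ.* (z ℤ.- 1ℤ) ≡ k ℤ.* z ℤ.- k
        down = ℤ-Solver.solve-∀

    quarter-entry : ∀ k d → projector k i (i ⊕ shift d ℓ) ≡ ω k * cos (ℤ.+ toℕ k ℤ.* ℤ.+ ℓ)
    quarter-entry k d = begin
      projector k i v                                          ≡⟨ projector-symmetric k i v ⟩
      ω k * cos (K ℤ.* offset v i)
        ≡⟨ cong (ω k *_) (cos-offset-⊕ k i (shift d ℓ) i) ⟩
      ω k * cos (K ℤ.* offset i i ℤ.+ K ℤ.* shift d ℓ)
        ≡⟨ cong (λ z → ω k * cos z) (lemma K (ℤ.+ toℕ i) (shift d ℓ)) ⟩
      ω k * cos (K ℤ.* shift d ℓ)                              ≡⟨ cong (ω k *_) (either d) ⟩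
      ω k * cos (K ℤ.* ℤ.+ ℓ)                                  ∎
      where
      open ≡-Reasoning
      K = ℤ.+ toℕ k
      v = i ⊕ shift d ℓ
      lemma : ∀ k i s → k ℤ.* (i ℤ.- i) ℤ.+ k ℤ.* s ≡ k ℤ.* s
      lemma = ℤ-Solver.solve-∀
      either : ∀ d → cos (K ℤ.* shift d ℓ) ≡ cos (K ℤ.* ℤ.+ ℓ)
      either forward  = refl
      either backward = trans (cong cos (sym (ℤ.neg-distribʳ-* K (ℤ.+ ℓ)))) (C-even c (K ℤ.* ℤ.+ ℓ))

    quarter-transfer : ∀ d → PeakStateTransfer i (i ⊕ shift d ℓ) ℓ
    quarter-transfer d = distinct d , ℕ.s≤s ℕ.z≤n , decomposition , peak , zero , nonzero
      where
      v = i ⊕ shift d ℓ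
      ℓ<n : ℓ ℕ.< n
      ℓ<n = subst (ℓ ℕ.<_) (sym n≡4ℓ) (ℕ.m<m+n ℓ (ℕ.s≤s ℕ.z≤n))
      distinct : ∀ d → i ≢ i ⊕ shift d ℓ
      distinct forward     = ⊕-moves i ℓ (ℕ.s≤s ℕ.z≤n) ℓ<n
      distinct backward eq = ⊕-moves i ℓ (ℕ.s≤s ℕ.z≤n) ℓ<n (trans (sym (⊕-cancel′ i (ℤ.+ ℓ)))
          (cong (_⊕ ℤ.+ ℓ) (sym eq)))
      term : ∀ k → abs (projector k i v) ≡ T (eigenvalue k) ℓ * projector k i v
      term k = trans (cong abs (quarter-entry k d)) (trans (abs-unique nonneg square)
          (sym (cong₂ _*_ (T-eigenvalue k) (quarter-entry k d))))
        where
        x = cos (ℤ.+ toℕ k ℤ.* ℤ.+ ℓ)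
        nonneg : 0# ≤ x * (ω k * x)
        nonneg = subst (0# ≤_) (solve 2 (λ w x → w :* (x :* x) := x :* (w :* x)) refl (ω k) x)
            (*-nonneg _ _ (<⇒≤ (ω-pos k)) (²-nonneg x))
        square : x * (ω k * x) * (x * (ω k * x)) ≡ ω k * x * (ω k * x)
        square = trans (solve 2 (λ w x → x :* (w :* x) :* (x :* (w :* x)) := w :* w :* ((x :* x) :* (x :* x)))
            refl (ω k) x)
          (trans (cong (ω k * ω k *_) (cos-quarter k))
              (solve 2 (λ w x → w :* w :* (x :* x) := w :* x :* (w :* x)) refl (ω k) x))
      peak : abs ((B_ ℓ) i v) ≡ sum (λ k → abs (projector k i v))
      peak = trans (abs-unique (B-nonneg ℓ i v) refl)
        (trans (Resolution.B-resolved resolution ℓ i v) (sym (sum-cong-≗ term)))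
      nonzero : projector zero i v ≢ 0#
      nonzero eq = <⇒≢ (ω-pos zero) (sym (trans (sym (*-identityʳ (ω zero))) eq))

quarter-peak-transfer : ∀ ℝ n 3≤n ℓ → n ≡ 4 ℕ.* ℓ → let open ArcReversalWalk ℝ (cycle n 3≤n) in
  ∀ i d → PeakStateTransfer i (i ⊕ shift d ℓ) ℓ
quarter-peak-transfer ℝ n 3≤n zero      n≡0  i d = contradiction (subst (3 ℕ.≤_) n≡0 3≤n) λ ()
quarter-peak-transfer ℝ n 3≤n (suc ℓ-1) n≡4ℓ i d =
  QuarterTransfer.From.quarter-transfer ℝ n 3≤n ℓ-1 n≡4ℓ i d

open import Data.Nat.Base using (_*_; _≤_)
open import Data.Integer.Base using (+_; -_)

lemma4p2 :
  (ℝ : CompleteOrderedField) (n : ℕ) (3≤n : 3 ≤ n) (i : Fin n) →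
  let open ArcReversalWalk ℝ (cycle n 3≤n) in
  PeriodicAt n i
  × (∀ m → n ≡ 2 * m → PerfectStateTransfer i (i ⊕ + m) m)
  × (∀ ℓ → n ≡ 4 * ℓ →
       PeakStateTransfer i (i ⊕ + ℓ) ℓ × PeakStateTransfer i (i ⊕ - (+ ℓ)) ℓ)
  × (∀ j → i ≢ j →
       ¬ (∃[ m ] n ≡ 2 * m × j ≡ i ⊕ + m) →
       ¬ (∃[ ℓ ] n ≡ 4 * ℓ × (j ≡ i ⊕ + ℓ ⊎ j ≡ i ⊕ - (+ ℓ))) →
       ∀ t → ¬ PeakStateTransfer i j t)
lemma4p2 ℝ n 3≤n i =
    CycleWalk.periodic ℝ n 3≤n i
  , CycleWalk.antipodal-transfer ℝ n 3≤n i
  , (λ ℓ n≡4ℓ → quarter-peak-transfer ℝ n 3≤n ℓ n≡4ℓ i forward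
              , quarter-peak-transfer ℝ n 3≤n ℓ n≡4ℓ i backward)
  , (λ j _ ¬half ¬quarter t peak →
       [ ¬half , ¬quarter ]′ (PeakTransferObstruction.peak-transfer-quarter-turns ℝ n 3≤n i j t peak))
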